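{- For every integer $c\ge1$ and every integer $\ell\ge1$, \[ k^*(P_\ell,P_c)\le\delta(c)\cdot\ell \quad\text{and}\quad k^*(P_\ell,P_c)\ge(\delta(c)-o(1))\cdot\ell, \] where $\delta(c)$ is defined in the context and $o(1)$ stands for a non-negative function of $c$ and $\ell$ that tends to $0$ for $c$ fixed and $\ell\to\infty$.
   Context: Game: for a positive integer $k$, the $(P_\ell,P_c)$-avoidance game with tree size restriction $k$ is played by Builder and Painter on a vertex-colored graph (the board), initially empty. In each step Builder adds one new vertex with edges from some previously present vertices to it, so that the board always remains a forest all of whose components have at most $k$ vertices; Painter immediately and irrevocably colors it with color $1$ or $2$. Painter loses as soon as the board contains a path on $\ell$ vertices all colored $1$ or a path on $c$ vertices all colored $2$ ($P_m$ denotes the path on $m$ vertices). $k^*(P_\ell,P_c)$ is the smallest $k$ for which Builder can force Painter to lose within finitely many steps. Definition of $\delta(c)$: for integers $\ell,c\ge1$ let $W(\ell,c)$ be the set of sequences $\alpha=(\alpha_1,\dots,\alpha_d)$, $d=\ell+c-2$, with entries in $\{1,2\}$ having exactly $\ell-1$ ones and $c-1$ twos. Let $\nu_{i,s}:=1+|\{1\le j\le i:\alpha_j=s\}|$. Set $x_{1,0}:=x_{2,0}:=0$ and for $i=0,\dots,d$ in turn let $k_i:=1+\sum_{s\in\{1,2\}}\min_{j_1,j_2\ge0,\ j_1+j_2=\nu_{i,s}-1}(x_{s,j_1}+x_{s,j_2})$ and, if $i<d$, set $x_{s,\nu_{i,s}}:=k_i$ for $s=\alpha_{i+1}$; this defines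 $x_{1,0},\dots,x_{1,\ell-1}$ and $x_{2,0},\dots,x_{2,c-1}$. Put $\beta(\alpha):=1+\min_{j_1+j_2=c-1,\ j_1,j_2\ge0}(x_{2,j_1}+x_{2,j_2})$, $\delta(\alpha):=\min_{0\le j\le\ell-1}\frac{x_{1,j}+\beta(\alpha)}{j+1}$, $\delta(1):=1$, and for $c\ge2$, $\delta(c):=\sup\{\delta(\alpha):\ell\ge1,\ \alpha\in W(\ell,c),\ \alpha_{\ell+c-2}=2\}$. -}

module Defs where

open import Data.Nat using (ℕ; zero; suc; _+_; _∸_; _≤_) renaming (_⊓_ to _⊓ℕ_)
open import Data.Bool using (Bool; true; false)
open import Data.Fin using (Fin; zero; suc)
open import Data.List using (List; []; _∷_; _++_; [_]; length; zipWith; reverse; foldr)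
open import Data.List.Relation.Unary.All using (All)
open import Data.List.Relation.Unary.Linked using (Linked)
open import Data.List.Relation.Unary.Unique.Propositional using (Unique)
open import Data.Product using (Σ; _×_; _,_)
open import Data.Sum using (_⊎_)
open import Data.Integer using (+_)
open import Data.Rational using (ℚ; _/_; 1ℚ) renaming (_⊓_ to _⊓ℚ_)
open import Relation.Binary.PropositionalEquality using (_≡_)
open import Relation.Nullary using (¬_)

data Color : Set where
  c₁ c₂ : Color

-- Boards: vertex-coloured graphs on Fin n (adjacency as a Bool matrix).
-- Boards only arise via `emptyBoard` and `extend`, so adjacency is
-- automatically symmetric and irreflexive.

record Board (n : ℕ) : Set where
  field
    col : Fin n → Color
    adj : Fin n → Fin n → Bool
open Board public

emptyBoard : Board 0
emptyBoard = record { col = λ () ; adj = λ () }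

extCol : ∀ {n} → (Fin n → Color) → Color → Fin (suc n) → Color
extCol f s zero    = s
extCol f s (suc i) = f i

extAdj : ∀ {n} → (Fin n → Fin n → Bool) → (Fin n → Bool) → Fin (suc n) → Fin (suc n) → Bool
extAdj a S zero    zero    = false
extAdj a S zero    (suc j) = S j
extAdj a S (suc i) zero    = S i
extAdj a S (suc i) (suc j) = a i j

-- Builder adds a new vertex joined to the set S of old vertices;
-- Painter gives it colour s.
extend : ∀ {n} → Board n → (Fin n → Bool) → Color → Board (suc n)
extend b S s = record { col = extCol (col b) s ; adj = extAdj (adj b) S }

Adj : ∀ {n} → Board n → Fin n → Fin n → Set
Adj b i j = adj b i j ≡ true

data Reach {n : ℕ} (b : Board n) (u : Fin n) : Fin n → Set where
  here : Reach b u u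
  step : ∀ {v w} → Reach b u v → Adj b v w → Reach b u w

Cycle : ∀ {n} → Board n → Fin n → List (Fin n) → Set
Cycle b u rest = (2 ≤ length rest) × Unique (u ∷ rest) × Linked (Adj b) (u ∷ rest ++ [ u ])

Forest : ∀ {n} → Board n → Set
Forest b = ∀ u rest → ¬ Cycle b u rest

ComponentsAtMost : ∀ {n} → ℕ → Board n → Set
ComponentsAtMost k b = ∀ v (ws : List _) → Unique ws → All (Reach b v) ws → length ws ≤ k

Legal : ∀ {n} → ℕ → Board n → Set
Legal k b = Forest b × ComponentsAtMost k b

MonoPath : ∀ {n} → Board n → Color → ℕ → Set
MonoPath b s m = Σ (List _) λ vs →
  (length vs ≡ m) × Unique vs × Linked (Adj b) vs × All (λ v → col b v ≡ s) vs

Lost : ∀ {n} → ℕ → ℕ → Board n → Set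
Lost ℓ c b = MonoPath b c₁ ℓ ⊎ MonoPath b c₂ c

-- Builder can force Painter to lose within finitely many steps
-- (inductive = well-founded game tree), tree size restriction k.
data BuilderWins (k ℓ c : ℕ) : ∀ {n} → Board n → Set where
  move : ∀ {n} {b : Board n} (S : Fin n → Bool) →
         (∀ s → Legal k (extend b S s) ×
                (Lost ℓ c (extend b S s) ⊎ BuilderWins k ℓ c (extend b S s))) →
         BuilderWins k ℓ c b

IsKStar : ℕ → ℕ → ℕ → Set
IsKStar ℓ c k = (1 ≤ k) × BuilderWins k ℓ c emptyBoard ×
  (∀ j → 1 ≤ j → suc j ≤ k → ¬ BuilderWins j ℓ c emptyBoard)

count : Color → List Color → ℕ
count s [] = 0
count c₁ (c₁ ∷ as) = suc (count c₁ as)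
count c₁ (c₂ ∷ as) = count c₁ as
count c₂ (c₁ ∷ as) = count c₂ as
count c₂ (c₂ ∷ as) = suc (count c₂ as)

minList : List ℕ → ℕ
minList []       = 0
minList (x ∷ xs) = foldr _⊓ℕ_ x xs

-- for xs = [x_0,…,x_m]:  min_{j1+j2=m} (x_{j1} + x_{j2})
minSum : List ℕ → ℕ
minSum xs = minList (zipWith _+_ xs (reverse xs))

run : List Color → List ℕ → List ℕ → List ℕ × List ℕ
run [] x1 x2 = x1 , x2
run (c₁ ∷ as) x1 x2 = run as (x1 ++ [ 1 + minSum x1 + minSum x2 ]) x2
run (c₂ ∷ as) x1 x2 = run as x1 (x2 ++ [ 1 + minSum x1 + minSum x2 ])

xs₁ : List Color → List ℕ
xs₁ α = Data.Product.proj₁ (run α (0 ∷ []) (0 ∷ []))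

xs₂ : List Color → List ℕ
xs₂ α = Data.Product.proj₂ (run α (0 ∷ []) (0 ∷ []))

βα : List Color → ℕ
βα α = 1 + minSum (xs₂ α)

ratios : ℕ → List ℕ → ℕ → List ℚ
ratios β [] j = []
ratios β (x ∷ xs) j = ((+ (x + β)) / suc j) ∷ ratios β xs (suc j)

minℚ : List ℚ → ℚ
minℚ [] = 1ℚ
minℚ (q ∷ qs) = foldr _⊓ℚ_ q qs

δα : List Color → ℚ
δα α = minℚ (ratios (βα α) (xs₁ α) 0)

WSet : ℕ → ℕ → List Color → Set
WSet ℓ c α = (count c₁ α ≡ ℓ ∸ 1) × (count c₂ α ≡ c ∸ 1) ×
  (Σ (List Color) λ α' → α ≡ α' ++ [ c₂ ])

-- v belongs to the set whose supremum is δ(c)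
DeltaVal : ℕ → ℚ → Set
DeltaVal c v = ((c ≡ 1) × (v ≡ 1ℚ)) ⊎
  ((2 ≤ c) × Σ ℕ λ ℓ → (1 ≤ ℓ) × Σ (List Color) λ α → WSet ℓ c α × (δα α ≡ v))

ℕtoℚ : ℕ → ℚ
ℕtoℚ n = (+ n) / 1

module Submission where

-- A word α over {1, 2} describes a Painter strategy, and kd, evaluated at the end of a word with
-- ℓ − 1 ones and c − 1 twos, is the component size it enforces.  Conversely Builder can collect
-- many copies of paths in pairwise different components and always join the cheapest halves, so
-- k*(P_ℓ, P_c) is the maximum of kd over such words.  After adding βα the sequence x₁ is
-- subadditive, which relates k* / ℓ to the minima δα in both directions (optimal-slope,
-- slope-size).  For the lower bound the index L has to be computed, so it is not enough that
-- δ(c) is a supremum: a word of arbitrary length is compressed to bounded length by dividing the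
-- positions of its twos by a large factor wherever they grow quickly, losing little in the ratio.

-- The sequences of a word satisfy exact recursions, which no rounding survives. Profiles keep only
-- the inequalities that Painter needs, so positions and sizes can be divided with rounding and
-- still describe a strategy. Compression divides late positions by `m = N * g` but sizes by
-- `M = (N + 1) * g`. The mismatch costs a factor `(N + 1) / N` in the ratio. In return it pays for
-- gluing `m` short pieces where a long piece is needed: the gluing loss is measured by `Y t`, the
-- gain is a fixed fraction of `Y (suc t)`, so a large gap between consecutive positions suffices.
-- Where there is no such gap, the next position is already bounded in terms of the previous one.
-- There are only `c` positions, so `c` rounds bound them all. The lower bound passes through three
-- lengths. Appending a huge number of ones to `α` turns `δα α` into a ratio of an actual size to a
-- length; compression makes that length bounded; the slope of an optimal word of bounded length is
-- then prolonged by ones to the prescribed `ℓ`. The additive error left over is the `βα` of that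
-- bounded word, so one `L` serves all of the set whose supremum is δ(c).

open import Defs
open import Data.Product using (Σ; ∃; ∃₂; _×_; _,_; proj₁; proj₂)
open import Data.Sum using (_⊎_; inj₁; inj₂)
open import Data.Empty using (⊥; ⊥-elim)
open import Data.List using (List; []; _∷_; _++_; [_]; length; map; reverse; replicate; zipWith; foldr; _ʳ++_)
open import Data.List.Relation.Unary.All as All using (All; []; _∷_)
import Data.List.Relation.Unary.All.Properties as Allₚ
open import Data.List.Relation.Unary.AllPairs as AllPairs using (AllPairs; []; _∷_)
open import Data.List.Relation.Unary.Any using (Any; here; there)
open import Data.List.Relation.Unary.Linked as Linked using (Linked; []; [-]; _∷_)
import Data.List.Relation.Unary.Linked.Properties as Linkedₚ
open import Data.List.Relation.Unary.Unique.Propositional using (Unique)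
import Data.List.Relation.Unary.Unique.Propositional.Properties as Uniqueₚ
open import Data.List.Membership.Propositional using (_∈_; _∉_; lose)
open import Relation.Nullary using (¬_; Dec; yes; no; does)
open import Relation.Binary.PropositionalEquality
  using (_≡_; _≢_; refl; sym; trans; cong; cong₂; subst; subst₂)

-- Cheapest splits of an index into two halves, and running maxima.

module MinSums where
  open import Data.Nat
  open import Data.Nat.Properties

  minUpTo : (ℕ → ℕ) → ℕ → ℕ → ℕ
  minUpTo f n zero    = f 0 + f n
  minUpTo f n (suc i) = (f (suc i) + f (n ∸ suc i)) ⊓ minUpTo f n i

  minUpTo-≤ : ∀ f n i k → i ≤ k → minUpTo f n k ≤ f i + f (n ∸ i)
  minUpTo-≤ f n zero zero _ = ≤-refl
  minUpTo-≤ f n i (suc k) i≤ with m≤n⇒m<n∨m≡n i≤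
  ... | inj₁ (s≤s i≤k) = ≤-trans (m⊓n≤n _ (minUpTo f n k)) (minUpTo-≤ f n i k i≤k)
  ... | inj₂ refl      = m⊓n≤m _ (minUpTo f n k)

  minUpTo-attained : ∀ f n k → k ≤ n → ∃₂ λ i j → i + j ≡ n × minUpTo f n k ≡ f i + f j
  minUpTo-attained f n zero _ = 0 , n , refl , refl
  minUpTo-attained f n (suc k) k<n
    with ≤-total (f (suc k) + f (n ∸ suc k)) (minUpTo f n k)
  ... | inj₁ p = suc k , n ∸ suc k , m+[n∸m]≡n k<n , m≤n⇒m⊓n≡m p
  ... | inj₂ p =
    let i , j , s , e = minUpTo-attained f n k (<⇒≤ k<n)
    in i , j , s , trans (m≥n⇒m⊓n≡n p) e

  abstract
    ms : (ℕ → ℕ) → ℕ → ℕ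
    ms f n = minUpTo f n n

    ms-≤ : ∀ f i j → ms f (i + j) ≤ f i + f j
    ms-≤ f i j = subst (λ z → ms f (i + j) ≤ f i + f z) (m+n∸m≡n i j)
      (minUpTo-≤ f (i + j) i (i + j) (m≤m+n i j))

    ms-attained : ∀ f n → ∃₂ λ i j → i + j ≡ n × ms f n ≡ f i + f j
    ms-attained f n = minUpTo-attained f n n ≤-refl

  ms-≤′ : ∀ f {n} i j → i + j ≡ n → ms f n ≤ f i + f j
  ms-≤′ f i j refl = ms-≤ f i j

  ms-mono : ∀ {f g} n → (∀ i → i ≤ n → f i ≤ g i) → ms f n ≤ ms g n
  ms-mono {f} {g} n h with ms-attained g n
  ... | i , j , refl , e = subst (ms f n ≤_) (sym e)
    (≤-trans (ms-≤ f i j) (+-mono-≤ (h i (m≤m+n i j)) (h j (m≤n+m j i))))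

  Monotone : (ℕ → ℕ) → Set
  Monotone f = ∀ {i j} → i ≤ j → f i ≤ f j

  -- Lowering a nonzero summand turns a split of `suc n` into one of `n`. Monotonicity is asked only
  -- up to `n`, because sequences stored as lists are monotone only on their range.
  ms-suc : ∀ {f} n → (∀ i → i ≤ n → f i ≤ f (suc i)) → ms f n ≤ ms f (suc n)
  ms-suc {f} n mono with ms-attained f (suc n)
  ... | zero , j , refl , e = subst (ms f n ≤_) (sym e)
    (≤-trans (ms-≤ f 0 n) (+-monoʳ-≤ (f 0) (mono n ≤-refl)))
  ... | suc i , j , s , e = subst (ms f n ≤_) (sym e) (≤-trans (ms-≤′ f i j (suc-injective s))
    (+-monoˡ-≤ (f j) (mono i (≤-trans (m≤m+n i j) (≤-reflexive (suc-injective s))))))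

  ms-monoʳ : ∀ {f} → Monotone f → Monotone (ms f)
  ms-monoʳ {f} mono {i} {j} i≤j = subst (λ z → ms f i ≤ ms f z) (m∸n+n≡m i≤j) (go (j ∸ i))
    where
    go : ∀ k → ms f i ≤ ms f (k + i)
    go zero    = ≤-refl
    go (suc k) = ≤-trans (go k) (ms-suc (k + i) (λ l _ → mono (n≤1+n l)))

  ms-≥-index : ∀ {f} n → (∀ i → i ≤ n → i ≤ f i) → n ≤ ms f n
  ms-≥-index {f} n h with ms-attained f n
  ... | i , j , refl , e = subst (i + j ≤_) (sym e) (+-mono-≤ (h i (m≤m+n i j)) (h j (m≤n+m j i)))

  runningMax : (ℕ → ℕ) → ℕ → ℕ
  runningMax f zero    = f 0
  runningMax f (suc n) = runningMax f n ⊔ f (suc n)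

  ≤-runningMax : ∀ f n → f n ≤ runningMax f n
  ≤-runningMax f zero    = ≤-refl
  ≤-runningMax f (suc n) = m≤n⊔m (runningMax f n) (f (suc n))

  runningMax-mono : ∀ f → Monotone (runningMax f)
  runningMax-mono f {i} {j} i≤j =
    subst (λ z → runningMax f i ≤ runningMax f z) (m∸n+n≡m i≤j) (go (j ∸ i))
    where
    go : ∀ k → runningMax f i ≤ runningMax f (k + i)
    go zero    = ≤-refl
    go (suc k) = ≤-trans (go k) (m≤m⊔n _ (f (suc (k + i))))

  runningMax-lub : ∀ f n {z} → (∀ i → i ≤ n → f i ≤ z) → runningMax f n ≤ z
  runningMax-lub f zero    h = h 0 z≤n
  runningMax-lub f (suc n) h =
    ⊔-lub (runningMax-lub f n (λ i i≤n → h i (m≤n⇒m≤1+n i≤n))) (h (suc n) ≤-refl)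

-- Inequality systems for Painter strategies.

module Profiles where
  open MinSums
  open import Data.Nat
  open import Data.Nat.Properties

  κ : (X Y : ℕ → ℕ) → ℕ → ℕ → ℕ
  κ X Y a b = 1 + ms X a + ms Y b

  κ-mono : ∀ {X Y X′ Y′} a b → (∀ i → i ≤ a → X i ≤ X′ i) → (∀ i → i ≤ b → Y i ≤ Y′ i) →
    κ X Y a b ≤ κ X′ Y′ a b
  κ-mono a b hX hY = +-mono-≤ (s≤s (ms-mono a hX)) (ms-mono b hY)

  κ-monoʳ : ∀ {X Y} → Monotone X → Monotone Y → ∀ {a a′ b b′} → a ≤ a′ → b ≤ b′ →
    κ X Y a b ≤ κ X Y a′ b′
  κ-monoʳ mX mY a≤ b≤ = +-mono-≤ (s≤s (ms-monoʳ mX a≤)) (ms-monoʳ mY b≤)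

  -- A lower bound for a Painter strategy given by a word with c twos, the t-th of them (t ≥ 1)
  -- coming when the current length of colour-1 paths is P t: X and Y are lower bounds for the
  -- sequences x₁ and x₂.  The last two stands for the end of the word, so P c plays the role
  -- of ℓ and Y c that of the final component size.
  record Profile (c′ : ℕ) (X Y P : ℕ → ℕ) : Set where
    field
      X-zero : X 0 ≡ 0
      Y-zero : Y 0 ≡ 0
      P-mono : Monotone P
      P-pos  : ∀ t → 1 ≤ P (suc t)
      X-step : ∀ a b → b ≤ c′ → suc a < P (suc b) → X (suc a) ≤ κ X Y a b
      Y-step : ∀ b → b ≤ c′ → Y (suc b) ≤ κ X Y (pred (P (suc b))) b

  -- Once `X` and `Y` are monotone, so is `κ`, and the bound for an earlier value carries over to a
  -- later index. This restores the monotonicity that contraction may destroy, and that lists lack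
  -- beyond their end, where they are read as 0.
  runningMax-profile : ∀ {c′ X Y P} → Profile c′ X Y P → Profile c′ (runningMax X) (runningMax Y) P
  runningMax-profile {c′} {X} {Y} {P} R = record
    { X-zero = X-zero ; Y-zero = Y-zero ; P-mono = P-mono ; P-pos = P-pos
    ; X-step = stepX ; Y-step = stepY }
    where
    open Profile R
    X̄ = runningMax X
    Ȳ = runningMax Y
    up : ∀ a b → κ X Y a b ≤ κ X̄ Ȳ a b
    up a b = κ-mono a b (λ i _ → ≤-runningMax X i) (λ i _ → ≤-runningMax Y i)
    stepX : ∀ a b → b ≤ c′ → suc a < P (suc b) → X̄ (suc a) ≤ κ X̄ Ȳ a b
    stepX zero b b≤ lt = ⊔-lub (≤-trans (≤-reflexive X-zero) z≤n)
      (≤-trans (X-step 0 b b≤ lt) (up 0 b))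
    stepX (suc a) b b≤ lt = ⊔-lub
      (≤-trans (stepX a b b≤ (<-trans (n<1+n _) lt))
        (κ-monoʳ (runningMax-mono X) (runningMax-mono Y) (n≤1+n a) (≤-refl {b})))
      (≤-trans (X-step (suc a) b b≤ lt) (up (suc a) b))
    stepY : ∀ b → b ≤ c′ → Ȳ (suc b) ≤ κ X̄ Ȳ (pred (P (suc b))) b
    stepY zero b≤ = ⊔-lub (≤-trans (≤-reflexive Y-zero) z≤n) (≤-trans (Y-step 0 b≤) (up _ 0))
    stepY (suc b) b≤ = ⊔-lub
      (≤-trans (stepY b (<⇒≤ b≤))
        (κ-monoʳ (runningMax-mono X) (runningMax-mono Y) (pred-mono-≤ (P-mono (n≤1+n _))) (n≤1+n b)))
      (≤-trans (Y-step (suc b) b≤) (up _ (suc b)))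

  module _ {c′ X Y P} (R : Profile c′ X Y P) (Y-mono : Monotone Y) where
    open Profile R

    ms-Y-≤ : ∀ t {b} → b ≤ 2 * t → ms Y b ≤ 2 * Y t
    ms-Y-≤ t {b} b≤ = begin
      ms Y b  ≤⟨ ms-monoʳ Y-mono b≤ ⟩
      ms Y (2 * t)  ≤⟨ ms-≤′ Y t t (cong (t +_) (sym (+-identityʳ t))) ⟩
      Y t + Y t  ≡⟨ cong (Y t +_) (sym (+-identityʳ (Y t))) ⟩
      2 * Y t  ∎
      where open ≤-Reasoning

    -- The split `0 + n` pays one vertex and at most `2 * Y t` per step. With `Y-linear` this bounds
    -- the next `Y` by the next position and `Y t`, which keeps the bounds of the compression
    -- computable.
    X-linear : ∀ t → t ≤ c′ → ∀ n → n < P (suc t) → X n ≤ n * (1 + 2 * Y t)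
    X-linear t t≤ zero _ = ≤-reflexive X-zero
    X-linear t t≤ (suc n) lt = begin
      X (suc n)  ≤⟨ X-step n t t≤ lt ⟩
      1 + ms X n + ms Y t  ≤⟨ +-mono-≤ (s≤s (ms-≤ X 0 n)) (ms-Y-≤ t (m≤n*m t 2)) ⟩
      1 + (X 0 + X n) + 2 * Y t  ≡⟨ cong (λ z → 1 + (z + X n) + 2 * Y t) X-zero ⟩
      1 + X n + 2 * Y t  ≡⟨ cong suc (+-comm (X n) (2 * Y t)) ⟩
      1 + 2 * Y t + X n  ≤⟨ +-monoʳ-≤ (1 + 2 * Y t) (X-linear t t≤ n (<-trans (n<1+n n) lt)) ⟩
      1 + 2 * Y t + n * (1 + 2 * Y t)  ∎
      where open ≤-Reasoning

    Y-linear : ∀ t → t ≤ c′ → Y (suc t) ≤ P (suc t) * (1 + 2 * Y t)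
    Y-linear t t≤ = lemma (P (suc t)) (P-pos t) (Y-step t t≤) (X-linear t t≤)
      where
      open ≤-Reasoning
      lemma : ∀ p → 1 ≤ p → Y (suc t) ≤ κ X Y (pred p) t → (∀ n → n < p → X n ≤ n * (1 + 2 * Y t)) →
        Y (suc t) ≤ p * (1 + 2 * Y t)
      lemma (suc n) _ hY hX = begin
        Y (suc t)  ≤⟨ hY ⟩
        1 + ms X n + ms Y t  ≤⟨ +-mono-≤ (s≤s (ms-≤ X 0 n)) (ms-Y-≤ t (m≤n*m t 2)) ⟩
        1 + (X 0 + X n) + 2 * Y t  ≡⟨ cong (λ z → 1 + (z + X n) + 2 * Y t) X-zero ⟩
        1 + X n + 2 * Y t  ≡⟨ cong suc (+-comm (X n) (2 * Y t)) ⟩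
        1 + 2 * Y t + X n  ≤⟨ +-monoʳ-≤ (1 + 2 * Y t) (hX n ≤-refl) ⟩
        1 + 2 * Y t + n * (1 + 2 * Y t)  ∎

-- Rounding up and down.

module CeilingDivision where
  open import Data.Nat
  open import Data.Nat.Properties
  open import Data.Nat.DivMod

  ⌈_/1+_⌉ : ℕ → ℕ → ℕ
  ⌈ x /1+ d ⌉ = (x + d) / suc d

  m<n*[1+m/n] : ∀ x d → x < suc d * suc (x / suc d)
  m<n*[1+m/n] x d = begin-strict
    x  ≡⟨ m≡m%n+[m/n]*n x (suc d) ⟩
    x % suc d + x / suc d * suc d  <⟨ +-monoˡ-< (x / suc d * suc d) (m%n<n x (suc d)) ⟩
    suc d + x / suc d * suc d  ≡⟨ *-comm (suc (x / suc d)) (suc d) ⟩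
    suc d * suc (x / suc d)  ∎
    where open ≤-Reasoning

  ⌈/⌉-upper : ∀ x d → x ≤ suc d * ⌈ x /1+ d ⌉
  ⌈/⌉-upper x d = +-cancelʳ-≤ (suc d) x (suc d * ⌈ x /1+ d ⌉) (begin
    x + suc d  ≡⟨ +-suc x d ⟩
    suc (x + d)  ≤⟨ m<n*[1+m/n] (x + d) d ⟩
    suc d * suc ⌈ x /1+ d ⌉  ≡⟨ *-suc (suc d) _ ⟩
    suc d + suc d * ⌈ x /1+ d ⌉  ≡⟨ +-comm (suc d) _ ⟩
    suc d * ⌈ x /1+ d ⌉ + suc d  ∎)
    where open ≤-Reasoning

  ⌈/⌉-least : ∀ x d q → x ≤ suc d * q → ⌈ x /1+ d ⌉ ≤ q
  ⌈/⌉-least x d q x≤ = s≤s⁻¹ (m<n*o⇒m/o<n {n = suc q} (begin-strict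
    x + d  <⟨ +-monoʳ-< x (n<1+n d) ⟩
    x + suc d  ≤⟨ +-monoˡ-≤ (suc d) x≤ ⟩
    suc d * q + suc d  ≡⟨ trans (+-comm _ (suc d)) (cong (suc d +_) (*-comm (suc d) q)) ⟩
    suc q * suc d  ∎))
    where open ≤-Reasoning

  n≤m/d⇒d*n≤m : ∀ {m n} d .{{_ : NonZero d}} → n ≤ m / d → d * n ≤ m
  n≤m/d⇒d*n≤m {m} {n} d n≤ = begin
    d * n  ≤⟨ *-monoʳ-≤ d n≤ ⟩
    d * (m / d)  ≡⟨ *-comm d (m / d) ⟩
    m / d * d  ≤⟨ m/n*n≤m m d ⟩
    m  ∎
    where open ≤-Reasoning

  d*n≤m⇒n≤m/d : ∀ {m n} d .{{_ : NonZero d}} → d * n ≤ m → n ≤ m / d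
  d*n≤m⇒n≤m/d {m} {n} d d*n≤m = begin
    n  ≡⟨ sym (m*n/n≡m n d) ⟩
    n * d / d  ≡⟨ cong (_/ d) (*-comm n d) ⟩
    d * n / d  ≤⟨ /-monoˡ-≤ d d*n≤m ⟩
    m / d  ∎
    where open ≤-Reasoning

-- One contraction of a profile at a gap.

-- All positions P t with t > t₀ are divided by m = 1 + m′.  In the new profile an index a stands
-- for the old index idx a = m a + m′, and its size is about X (idx a) / M with M = m + g.
-- Each piece used below an index loses an additive error E; since every join of two pieces also
-- pays a colour-2 term, which carries a surplus of at least E, these losses do not accumulate.
module Contraction where
  open MinSums
  open Profiles
  open CeilingDivision
  open import Data.Nat
  open import Data.Nat.Properties
  open import Data.Nat.DivMod
  open import Data.Nat.Tactic.RingSolver using (solve-∀)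

  -- The gaps in `P` keep the divided positions monotone and positive. `Y-gap` prevents contracted
  -- halves from undercutting the kept ones, and `Y-gap⁺` is the size from which `scaled-surplus`
  -- works.
  module Contract
    {c′ : ℕ} {X Y P : ℕ → ℕ} (R : Profile c′ X Y P) (X-mono : Monotone X) (Y-mono : Monotone Y)
    (t₀ m′ g N : ℕ) (t₀≤c′ : t₀ ≤ c′) (m≡N*g : suc m′ ≡ N * g)
    (P-gap : P t₀ ≤ P (suc t₀) / suc m′) (P-gap⁺ : 1 ≤ P (suc t₀) / suc m′)
    (Y-gap : suc (m′ + g) * (2 * Y t₀) ≤ Y (suc t₀))
    (Y-gap⁺ : (N * (2 * suc c′ + 2) + 2) * (suc m′ * (1 + 2 * Y t₀)) ≤ Y (suc t₀))
    where
    open Profile R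

    -- `BL` bounds the cost of a join with colour-2 index at most `2 * t₀`, where two halves of
    -- index at most `t₀` suffice. `E` pays for gluing `m` pieces by such joins, and `w` is the
    -- largest admissible index of this kind.
    m M BL E w : ℕ
    m  = suc m′
    M  = suc (m′ + g)
    BL = 1 + 2 * Y t₀
    E  = m * BL
    w  = (2 * t₀) ⊓ c′

    -- The surplus in units of `E`. It drops by 2 with every two, since a colour-2 step consumes two
    -- colour-1 pieces that lose `E` each, and it is still 1 at the end, as a colour-1 step
    -- requires.
    e : ℕ → ℕ
    e t = suc (2 * (suc c′ ∸ t))

    -- A join adds the values of length plus one, so it is this quantity that is scaled:
    -- `suc (idx a)` equals `m * suc a`, and `idx` commutes with joins (`idx-suc`).
    idx : ℕ → ℕ
    idx a = m * a + m′

    abstract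
      P′ X′ Y′ : ℕ → ℕ
      P′ t with t ≤? t₀
      ... | yes _ = P t
      ... | no  _ = P t / m
      -- In this range the colour-2 term may consist of uncontracted halves only, which carry no
      -- surplus. The old value is therefore kept; `X-idx-low` shows that it is large enough.
      X′ a with a <? P (suc w) / m
      ... | yes _ = X a
      ... | no  _ = ⌈ X (idx a) ∸ E /1+ (m′ + g) ⌉
      Y′ t with t ≤? t₀
      ... | yes _ = Y t
      ... | no  _ = ⌈ Y t + e t * E /1+ (m′ + g) ⌉

      P′-lo : ∀ {t} → t ≤ t₀ → P′ t ≡ P t
      P′-lo {t} t≤ with t ≤? t₀
      ... | yes _ = refl
      ... | no ¬p = ⊥-elim (¬p t≤)

      P′-hi : ∀ {t} → t₀ < t → P′ t ≡ P t / m
      P′-hi {t} t> with t ≤? t₀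
      ... | yes p = ⊥-elim (<⇒≱ t> p)
      ... | no  _ = refl

      Y′-lo : ∀ {t} → t ≤ t₀ → Y′ t ≡ Y t
      Y′-lo {t} t≤ with t ≤? t₀
      ... | yes _ = refl
      ... | no ¬p = ⊥-elim (¬p t≤)

      Y′-hi : ∀ {t} → t₀ < t → Y′ t ≡ ⌈ Y t + e t * E /1+ (m′ + g) ⌉
      Y′-hi {t} t> with t ≤? t₀
      ... | yes p = ⊥-elim (<⇒≱ t> p)
      ... | no  _ = refl

      X′-lo : ∀ {a} → a < P (suc w) / m → X′ a ≡ X a
      X′-lo {a} a< with a <? P (suc w) / m
      ... | yes _ = refl
      ... | no ¬p = ⊥-elim (¬p a<)

      X′-hi : ∀ {a} → P (suc w) / m ≤ a → X′ a ≡ ⌈ X (idx a) ∸ E /1+ (m′ + g) ⌉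
      X′-hi {a} a≥ with a <? P (suc w) / m
      ... | yes p = ⊥-elim (<⇒≱ p a≥)
      ... | no  _ = refl

    t₀≤w : t₀ ≤ w
    t₀≤w = ⊓-glb (m≤n*m t₀ 2) t₀≤c′

    P′≤P : ∀ t → P′ t ≤ P t
    P′≤P t with t ≤? t₀
    ... | yes p = ≤-reflexive (P′-lo p)
    ... | no  p = ≤-trans (≤-reflexive (P′-hi (≰⇒> p))) (m/n≤m (P t) m)

    Y′-hi-≥ : ∀ {t} → t₀ < t → Y t + e t * E ≤ M * Y′ t
    Y′-hi-≥ {t} t> = subst (λ z → Y t + e t * E ≤ M * z) (sym (Y′-hi t>))
      (⌈/⌉-upper (Y t + e t * E) (m′ + g))

    Y≤M*Y′ : ∀ t → Y t ≤ M * Y′ t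
    Y≤M*Y′ t with t ≤? t₀
    ... | yes p = subst (λ z → Y t ≤ M * z) (sym (Y′-lo p)) (m≤n*m (Y t) M)
    ... | no  p = ≤-trans (m≤m+n (Y t) (e t * E)) (Y′-hi-≥ (≰⇒> p))

    -- A single contracted half costs at least as much as two halves at `t₀`, so using one cannot
    -- lower a minimum at indices up to `2 * t₀`.
    2Y≤Y′ : ∀ {t} → t₀ < t → 2 * Y t₀ ≤ Y′ t
    2Y≤Y′ {t} t> = *-cancelˡ-≤ M (≤-trans Y-gap (≤-trans (Y-mono t>) (Y≤M*Y′ t)))

    -- The path consists of `suc i` pieces of length `a` and `i` joining vertices, and each join
    -- costs at most `BL`.
    X-block : ∀ i a → i * suc a + a < P (suc w) → X (i * suc a + a) ≤ suc i * X a + i * BL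
    X-block zero a _ = ≤-reflexive (sym (trans (+-identityʳ _) (+-identityʳ _)))
    X-block (suc i) a lt = begin
      X (suc (a + i * suc a + a))  ≤⟨ X-step (a + i * suc a + a) w (m⊓n≤n (2 * t₀) c′) lt ⟩
      1 + ms X (a + i * suc a + a) + ms Y w  ≤⟨ +-mono-≤ (s≤s (ms-≤′ X a (i * suc a + a) (sym (+-assoc a _ a))))
          (ms-Y-≤ R Y-mono t₀ (m⊓n≤m (2 * t₀) c′)) ⟩
      1 + (X a + X (i * suc a + a)) + 2 * Y t₀ ≤⟨ +-monoˡ-≤ (2 * Y t₀) (s≤s (+-monoʳ-≤ (X a)
          (X-block i a (≤-<-trans (+-monoˡ-≤ a (m≤n+m _ a)) (<-trans (n<1+n _) lt))))) ⟩
      1 + (X a + (suc i * X a + i * BL)) + 2 * Y t₀ ≡⟨ ring (X a) (suc i * X a) (i * BL) (2 * Y t₀) ⟩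
      suc (suc i) * X a + suc i * BL  ∎
      where
      open ≤-Reasoning
      ring : ∀ x y z u → 1 + (x + (y + z)) + u ≡ (x + y) + ((1 + u) + z)
      ring = solve-∀

    idx≡ : ∀ a → idx a ≡ m′ * suc a + a
    idx≡ a = trans (cong (λ z → a + m′ * a + z) (sym (*-identityʳ m′))) (ring m′ a)
      where
      ring : ∀ x y → y + x * y + x * 1 ≡ x * (1 + y) + y
      ring = solve-∀

    idx<P : ∀ {a b} → a < P b / m → idx a < P b
    idx<P {a} {b} lt = begin-strict
      m * a + m′  <⟨ +-monoʳ-< (m * a) (n<1+n m′) ⟩
      m * a + m  ≡⟨ trans (+-comm (m * a) m) (sym (*-suc m a)) ⟩
      m * suc a  ≤⟨ n≤m/d⇒d*n≤m m lt ⟩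
      P b  ∎
      where open ≤-Reasoning

    X-idx-low : ∀ {a} → a < P (suc w) / m → X (idx a) ≤ m * X a + E
    X-idx-low {a} lt = begin
      X (idx a)  ≡⟨ cong X (idx≡ a) ⟩
      X (m′ * suc a + a)  ≤⟨ X-block m′ a (subst (_< P (suc w)) (idx≡ a) (idx<P {b = suc w} lt)) ⟩
      m * X a + m′ * BL  ≤⟨ +-monoʳ-≤ (m * X a) (*-monoˡ-≤ BL (n≤1+n m′)) ⟩
      m * X a + E  ∎
      where open ≤-Reasoning

    X-idx : ∀ a → X (idx a) ≤ M * X′ a + E
    X-idx a with a <? P (suc w) / m
    ... | yes lt = ≤-trans (X-idx-low lt) (+-monoˡ-≤ E (≤-trans (*-monoˡ-≤ (X a) (s≤s (m≤m+n m′ g)))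
      (≤-reflexive (cong (M *_) (sym (X′-lo lt))))))
    ... | no  ge = ≤-trans (m≤n+m∸n (X (idx a)) E) (≤-trans
      (+-monoʳ-≤ E (⌈/⌉-upper (X (idx a) ∸ E) (m′ + g)))
      (≤-reflexive (trans (+-comm E _) (cong (λ z → M * z + E) (sym (X′-hi (≮⇒≥ ge)))))))

    -- As `e` is decreasing, the contracted half `i` alone brings the surplus due at `b`; nothing
    -- extra is asked of the half `j`.
    surplus : ∀ {i j b} → t₀ < i → i ≤ b → Y i + Y j + e b * E ≤ M * (Y′ i + Y′ j)
    surplus {i} {j} {b} t₀<i i≤b = begin
      Y i + Y j + e b * E  ≡⟨ ring (Y i) (Y j) (e b * E) ⟩
      Y i + e b * E + Y j  ≤⟨ +-mono-≤ (+-monoʳ-≤ (Y i) (*-monoˡ-≤ E (s≤s (*-monoʳ-≤ 2 (∸-monoʳ-≤ (suc c′) i≤b))))) (Y≤M*Y′ j) ⟩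
      Y i + e i * E + M * Y′ j ≤⟨ +-monoˡ-≤ (M * Y′ j) (Y′-hi-≥ t₀<i) ⟩
      M * Y′ i + M * Y′ j  ≡⟨ sym (*-distribˡ-+ M (Y′ i) (Y′ j)) ⟩
      M * (Y′ i + Y′ j)  ∎
      where
      open ≤-Reasoning
      ring : ∀ x y z → x + y + z ≡ x + z + y
      ring = solve-∀

    i+j≤2t₀ : ∀ {i j} → i ≤ t₀ → j ≤ t₀ → i + j ≤ 2 * t₀
    i+j≤2t₀ i≤ j≤ = ≤-trans (+-mono-≤ i≤ j≤) (≤-reflexive (cong (t₀ +_) (sym (+-identityʳ t₀))))

    -- Two indices up to `t₀` cannot add up to `b`, so every split has a contracted half, to which
    -- `surplus` applies.
    ms-Y′-high : ∀ {b} → 2 * t₀ < b → 1 + ms Y b + e b * E ≤ M * (1 + ms Y′ b)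
    ms-Y′-high {b} b> with ms-attained Y′ b
    ... | i , j , refl , eq = begin
      1 + ms Y b + e b * E  ≤⟨ s≤s (+-monoˡ-≤ (e b * E) (ms-≤ Y i j)) ⟩
      1 + (Y i + Y j + e b * E)  ≤⟨ +-mono-≤ (s≤s (z≤n {m′ + g})) pair ⟩
      M + M * (Y′ i + Y′ j)  ≡⟨ sym (*-suc M (Y′ i + Y′ j)) ⟩
      M * (1 + (Y′ i + Y′ j))  ≡⟨ cong (λ z → M * (1 + z)) (sym eq) ⟩
      M * (1 + ms Y′ b)  ∎
      where
      open ≤-Reasoning
      pair : Y i + Y j + e (i + j) * E ≤ M * (Y′ i + Y′ j)
      pair with i ≤? t₀ | j ≤? t₀
      ... | no  p | _     = surplus (≰⇒> p) (m≤m+n i j)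
      ... | yes _ | no  q = subst (λ z → z + e (i + j) * E ≤ M * (Y′ i + Y′ j)) (+-comm (Y j) (Y i))
        (subst (λ z → Y j + Y i + e (i + j) * E ≤ M * z) (+-comm (Y′ j) (Y′ i)) (surplus (≰⇒> q) (m≤n+m j i)))
      ... | yes p | yes q = ⊥-elim (<⇒≱ b> (i+j≤2t₀ p q))

    ms-Y′-low : ∀ {b₀ b} → b₀ ≤ 2 * t₀ → b ≡ b₀ ⊎ 2 * t₀ < b → ms Y b₀ ≤ ms Y′ b
    ms-Y′-low {b₀} {b} b₀≤ h with ms-attained Y′ b
    ... | i , j , refl , eq = subst (ms Y b₀ ≤_) (sym eq) (pair h)
      where
      pair : i + j ≡ b₀ ⊎ 2 * t₀ < i + j → ms Y b₀ ≤ Y′ i + Y′ j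
      pair h with i ≤? t₀ | j ≤? t₀ | h
      ... | no  p | _     | _ = ≤-trans (ms-Y-≤ R Y-mono t₀ b₀≤) (≤-trans (2Y≤Y′ (≰⇒> p)) (m≤m+n (Y′ i) (Y′ j)))
      ... | yes _ | no  q | _ = ≤-trans (ms-Y-≤ R Y-mono t₀ b₀≤) (≤-trans (2Y≤Y′ (≰⇒> q)) (m≤n+m (Y′ j) (Y′ i)))
      ... | yes p | yes q | inj₁ b≡b₀ = subst (λ z → ms Y z ≤ Y′ i + Y′ j) b≡b₀
        (≤-trans (ms-≤ Y i j) (≤-reflexive (sym (cong₂ _+_ (Y′-lo p) (Y′-lo q)))))
      ... | yes p | yes q | inj₂ b>   = ⊥-elim (<⇒≱ b> (i+j≤2t₀ p q))

    assemble : ∀ {x₁ x₂ x₁′ x₂′ y y′ f} → x₁ ≤ M * x₁′ + E → x₂ ≤ M * x₂′ + E →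
      1 + y + f ≤ M * (1 + y′) → 1 + (x₁ + x₂) + y + f ≤ 2 * E + M * (1 + (x₁′ + x₂′) + y′)
    assemble {x₁} {x₂} {x₁′} {x₂′} {y} {y′} {f} h₁ h₂ hy = begin
      1 + (x₁ + x₂) + y + f  ≡⟨ ring₁ x₁ x₂ y f ⟩
      x₁ + x₂ + (1 + y + f)  ≤⟨ +-mono-≤ (+-mono-≤ h₁ h₂) hy ⟩
      (M * x₁′ + E) + (M * x₂′ + E) + M * (1 + y′)  ≡⟨ ring₂ M x₁′ x₂′ y′ E ⟩
      2 * E + M * (1 + (x₁′ + x₂′) + y′)  ∎
      where
      open ≤-Reasoning
      ring₁ : ∀ a b c d → 1 + (a + b) + c + d ≡ a + b + (1 + c + d)
      ring₁ = solve-∀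
      ring₂ : ∀ M a b c E → (M * a + E) + (M * b + E) + M * (1 + c) ≡ 2 * E + M * (1 + (a + b) + c)
      ring₂ = solve-∀

    idx-+ : ∀ i j → idx i + idx j ≡ m * (i + j) + (m′ + m′)
    idx-+ i j = ring m′ i j
      where
      ring : ∀ x i j → ((1 + x) * i + x) + ((1 + x) * j + x) ≡ (1 + x) * (i + j) + (x + x)
      ring = solve-∀

    idx-suc : ∀ i j → idx (suc (i + j)) ≡ suc (idx i + idx j)
    idx-suc i j = ring m′ i j
      where
      ring : ∀ x i j → (1 + x) * (1 + (i + j)) + x ≡ 1 + (((1 + x) * i + x) + ((1 + x) * j + x))
      ring = solve-∀

    low-gap : P (suc t₀) / m ≤ P (suc w) / m
    low-gap = /-monoˡ-≤ m (P-mono (s≤s t₀≤w))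

    X′-step : ∀ a b → b ≤ c′ → suc a < P′ (suc b) → X′ (suc a) ≤ κ X′ Y′ a b
    X′-step a b b≤ lt = go (suc a <? P (suc w) / m)
      where
      go : _ → X′ (suc a) ≤ κ X′ Y′ a b
      go (yes low) = subst (_≤ κ X′ Y′ a b) (sym (X′-lo low)) (low′ (b ≤? 2 * t₀))
        where
        msX : ms X a ≤ ms X′ a
        msX = ms-mono a (λ i i≤a → ≤-reflexive (sym (X′-lo (≤-<-trans i≤a (<-trans (n<1+n a) low)))))
        low′ : _ → X (suc a) ≤ κ X′ Y′ a b
        low′ (yes b≤2t₀) = ≤-trans (X-step a b b≤ (<-≤-trans lt (P′≤P (suc b))))
          (+-mono-≤ (s≤s msX) (ms-Y′-low b≤2t₀ (inj₁ refl)))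
        -- Since `suc a` lies below the old position of index `suc w`, the old step is available at
        -- `w`, where the colour-2 term is still small enough to be compared with `ms Y′ b`.
        low′ (no  b>2t₀) = ≤-trans (X-step a w (m⊓n≤n (2 * t₀) c′) (<-≤-trans low (m/n≤m _ m)))
          (+-mono-≤ (s≤s msX) (ms-Y′-low {b = b} (m⊓n≤m (2 * t₀) c′) (inj₂ (≰⇒> b>2t₀))))
      go (no high) with suc b ≤? t₀
      ... | yes sb≤t₀ = ⊥-elim (high (<-≤-trans lt (≤-trans (≤-reflexive (P′-lo sb≤t₀))
        (≤-trans (P-mono sb≤t₀) (≤-trans P-gap low-gap)))))
      ... | no  sb≰t₀ with ms-attained X′ a
      -- The two halves lose `2 * E`. One `E` is forgiven by the subtraction in the definition of
      -- `X′`, the other is covered by the surplus, because `e b` is at least 1.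
      ... | i , j , refl , eq = ≤-trans (≤-reflexive (X′-hi (≮⇒≥ high))) (⌈/⌉-least _ (m′ + g) _
        (m≤n+o⇒m∸n≤o _ E (+-cancelˡ-≤ E _ _ (begin
          E + X (idx (suc (i + j)))  ≡⟨ cong (λ z → E + X z) (idx-suc i j) ⟩
          E + X (suc (idx i + idx j))  ≤⟨ +-monoʳ-≤ E (X-step (idx i + idx j) b b≤
              (subst (_< P (suc b)) (idx-suc i j) (idx<P {b = suc b} sa<))) ⟩
          E + (1 + ms X (idx i + idx j) + ms Y b)  ≤⟨ +-monoʳ-≤ E (+-monoˡ-≤ (ms Y b) (s≤s (ms-≤ X (idx i) (idx j)))) ⟩
          E + (1 + (X (idx i) + X (idx j)) + ms Y b)  ≡⟨ +-comm E _ ⟩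
          1 + (X (idx i) + X (idx j)) + ms Y b + E  ≤⟨ assemble (X-idx i) (X-idx j)
              (≤-trans (+-monoʳ-≤ (1 + ms Y b) (m≤m+n E _)) (ms-Y′-high b>2t₀)) ⟩
          2 * E + M * (1 + (X′ i + X′ j) + ms Y′ b)  ≡⟨ cong (λ z → 2 * E + M * (1 + z + ms Y′ b)) (sym eq) ⟩
          2 * E + M * κ X′ Y′ (i + j) b  ≡⟨ ring E (M * κ X′ Y′ (i + j) b) ⟩
          E + (E + M * κ X′ Y′ (i + j) b)  ∎))))
        where
        open ≤-Reasoning
        ring : ∀ x y → 2 * x + y ≡ x + (x + y)
        ring = solve-∀
        sa< : suc (i + j) < P (suc b) / m
        sa< = subst (suc (i + j) <_) (P′-hi (≰⇒> sb≰t₀)) lt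
        b>2t₀ : 2 * t₀ < b
        b>2t₀ = ≰⇒> (λ b≤2t₀ → high (<-≤-trans sa< (/-monoˡ-≤ m (P-mono (s≤s (⊓-glb b≤2t₀ b≤))))))

    e-suc : ∀ {b} → b ≤ c′ → e b ≡ 2 + e (suc b)
    e-suc {b} b≤ = cong suc (trans (cong (2 *_) (+-∸-assoc 1 b≤)) (*-suc 2 (c′ ∸ b)))

    -- Rounding down gives `P (suc b) < m * (i + j + 2)`, and the right-hand side exceeds
    -- `idx i + idx j` by exactly 2.
    pred-P≤ : ∀ {b i j} → P (suc b) / m ≡ suc (i + j) → pred (P (suc b)) ≤ idx i + idx j
    pred-P≤ {b} {i} {j} eq = ≤-trans (pred-mono-≤ (s≤s⁻¹ (begin
      suc (P (suc b))  ≤⟨ m<n*[1+m/n] (P (suc b)) m′ ⟩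
      m * suc (P (suc b) / m)  ≡⟨ cong (λ z → m * suc z) eq ⟩
      m * suc (suc (i + j))  ≡⟨ ring m′ (i + j) ⟩
      suc (suc (m * (i + j) + (m′ + m′)))  ∎))) (≤-reflexive (sym (idx-+ i j)))
      where
      open ≤-Reasoning
      ring : ∀ x y → (1 + x) * (2 + y) ≡ 2 + ((1 + x) * y + (x + x))
      ring = solve-∀

    -- As `M` is `(1 + 1/N) * m`, the product `M * k` is at least `(1 + 1/N) * (y - 2 * E)`. This
    -- reaches `y + f * E` as soon as `y / N` covers `(f + 2) * E + 2 * E / N`, which is the second
    -- hypothesis.
    scaled-surplus : ∀ {y f k} → y ≤ 2 * E + m * k → (N * (f + 2) + 2) * E ≤ y → y + f * E ≤ M * k
    scaled-surplus {y} {f} {k} y≤ y≥ = cancel N m≡N*g y≥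
      where
      open ≤-Reasoning
      ring₁ : ∀ N y f E → (1 + N) * (y + f * E) + ((1 + N) * 2 * E) ≡ (1 + N) * y + ((1 + N) * (f + 2)) * E
      ring₁ = solve-∀
      ring₂ : ∀ N y f E → (1 + N) * y + ((1 + N) * (f + 2)) * E + 2 * E ≡ (1 + N) * y + (((1 + N) * (f + 2)) + 2) * E
      ring₂ = solve-∀
      ring₃ : ∀ N E m k → (2 + N) * (2 * E + m * k) ≡ (1 + N) * (m * k) + m * k + ((1 + N) * 2 * E + 2 * E)
      ring₃ = solve-∀
      ring₄ : ∀ N m g k → (1 + N) * (m * k) + ((1 + N) * g) * k ≡ (1 + N) * ((m + g) * k)
      ring₄ = solve-∀
      cancel : ∀ N → m ≡ N * g → (N * (f + 2) + 2) * E ≤ y → y + f * E ≤ M * k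
      cancel (suc N) eq h = *-cancelˡ-≤ (suc N) (+-cancelʳ-≤ (suc N * 2 * E + 2 * E) _ _ (begin
        suc N * (y + f * E) + (suc N * 2 * E + 2 * E)  ≡⟨ sym (+-assoc (suc N * (y + f * E)) (suc N * 2 * E) (2 * E)) ⟩
        suc N * (y + f * E) + suc N * 2 * E + 2 * E  ≡⟨ cong (_+ 2 * E) (ring₁ N y f E) ⟩
        suc N * y + suc N * (f + 2) * E + 2 * E  ≡⟨ ring₂ N y f E ⟩
        suc N * y + (suc N * (f + 2) + 2) * E  ≤⟨ +-monoʳ-≤ (suc N * y) h ⟩
        suc N * y + y  ≡⟨ +-comm (suc N * y) y ⟩
        suc (suc N) * y  ≤⟨ *-monoʳ-≤ (suc (suc N)) y≤ ⟩
        suc (suc N) * (2 * E + m * k)  ≡⟨ ring₃ N E m k ⟩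
        suc N * (m * k) + m * k + (suc N * 2 * E + 2 * E)  ≡⟨ cong (λ z → suc N * (m * k) + z * k + (suc N * 2 * E + 2 * E)) eq ⟩
        suc N * (m * k) + suc N * g * k + (suc N * 2 * E + 2 * E) ≡⟨ cong (_+ (suc N * 2 * E + 2 * E)) (ring₄ N m g k) ⟩
        suc N * (M * k) + (suc N * 2 * E + 2 * E)  ∎))

    Y′-step : ∀ b → b ≤ c′ → Y′ (suc b) ≤ κ X′ Y′ (pred (P′ (suc b))) b
    Y′-step b b≤ = go (suc b ≤? t₀)
      where
      open ≤-Reasoning
      go : _ → Y′ (suc b) ≤ κ X′ Y′ (pred (P′ (suc b))) b
      go (yes sb≤t₀) = begin
        Y′ (suc b)  ≡⟨ Y′-lo sb≤t₀ ⟩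
        Y (suc b)  ≤⟨ Y-step b b≤ ⟩
        κ X Y (pred (P (suc b))) b  ≤⟨ κ-mono (pred (P (suc b))) b
            (λ i i≤ → ≤-reflexive (sym (X′-lo (<-≤-trans (i<P i≤) P≤))))
            (λ i i≤ → ≤-reflexive (sym (Y′-lo (≤-trans i≤ (<⇒≤ sb≤t₀))))) ⟩
        κ X′ Y′ (pred (P (suc b))) b  ≡⟨ cong (λ z → κ X′ Y′ (pred z) b) (sym (P′-lo sb≤t₀)) ⟩
        κ X′ Y′ (pred (P′ (suc b))) b  ∎
        where
        i<P : ∀ {i} → i ≤ pred (P (suc b)) → i < P (suc b)
        i<P i≤ = ≤-trans (s≤s i≤) (≤-reflexive (suc-pred (P (suc b)) {{>-nonZero (P-pos b)}}))
        P≤ : P (suc b) ≤ P (suc w) / m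
        P≤ = ≤-trans (P-mono sb≤t₀) (≤-trans P-gap low-gap)
      go (no sb≰t₀) = rest (P (suc b) / m) refl (≤-trans P-gap⁺ (/-monoˡ-≤ m (P-mono (≰⇒> sb≰t₀))))
        where
        rest : ∀ p → P (suc b) / m ≡ p → 1 ≤ p → Y′ (suc b) ≤ κ X′ Y′ (pred (P′ (suc b))) b
        rest (suc a) eq _ with ms-attained X′ a
        ... | i , j , refl , eqX = begin
          Y′ (suc b)  ≡⟨ Y′-hi (≰⇒> sb≰t₀) ⟩
          ⌈ Y (suc b) + e (suc b) * E /1+ (m′ + g) ⌉ ≤⟨ ⌈/⌉-least _ (m′ + g) _ (main (b ≤? 2 * t₀)) ⟩
          κ X′ Y′ (i + j) b  ≡⟨ cong (λ z → κ X′ Y′ (pred z) b) (sym (trans (P′-hi (≰⇒> sb≰t₀)) eq)) ⟩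
          κ X′ Y′ (pred (P′ (suc b))) b  ∎
          where
          Y≤ : Y (suc b) ≤ 1 + (X (idx i) + X (idx j)) + ms Y b
          Y≤ = begin
            Y (suc b)  ≤⟨ Y-step b b≤ ⟩
            κ X Y (pred (P (suc b))) b  ≤⟨ κ-monoʳ X-mono Y-mono {b = b} (pred-P≤ {b} {i} {j} eq) ≤-refl ⟩
            κ X Y (idx i + idx j) b  ≤⟨ +-monoˡ-≤ (ms Y b) (s≤s (ms-≤ X (idx i) (idx j))) ⟩
            1 + (X (idx i) + X (idx j)) + ms Y b  ∎
          main : _ → Y (suc b) + e (suc b) * E ≤ M * κ X′ Y′ (i + j) b
          -- The colour-2 term has surplus `e b`, two more than `e (suc b)`: exactly what the two
          -- colour-1 halves lose.
          main (no b≰) = +-cancelʳ-≤ (2 * E) _ _ (begin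
            Y (suc b) + e (suc b) * E + 2 * E  ≡⟨ +-assoc (Y (suc b)) _ _ ⟩
            Y (suc b) + (e (suc b) * E + 2 * E)  ≡⟨ cong (Y (suc b) +_) (trans (+-comm (e (suc b) * E) (2 * E)) (sym (*-distribʳ-+ E 2 (e (suc b))))) ⟩
            Y (suc b) + (2 + e (suc b)) * E  ≡⟨ cong (λ z → Y (suc b) + z * E) (sym (e-suc b≤)) ⟩
            Y (suc b) + e b * E  ≤⟨ +-monoˡ-≤ (e b * E) Y≤ ⟩
            1 + (X (idx i) + X (idx j)) + ms Y b + e b * E  ≤⟨ assemble (X-idx i) (X-idx j) (ms-Y′-high (≰⇒> b≰)) ⟩
            2 * E + M * (1 + (X′ i + X′ j) + ms Y′ b)  ≡⟨ cong (λ z → 2 * E + M * (1 + z + ms Y′ b)) (sym eqX) ⟩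
            2 * E + M * κ X′ Y′ (i + j) b  ≡⟨ +-comm (2 * E) _ ⟩
            M * κ X′ Y′ (i + j) b + 2 * E  ∎)
          -- No surplus is available from colour 2 here, but all colour-1 pieces lie in the kept
          -- range and scale by `m` only, so the difference between `M` and `m` pays.
          main (yes b≤2t₀) = scaled-surplus {f = e (suc b)} Y≤′ (≤-trans (*-monoˡ-≤ E (+-monoˡ-≤ 2 (*-monoʳ-≤ N (+-monoˡ-≤ 2 e≤))))
            (≤-trans Y-gap⁺ (Y-mono (≰⇒> sb≰t₀))))
            where
            e≤ : e (suc b) ≤ 2 * suc c′
            e≤ = ≤-trans (s≤s (*-monoʳ-≤ 2 (m∸n≤m c′ b))) (≤-trans (n≤1+n _) (≤-reflexive (sym (*-suc 2 c′))))
            low : ∀ {i} → i ≤ a → i < P (suc w) / m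
            low i≤a = <-≤-trans (s≤s i≤a) (≤-trans (≤-reflexive (sym eq)) (/-monoˡ-≤ m (P-mono (s≤s (⊓-glb b≤2t₀ b≤)))))
            X≤ : ∀ {i} → i ≤ a → X (idx i) ≤ m * X′ i + E
            X≤ {i} i≤ = subst (λ z → X (idx i) ≤ m * z + E) (sym (X′-lo (low i≤))) (X-idx-low (low i≤))
            ring : ∀ m x y z E → 1 * m + ((m * x + E) + (m * y + E)) + m * z ≡ 2 * E + m * (1 + (x + y) + z)
            ring = solve-∀
            Y≤′ : Y (suc b) ≤ 2 * E + m * κ X′ Y′ (i + j) b
            Y≤′ = begin
              Y (suc b)  ≤⟨ Y≤ ⟩
              1 + (X (idx i) + X (idx j)) + ms Y b  ≤⟨ +-mono-≤ (+-mono-≤ (s≤s (z≤n {m′ + 0})) (+-mono-≤ (X≤ (m≤m+n i j)) (X≤ (m≤n+m j i))))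
                  (≤-trans (ms-Y′-low b≤2t₀ (inj₁ refl)) (m≤n*m (ms Y′ b) m)) ⟩
              1 * m + ((m * X′ i + E) + (m * X′ j + E)) + m * ms Y′ b  ≡⟨ ring m (X′ i) (X′ j) (ms Y′ b) E ⟩
              2 * E + m * (1 + (X′ i + X′ j) + ms Y′ b)  ≡⟨ cong (λ z → 2 * E + m * (1 + z + ms Y′ b)) (sym eqX) ⟩
              2 * E + m * κ X′ Y′ (i + j) b  ∎

    P′-mono : Monotone P′
    P′-mono {i} {j} i≤j with i ≤? t₀ | j ≤? t₀
    ... | yes p | yes q = subst₂ _≤_ (sym (P′-lo p)) (sym (P′-lo q)) (P-mono i≤j)
    ... | yes p | no  q = subst₂ _≤_ (sym (P′-lo p)) (sym (P′-hi (≰⇒> q)))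
      (≤-trans (P-mono p) (≤-trans P-gap (/-monoˡ-≤ m (P-mono (≰⇒> q)))))
    ... | no  p | yes q = ⊥-elim (p (≤-trans i≤j q))
    ... | no  p | no  q = subst₂ _≤_ (sym (P′-hi (≰⇒> p))) (sym (P′-hi (≰⇒> q))) (/-monoˡ-≤ m (P-mono i≤j))

    P′-pos : ∀ t → 1 ≤ P′ (suc t)
    P′-pos t with suc t ≤? t₀
    ... | yes p = subst (1 ≤_) (sym (P′-lo p)) (P-pos t)
    ... | no  q = subst (1 ≤_) (sym (P′-hi (≰⇒> q))) (≤-trans P-gap⁺ (/-monoˡ-≤ m (P-mono (≰⇒> q))))

    profile′ : Profile c′ X′ Y′ P′
    profile′ = record
      { X-zero = trans (X′-lo (≤-trans P-gap⁺ low-gap)) X-zero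
      ; Y-zero = trans (Y′-lo z≤n) Y-zero
      ; P-mono = P′-mono ; P-pos = P′-pos ; X-step = X′-step ; Y-step = Y′-step }

-- Iterated contraction down to bounded positions.

module Downscaling where
  open MinSums
  open Profiles
  open CeilingDivision
  open Contraction
  open import Data.Nat
  open import Data.Nat.Properties
  open import Data.Nat.DivMod
  open import Data.Nat.Tactic.RingSolver using (solve-∀)

  -- The state after `t` rounds. Division factors are chosen by the size of `P`, whereas contraction
  -- needs `Y` to be large; `L` translates between the two. It doubles per round because `M` is at
  -- most `2 * m`.
  record Stage (c′ t L p y : ℕ) (X Y P : ℕ → ℕ) : Set where
    field
      profile : Profile c′ X Y P
      X-mono  : Monotone X
      Y-mono  : Monotone Y
      P-bound : P t ≤ p
      Y-bound : Y t ≤ y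
      P≤L*Y   : ∀ s → s ≤ c′ → P (suc s) ≤ L * Y (suc s)

  slack : ℕ → ℕ → ℕ
  slack N c′ = N * (2 * suc c′ + 2) + 2

  abstract
    -- If `P (suc t)` is at least `m` times this, the first summand yields `Y-gap⁺` through `P≤L*Y`,
    -- and the second keeps `P t` below the divided next position.
    gap : (N c′ L p y : ℕ) → ℕ
    gap N c′ L p y = L * (slack N c′ * (1 + 2 * y)) + suc p

    slack≤gap : ∀ N c′ L p y → L * (slack N c′ * (1 + 2 * y)) ≤ gap N c′ L p y
    slack≤gap N c′ L p y = m≤m+n _ (suc p)

    p<gap : ∀ N c′ L p y → p < gap N c′ L p y
    p<gap N c′ L p y = m≤n+m (suc p) _

  -- Let `G` be the gap and `g` the quotient of `P (suc t)` by `N * G`. If `g` is zero, the position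
  -- is below `N * G` already. Otherwise it is below `2 * g * N * G`, and division by `N * g` leaves
  -- at most `2 * G`. The bound covers both cases.
  nextP nextY : (N c′ L p y : ℕ) → ℕ
  nextP N c′ L p y = 2 * (N * gap N c′ L p y)
  nextY N c′ L p y = nextP N c′ L p y * (1 + 2 * y)

  -- The inequality says that the final ratio of size to length drops by a factor of at most
  -- `suc N / N`, that is `M / m`.
  NextStage : (N c′ t L p y : ℕ) (Y P : ℕ → ℕ) → Set
  NextStage N c′ t L p y Y P =
    Σ (ℕ → ℕ) λ X′ → Σ (ℕ → ℕ) λ Y′ → Σ (ℕ → ℕ) λ P′ →
      Stage c′ (suc t) (2 * L) (nextP N c′ L p y) (nextY N c′ L p y) X′ Y′ P′ ×
      N * Y (suc c′) * P′ (suc c′) ≤ suc N * Y′ (suc c′) * P (suc c′)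

  module _ {c′ t L p y N : ℕ} {X Y P} (S : Stage c′ t L p y X Y P)
    (t≤c′ : t ≤ c′) (1≤L : 1 ≤ L) (1≤N : 1 ≤ N) where
    open Stage S
    open Profile profile
    open ≤-Reasoning

    private
      G : ℕ
      G = gap N c′ L p y

    keep : P (suc t) < N * G → NextStage N c′ t L p y Y P
    keep P< = X , Y , P , record
      { profile = profile ; X-mono = X-mono ; Y-mono = Y-mono
      ; P-bound = Pt≤
      ; Y-bound = ≤-trans (Y-linear profile Y-mono t t≤c′) (*-mono-≤ Pt≤ (s≤s (*-monoʳ-≤ 2 Y-bound)))
      ; P≤L*Y = λ s s≤ → ≤-trans (P≤L*Y s s≤) (*-monoˡ-≤ (Y (suc s)) (m≤n*m L 2))
      } , *-monoˡ-≤ (P (suc c′)) (*-monoˡ-≤ (Y (suc c′)) (n≤1+n N))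
      where
      Pt≤ : P (suc t) ≤ nextP N c′ L p y
      Pt≤ = ≤-trans (<⇒≤ P<) (m≤n*m (N * G) 2)

    rescale : ∀ g m′ → suc m′ ≡ N * g → g * (N * G) ≤ P (suc t) → P (suc t) < suc g * (N * G) → 1 ≤ g → g ≤ suc m′ →
      NextStage N c′ t L p y Y P
    rescale g m′ m≡ lo hi 1≤g g≤m = runningMax X′ , runningMax Y′ , P′ , stage , quality
      where
      mG≤P : suc m′ * G ≤ P (suc t)
      mG≤P = ≤-trans (≤-reflexive (trans (cong (_* G) m≡) (ring N g G))) lo
        where
        ring : ∀ a b c → a * b * c ≡ b * (a * c)
        ring = solve-∀
      below : ∀ {z} → z ≤ G → z ≤ P (suc t) / suc m′
      below z≤ = d*n≤m⇒n≤m/d (suc m′) (≤-trans (*-monoʳ-≤ (suc m′) z≤) mG≤P)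
      gap⁺ : slack N c′ * (suc m′ * (1 + 2 * Y t)) ≤ Y (suc t)
      gap⁺ = *-cancelˡ-≤ L {{>-nonZero 1≤L}} (begin
        L * (slack N c′ * (suc m′ * (1 + 2 * Y t))) ≡⟨ ring L (slack N c′) (suc m′) (1 + 2 * Y t) ⟩
        suc m′ * (L * (slack N c′ * (1 + 2 * Y t))) ≤⟨ *-monoʳ-≤ (suc m′) (≤-trans
            (*-monoʳ-≤ L (*-monoʳ-≤ (slack N c′) (s≤s (*-monoʳ-≤ 2 Y-bound))))
            (slack≤gap N c′ L p y)) ⟩
        suc m′ * G  ≤⟨ mG≤P ⟩
        P (suc t)  ≤⟨ P≤L*Y t t≤c′ ⟩
        L * Y (suc t)  ∎)
        where
        ring : ∀ a b c d → a * (b * (c * d)) ≡ c * (a * (b * d))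
        ring = solve-∀
      M≤2m : suc (m′ + g) ≤ 2 * suc m′
      M≤2m = ≤-trans (+-monoʳ-≤ (suc m′) g≤m) (≤-reflexive (cong (suc m′ +_) (sym (+-identityʳ (suc m′)))))
      gap₂ : suc (m′ + g) * (2 * Y t) ≤ Y (suc t)
      gap₂ = begin
        suc (m′ + g) * (2 * Y t)  ≤⟨ *-mono-≤ M≤2m (n≤1+n (2 * Y t)) ⟩
        2 * suc m′ * (1 + 2 * Y t)  ≡⟨ *-assoc 2 (suc m′) (1 + 2 * Y t) ⟩
        2 * (suc m′ * (1 + 2 * Y t))  ≤⟨ *-monoˡ-≤ (suc m′ * (1 + 2 * Y t)) (m≤n+m 2 (N * (2 * suc c′ + 2))) ⟩
        slack N c′ * (suc m′ * (1 + 2 * Y t))  ≤⟨ gap⁺ ⟩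
        Y (suc t)  ∎
      open Contract profile X-mono Y-mono t m′ g N t≤c′ m≡
        (below (≤-trans P-bound (<⇒≤ (p<gap N c′ L p y))))
        (below (≤-trans (s≤s z≤n) (p<gap N c′ L p y))) gap₂ gap⁺
      profile″ : Profile c′ (runningMax X′) (runningMax Y′) P′
      profile″ = runningMax-profile profile′
      P′t≤ : P′ (suc t) ≤ nextP N c′ L p y
      P′t≤ = begin
        P′ (suc t)  ≡⟨ P′-hi (n<1+n t) ⟩
        P (suc t) / suc m′  ≤⟨ <⇒≤ (m<n*o⇒m/o<n {n = 2 * (N * G)} P<) ⟩
        2 * (N * G)  ∎
        where
        P< : P (suc t) < 2 * (N * G) * suc m′
        P< = begin-strict
          P (suc t)  <⟨ hi ⟩
          suc g * (N * G)  ≤⟨ *-monoˡ-≤ (N * G) (+-monoˡ-≤ g 1≤g) ⟩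
          (g + g) * (N * G)  ≡⟨ ring g N G ⟩
          2 * G * (N * g)  ≡⟨ cong (2 * G *_) (sym m≡) ⟩
          2 * G * suc m′  ≤⟨ *-monoˡ-≤ (suc m′) (*-monoʳ-≤ 2 (m≤n*m G N {{>-nonZero 1≤N}})) ⟩
          2 * (N * G) * suc m′  ∎
          where
          ring : ∀ g N G → (g + g) * (N * G) ≡ 2 * G * (N * g)
          ring = solve-∀
      Y′t≤ : runningMax Y′ t ≤ y
      Y′t≤ = runningMax-lub Y′ t (λ i i≤t → ≤-trans (≤-reflexive (Y′-lo i≤t)) (≤-trans (Y-mono i≤t) Y-bound))
      P′≤ : ∀ s → s ≤ c′ → P′ (suc s) ≤ 2 * L * Y′ (suc s)
      P′≤ s s≤ = cases (suc s ≤? t)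
        where
        ring : ∀ a b c → a * (2 * b * c) ≡ b * (2 * a * c)
        ring = solve-∀
        cases : Dec (suc s ≤ t) → P′ (suc s) ≤ 2 * L * Y′ (suc s)
        cases (yes q) = begin
          P′ (suc s)  ≡⟨ P′-lo q ⟩
          P (suc s)  ≤⟨ P≤L*Y s s≤ ⟩
          L * Y (suc s)  ≡⟨ cong (L *_) (sym (Y′-lo q)) ⟩
          L * Y′ (suc s)  ≤⟨ *-monoˡ-≤ (Y′ (suc s)) (m≤n*m L 2) ⟩
          2 * L * Y′ (suc s)  ∎
        cases (no  q) = *-cancelˡ-≤ (suc m′) (begin
          suc m′ * P′ (suc s)  ≤⟨ n≤m/d⇒d*n≤m (suc m′) (≤-reflexive (P′-hi (≰⇒> q))) ⟩
          P (suc s)  ≤⟨ P≤L*Y s s≤ ⟩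
          L * Y (suc s)  ≤⟨ *-monoʳ-≤ L (Y≤M*Y′ (suc s)) ⟩
          L * (suc (m′ + g) * Y′ (suc s))  ≤⟨ *-monoʳ-≤ L (*-monoˡ-≤ (Y′ (suc s)) M≤2m) ⟩
          L * (2 * suc m′ * Y′ (suc s))  ≡⟨ ring L (suc m′) (Y′ (suc s)) ⟩
          suc m′ * (2 * L * Y′ (suc s))  ∎)
      stage : Stage c′ (suc t) (2 * L) (nextP N c′ L p y) (nextY N c′ L p y) (runningMax X′) (runningMax Y′) P′
      stage = record
        { profile = profile″ ; X-mono = runningMax-mono X′ ; Y-mono = runningMax-mono Y′
        ; P-bound = P′t≤
        ; Y-bound = ≤-trans (Y-linear profile″ (runningMax-mono Y′) t t≤c′)
            (*-mono-≤ P′t≤ (s≤s (*-monoʳ-≤ 2 Y′t≤)))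
        ; P≤L*Y = λ s s≤ → ≤-trans (P′≤ s s≤) (*-monoʳ-≤ (2 * L) (≤-runningMax Y′ (suc s)))
        }
      quality : N * Y (suc c′) * P′ (suc c′) ≤ suc N * runningMax Y′ (suc c′) * P (suc c′)
      quality = begin
        N * Y (suc c′) * P′ (suc c′)  ≤⟨ *-monoˡ-≤ (P′ (suc c′)) (*-monoʳ-≤ N (Y≤M*Y′ (suc c′))) ⟩
        N * ((suc m′ + g) * Y′ (suc c′)) * P′ (suc c′)  ≡⟨ cong (λ z → N * ((z + g) * Y′ (suc c′)) * P′ (suc c′)) m≡ ⟩
        N * ((N * g + g) * Y′ (suc c′)) * P′ (suc c′)  ≡⟨ ring N g (Y′ (suc c′)) (P′ (suc c′)) ⟩
        suc N * Y′ (suc c′) * (N * g * P′ (suc c′))  ≡⟨ cong (λ z → suc N * Y′ (suc c′) * (z * P′ (suc c′))) (sym m≡) ⟩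
        suc N * Y′ (suc c′) * (suc m′ * P′ (suc c′))  ≤⟨ *-mono-≤ (*-monoʳ-≤ (suc N) (≤-runningMax Y′ (suc c′)))
            (n≤m/d⇒d*n≤m (suc m′) (≤-reflexive (P′-hi (s≤s t≤c′)))) ⟩
        suc N * runningMax Y′ (suc c′) * P (suc c′)  ∎
        where
        ring : ∀ N g a b → N * ((N * g + g) * a) * b ≡ (1 + N) * a * (N * g * b)
        ring = solve-∀

    nextStage : NextStage N c′ t L p y Y P
    nextStage = go (N * G) refl
      where
      NG⁺ : 1 ≤ N * G
      NG⁺ = *-mono-≤ 1≤N (≤-trans (s≤s z≤n) (p<gap N c′ L p y))
      go : ∀ d → d ≡ N * G → NextStage N c′ t L p y Y P
      go zero eq with subst (1 ≤_) (sym eq) NG⁺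
      ... | ()
      go (suc d) eq = byQuotient (P (suc t) / suc d) (n≤m/d⇒d*n≤m (suc d) ≤-refl) (m<n*[1+m/n] (P (suc t)) d)
        where
        byQuotient : ∀ q → suc d * q ≤ P (suc t) → P (suc t) < suc d * suc q → NextStage N c′ t L p y Y P
        byQuotient zero _ hi = keep (subst (P (suc t) <_) (trans (*-identityʳ (suc d)) eq) hi)
        byQuotient (suc g) lo hi = factor N refl
          where
          factor : ∀ N₀ → N₀ ≡ N → NextStage N c′ t L p y Y P
          factor zero eqN with subst (1 ≤_) (sym eqN) 1≤N
          ... | ()
          factor (suc N′) eqN = rescale (suc g) (g + N′ * suc g) (cong (_* suc g) eqN) lo′ hi′ (s≤s z≤n) (m≤m+n (suc g) (N′ * suc g))
            where
            lo′ = subst (_≤ P (suc t)) (trans (*-comm (suc d) (suc g)) (cong (suc g *_) eq)) lo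
            hi′ = subst (P (suc t) <_) (trans (*-comm (suc d) (suc (suc g))) (cong (suc (suc g) *_) eq)) hi

  abstract
    scale pBound yBound : (N c′ t : ℕ) → ℕ
    scale N c′ zero    = 1
    scale N c′ (suc t) = 2 * scale N c′ t
    pBound N c′ zero    = 0
    pBound N c′ (suc t) = nextP N c′ (scale N c′ t) (pBound N c′ t) (yBound N c′ t)
    yBound N c′ zero    = 0
    yBound N c′ (suc t) = nextY N c′ (scale N c′ t) (pBound N c′ t) (yBound N c′ t)

  Downscaled : (N c′ t : ℕ) (Y P : ℕ → ℕ) → Set
  Downscaled N c′ t Y P =
    Σ (ℕ → ℕ) λ X′ → Σ (ℕ → ℕ) λ Y′ → Σ (ℕ → ℕ) λ P′ →
      Stage c′ t (scale N c′ t) (pBound N c′ t) (yBound N c′ t) X′ Y′ P′ ×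
      N ^ t * Y (suc c′) * P′ (suc c′) ≤ suc N ^ t * Y′ (suc c′) * P (suc c′)

  abstract
    -- The ratio losses of successive rounds multiply; the intermediate product `Y₁ * P₁` cancels,
    -- being positive by `P≤L*Y`.
    downscale : ∀ {N c′ X Y P} → 1 ≤ N → Stage c′ 0 1 0 0 X Y P → ∀ t → t ≤ suc c′ → Downscaled N c′ t Y P
    downscale {X = X} {Y} {P} 1≤N S zero _ = X , Y , P , S , ≤-refl
    downscale {N} {c′} {X} {Y} {P} 1≤N S (suc t) (s≤s t≤c′) with downscale {N} 1≤N S t (m≤n⇒m≤1+n t≤c′)
    ... | X₁ , Y₁ , P₁ , S₁ , q₁ with nextStage {N = N} S₁ t≤c′ (scale⁺ t) 1≤N
      where
      scale⁺ : ∀ t → 1 ≤ scale N c′ t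
      scale⁺ zero    = ≤-refl
      scale⁺ (suc t) = ≤-trans (scale⁺ t) (m≤n*m (scale N c′ t) 2)
    ... | X₂ , Y₂ , P₂ , S₂ , q₂ = X₂ , Y₂ , P₂ , S₂ ,
      *-cancelˡ-≤ (Y₁ (suc c′) * P₁ (suc c′)) {{>-nonZero YP⁺}} (begin
        Y₁ c * P₁ c * (N * N ^ t * Y c * P₂ c)  ≡⟨ ring₁ (Y₁ c) (P₁ c) N (N ^ t) (Y c) (P₂ c) ⟩
        N ^ t * Y c * P₁ c * (N * Y₁ c * P₂ c)  ≤⟨ *-mono-≤ q₁ q₂ ⟩
        suc N ^ t * Y₁ c * P c * (suc N * Y₂ c * P₁ c)  ≡⟨ ring₂ (Y₁ c) (P₁ c) (suc N) (suc N ^ t) (Y₂ c) (P c) ⟩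
        Y₁ c * P₁ c * (suc N * suc N ^ t * Y₂ c * P c)  ∎)
      where
      open ≤-Reasoning
      c : ℕ
      c = suc c′
      ring₁ : ∀ y p n nt Y P → y * p * (n * nt * Y * P) ≡ nt * Y * p * (n * y * P)
      ring₁ = solve-∀
      ring₂ : ∀ y p n nt Y P → nt * y * P * (n * Y * p) ≡ y * p * (n * nt * Y * P)
      ring₂ = solve-∀
      Y⁺ : ∀ {L y} → 1 ≤ L * y → 1 ≤ y
      Y⁺ {L} {zero}  h = ≤-trans h (≤-reflexive (*-zeroʳ L))
      Y⁺ {L} {suc y} h = s≤s z≤n
      P⁺ : 1 ≤ P₁ c
      P⁺ = Profile.P-pos (Stage.profile S₁) c′
      YP⁺ : 1 ≤ Y₁ c * P₁ c
      YP⁺ = *-mono-≤ (Y⁺ {scale N c′ t} (≤-trans P⁺ (Stage.P≤L*Y S₁ c′ ≤-refl))) P⁺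

-- The list minima of the definitions as minima over splits.

module MinSumLists where
  open MinSums
  open import Data.Nat
  open import Data.Nat.Properties
  open import Data.List.Properties using (length-reverse; unfold-reverse; length-++)

  at : List ℕ → ℕ → ℕ
  at []       _       = 0
  at (x ∷ xs) zero    = x
  at (x ∷ xs) (suc i) = at xs i

  at-++ˡ : ∀ xs ys {i} → i < length xs → at (xs ++ ys) i ≡ at xs i
  at-++ˡ (x ∷ xs) ys {zero}  _         = refl
  at-++ˡ (x ∷ xs) ys {suc i} (s≤s i<n) = at-++ˡ xs ys i<n

  at-last : ∀ xs x → at (xs ++ [ x ]) (length xs) ≡ x
  at-last []       x = refl
  at-last (_ ∷ xs) x = at-last xs x

  length-snoc : ∀ (xs : List ℕ) x → length (xs ++ [ x ]) ≡ suc (length xs)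
  length-snoc xs x = trans (length-++ xs) (+-comm (length xs) 1)

  at-reverse : ∀ xs i j → suc (i + j) ≡ length xs → at (reverse xs) i ≡ at xs j
  at-reverse (x ∷ xs) i zero e = trans (cong (λ l → at l i) (unfold-reverse x xs))
    (subst (λ k → at (reverse xs ++ [ x ]) k ≡ x)
      (trans (length-reverse xs) (trans (sym (suc-injective e)) (+-identityʳ i)))
      (at-last (reverse xs) x))
  at-reverse (x ∷ xs) i (suc j) e = trans (cong (λ l → at l i) (unfold-reverse x xs))
    (trans (at-++ˡ (reverse xs) [ x ] (≤-trans (s≤s (m≤m+n i j)) (≤-reflexive (trans e′ (sym (length-reverse xs))))))
      (at-reverse xs i j e′))
    where
    e′ : suc (i + j) ≡ length xs
    e′ = trans (sym (+-suc i j)) (suc-injective e)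

  at-zipWith : ∀ xs ys i → i < length xs → i < length ys → at (zipWith _+_ xs ys) i ≡ at xs i + at ys i
  at-zipWith (x ∷ xs) (y ∷ ys) zero    _       _       = refl
  at-zipWith (x ∷ xs) (y ∷ ys) (suc i) (s≤s p) (s≤s q) = at-zipWith xs ys i p q

  length-zipWith : ∀ (xs ys : List ℕ) → length xs ≡ length ys → length (zipWith _+_ xs ys) ≡ length xs
  length-zipWith []       ys       _ = refl
  length-zipWith (x ∷ xs) (y ∷ ys) e = cong suc (length-zipWith xs ys (suc-injective e))

  foldr-⊓-≤ : ∀ x xs → foldr _⊓_ x xs ≤ x
  foldr-⊓-≤ x []       = ≤-refl
  foldr-⊓-≤ x (y ∷ xs) = ≤-trans (m⊓n≤n y (foldr _⊓_ x xs)) (foldr-⊓-≤ x xs)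

  foldr-⊓-at : ∀ x xs i → i < length xs → foldr _⊓_ x xs ≤ at xs i
  foldr-⊓-at x (y ∷ xs) zero    _       = m⊓n≤m y (foldr _⊓_ x xs)
  foldr-⊓-at x (y ∷ xs) (suc i) (s≤s p) = ≤-trans (m⊓n≤n y (foldr _⊓_ x xs)) (foldr-⊓-at x xs i p)

  minList-≤ : ∀ xs i → i < length xs → minList xs ≤ at xs i
  minList-≤ (x ∷ xs) zero    _       = foldr-⊓-≤ x xs
  minList-≤ (x ∷ xs) (suc i) (s≤s p) = foldr-⊓-at x xs i p

  foldr-⊓-attained : ∀ x xs → ∃ λ i → i < suc (length xs) × foldr _⊓_ x xs ≡ at (x ∷ xs) i
  foldr-⊓-attained x [] = 0 , s≤s z≤n , refl
  foldr-⊓-attained x (y ∷ xs) with ≤-total y (foldr _⊓_ x xs)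
  ... | inj₁ p = 1 , s≤s (s≤s z≤n) , m≤n⇒m⊓n≡m p
  ... | inj₂ p with foldr-⊓-attained x xs
  ...   | zero  , _ , e = 0 , s≤s z≤n , trans (m≥n⇒m⊓n≡n p) e
  ...   | suc i , s≤s lt , e = suc (suc i) , s≤s (s≤s lt) , trans (m≥n⇒m⊓n≡n p) e

  minList-attained : ∀ xs → 1 ≤ length xs → ∃ λ i → i < length xs × minList xs ≡ at xs i
  minList-attained (x ∷ xs) _ = foldr-⊓-attained x xs

  module _ (xs : List ℕ) where
    private
      zs : List ℕ
      zs = zipWith _+_ xs (reverse xs)

      length-zs : length zs ≡ length xs
      length-zs = length-zipWith xs (reverse xs) (sym (length-reverse xs))

      at-zs : ∀ i j → suc (i + j) ≡ length xs → at zs i ≡ at xs i + at xs j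
      at-zs i j e = trans (at-zipWith xs (reverse xs) i i< (≤-trans i< (≤-reflexive (sym (length-reverse xs)))))
        (cong (at xs i +_) (at-reverse xs i j e))
        where
        i< : i < length xs
        i< = ≤-trans (s≤s (m≤m+n i j)) (≤-reflexive e)

    minSum-≤ : ∀ i j → suc (i + j) ≡ length xs → minSum xs ≤ at xs i + at xs j
    minSum-≤ i j e = ≤-trans (minList-≤ zs i (≤-trans (s≤s (m≤m+n i j)) (≤-reflexive (trans e (sym length-zs)))))
      (≤-reflexive (at-zs i j e))

    minSum-attained : ∀ n → length xs ≡ suc n → ∃₂ λ i j → i + j ≡ n × minSum xs ≡ at xs i + at xs j
    minSum-attained n e with minList-attained zs (≤-trans (s≤s (z≤n {n})) (≤-reflexive (sym (trans length-zs e))))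
    ... | i , lt , eq = i , n ∸ i , m+[n∸m]≡n i≤n ,
      trans eq (at-zs i (n ∸ i) (trans (cong suc (m+[n∸m]≡n i≤n)) (sym e)))
      where
      i≤n : i ≤ n
      i≤n = s≤s⁻¹ (≤-trans lt (≤-reflexive (trans length-zs e)))

    minSum≡ms : ∀ n → length xs ≡ suc n → minSum xs ≡ ms (at xs) n
    minSum≡ms n e = ≤-antisym lower upper
      where
      lower : minSum xs ≤ ms (at xs) n
      lower with ms-attained (at xs) n
      ... | i , j , s , eq = ≤-trans (minSum-≤ i j (trans (cong suc s) (sym e))) (≤-reflexive (sym eq))
      upper : ms (at xs) n ≤ minSum xs
      upper with minSum-attained n e
      ... | i , j , s , eq = ≤-trans (ms-≤′ (at xs) i j s) (≤-reflexive (sym eq))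

-- Words, their profiles and their slopes.

module Words where
  open MinSums
  open Profiles
  open MinSumLists
  open import Data.Nat
  open import Data.Nat.Properties
  open import Data.Nat.Tactic.RingSolver using (solve-∀)

  kd : List ℕ → List ℕ → ℕ
  kd x y = 1 + minSum x + minSum y

  size : List Color → ℕ
  size α = kd (xs₁ α) (xs₂ α)

  kd≡κ : ∀ x y {n t} → length x ≡ suc n → length y ≡ suc t → kd x y ≡ κ (at x) (at y) n t
  kd≡κ x y ex ey = cong₂ (λ a b → 1 + a + b) (minSum≡ms x _ ex) (minSum≡ms y _ ey)

  run-++ : ∀ α γ x y → run (α ++ γ) x y ≡ run γ (proj₁ (run α x y)) (proj₂ (run α x y))
  run-++ []       γ x y = refl
  run-++ (c₁ ∷ α) γ x y = run-++ α γ _ _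
  run-++ (c₂ ∷ α) γ x y = run-++ α γ _ _

  record Sorted (x : List ℕ) (top : ℕ) : Set where
    field
      sorted  : ∀ i → suc i < length x → at x i ≤ at x (suc i)
      bounded : ∀ i → i < length x → at x i ≤ top
  open Sorted

  at-snoc-≤ : ∀ x {k} → (∀ i → i < length x → at x i ≤ k) → ∀ i → i < suc (length x) → at (x ++ [ k ]) i ≤ k
  at-snoc-≤ x {k} h i i< with m≤n⇒m<n∨m≡n (s≤s⁻¹ i<)
  ... | inj₁ lt   = ≤-trans (≤-reflexive (at-++ˡ x [ k ] lt)) (h i lt)
  ... | inj₂ refl = ≤-reflexive (at-last x k)

  sorted-snoc : ∀ {x k} → Sorted x k → Sorted (x ++ [ k ]) k
  sorted-snoc {x} {k} S .bounded i i< = at-snoc-≤ x (bounded S) i (≤-trans i< (≤-reflexive (length-snoc x k)))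
  sorted-snoc {x} {k} S .sorted i i< with m≤n⇒m<n∨m≡n (s≤s⁻¹ (≤-trans i< (≤-reflexive (length-snoc x k))))
  ... | inj₁ lt = subst₂ _≤_ (sym (at-++ˡ x [ k ] (<-trans (n<1+n i) lt))) (sym (at-++ˡ x [ k ] lt)) (sorted S i lt)
  ... | inj₂ eq = ≤-trans (at-snoc-≤ x (bounded S) i (≤-trans (≤-reflexive eq) (n≤1+n _)))
    (≤-reflexive (sym (trans (cong (at (x ++ [ k ])) eq) (at-last x k))))

  sorted-top : ∀ {x k k′} → k ≤ k′ → Sorted x k → Sorted x k′
  sorted-top k≤ S .sorted  = sorted S
  sorted-top k≤ S .bounded i i< = ≤-trans (bounded S i i<) k≤

  minSum-snoc : ∀ {x k n} → length x ≡ suc n → Sorted x k → minSum x ≤ minSum (x ++ [ k ])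
  minSum-snoc {x} {k} {n} e S = subst₂ _≤_
    (sym (trans (minSum≡ms x n e) (≤-antisym (ms-mono n (λ i i≤ → ≤-reflexive (sym (at≡ i i≤)))) (ms-mono n (λ i i≤ → ≤-reflexive (at≡ i i≤))))))
    (sym (minSum≡ms (x ++ [ k ]) (suc n) e′))
    (ms-suc n (λ i i≤ → sorted (sorted-snoc S) i (≤-trans (s≤s (s≤s i≤)) (≤-reflexive (sym e′)))))
    where
    e′ : length (x ++ [ k ]) ≡ suc (suc n)
    e′ = trans (length-snoc x k) (cong suc e)
    at≡ : ∀ i → i ≤ n → at (x ++ [ k ]) i ≡ at x i
    at≡ i i≤ = at-++ˡ x [ k ] (≤-trans (s≤s i≤) (≤-reflexive (sym e)))

  -- `kd x y` is the next entry of whichever list is extended, so each sortedness condition includes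
  -- it as upper bound. `index≤₁` is what later bounds positions by sizes.
  record State (n t : ℕ) (x y : List ℕ) : Set where
    field
      length₁ : length x ≡ suc n
      length₂ : length y ≡ suc t
      sorted₁ : Sorted x (kd x y)
      sorted₂ : Sorted y (kd x y)
      head₁   : at x 0 ≡ 0
      head₂   : at y 0 ≡ 0
      index≤₁ : ∀ i → i ≤ n → i ≤ at x i
  open State public

  initial : State 0 0 (0 ∷ []) (0 ∷ [])
  initial = record { length₁ = refl ; length₂ = refl ; sorted₁ = s ; sorted₂ = s
    ; head₁ = refl ; head₂ = refl ; index≤₁ = λ { zero _ → z≤n } }
    where
    s : Sorted (0 ∷ []) 1
    s .sorted i (s≤s ())
    s .bounded zero _ = z≤n
    s .bounded (suc i) (s≤s ())

  kd-snoc₁ : ∀ {n t x y} → State n t x y → kd x y ≤ kd (x ++ [ kd x y ]) y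
  kd-snoc₁ {y = y} S = +-monoˡ-≤ (minSum y) (s≤s (minSum-snoc (length₁ S) (sorted₁ S)))

  kd-snoc₂ : ∀ {n t x y} → State n t x y → kd x y ≤ kd x (y ++ [ kd x y ])
  kd-snoc₂ {x = x} S = +-monoʳ-≤ (1 + minSum x) (minSum-snoc (length₂ S) (sorted₂ S))

  at-zero : ∀ x {k n} → length x ≡ suc n → at x 0 ≡ 0 → at (x ++ [ k ]) 0 ≡ 0
  at-zero x {k} e h = trans (at-++ˡ x [ k ] (≤-trans (s≤s z≤n) (≤-reflexive (sym e)))) h

  next₁ : ∀ {n t x y} → State n t x y → State (suc n) t (x ++ [ kd x y ]) y
  next₁ {n} {t} {x} {y} S = record
    { length₁ = trans (length-snoc x k) (cong suc (length₁ S)) ; length₂ = length₂ S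
    ; sorted₁ = sorted-top (kd-snoc₁ S) (sorted-snoc (sorted₁ S)) ; sorted₂ = sorted-top (kd-snoc₁ S) (sorted₂ S)
    ; head₁ = at-zero x (length₁ S) (head₁ S) ; head₂ = head₂ S ; index≤₁ = index }
    where
    k = kd x y
    index : ∀ i → i ≤ suc n → i ≤ at (x ++ [ k ]) i
    index i i≤ with m≤n⇒m<n∨m≡n i≤
    ... | inj₁ lt = ≤-trans (index≤₁ S i (s≤s⁻¹ lt)) (≤-reflexive (sym (at-++ˡ x [ k ] (≤-trans lt (≤-reflexive (sym (length₁ S)))))))
    ... | inj₂ refl = subst (suc n ≤_) (sym (trans (cong (at (x ++ [ k ])) (sym (length₁ S))) (at-last x k)))
      (subst (suc n ≤_) (sym (kd≡κ x y (length₁ S) (length₂ S)))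
        (≤-trans (s≤s (ms-≥-index n (index≤₁ S))) (m≤m+n (1 + ms (at x) n) (ms (at y) t))))

  next₂ : ∀ {n t x y} → State n t x y → State n (suc t) x (y ++ [ kd x y ])
  next₂ {x = x} {y} S = record
    { length₁ = length₁ S ; length₂ = trans (length-snoc y (kd x y)) (cong suc (length₂ S))
    ; sorted₁ = sorted-top (kd-snoc₂ S) (sorted₁ S) ; sorted₂ = sorted-top (kd-snoc₂ S) (sorted-snoc (sorted₂ S))
    ; head₁ = head₁ S ; head₂ = at-zero y (length₂ S) (head₂ S) ; index≤₁ = index≤₁ S }

  run-state : ∀ α {n t x y} → State n t x y →
    State (n + count c₁ α) (t + count c₂ α) (proj₁ (run α x y)) (proj₂ (run α x y))
  run-state [] {n} {t} {x} {y} S = subst₂ (λ a b → State a b x y) (sym (+-identityʳ n)) (sym (+-identityʳ t)) S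
  run-state (c₁ ∷ α) {n} {t} {x} {y} S = subst
    (λ a → State a (t + count c₂ α) (proj₁ (run (c₁ ∷ α) x y)) (proj₂ (run (c₁ ∷ α) x y)))
    (sym (+-suc n (count c₁ α))) (run-state α (next₁ S))
  run-state (c₂ ∷ α) {n} {t} {x} {y} S = subst
    (λ a → State (n + count c₁ α) a (proj₁ (run (c₂ ∷ α) x y)) (proj₂ (run (c₂ ∷ α) x y)))
    (sym (+-suc t (count c₂ α))) (run-state α (next₂ S))

  word-state : ∀ α → State (count c₁ α) (count c₂ α) (xs₁ α) (xs₂ α)
  word-state α = run-state α initial

  kd-run : ∀ γ {n t x y} → State n t x y → kd x y ≤ kd (proj₁ (run γ x y)) (proj₂ (run γ x y))
  kd-run []       S = ≤-refl
  kd-run (c₁ ∷ γ) S = ≤-trans (kd-snoc₁ S) (kd-run γ (next₁ S))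
  kd-run (c₂ ∷ γ) S = ≤-trans (kd-snoc₂ S) (kd-run γ (next₂ S))

  size-++ : ∀ α γ → size α ≤ size (α ++ γ)
  size-++ α γ = subst (λ r → size α ≤ kd (proj₁ r) (proj₂ r)) (sym (run-++ α γ _ _)) (kd-run γ (word-state α))

  run-at₁ : ∀ α x y {i} → i < length x → at (proj₁ (run α x y)) i ≡ at x i
  run-at₁ []       x y lt = refl
  run-at₁ (c₁ ∷ α) x y lt = trans (run-at₁ α _ y (≤-trans lt (≤-trans (n≤1+n _) (≤-reflexive (sym (length-snoc x _)))))) (at-++ˡ x _ lt)
  run-at₁ (c₂ ∷ α) x y lt = run-at₁ α x _ lt

  run-at₂ : ∀ α x y {i} → i < length y → at (proj₂ (run α x y)) i ≡ at y i
  run-at₂ []       x y lt = refl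
  run-at₂ (c₁ ∷ α) x y lt = run-at₂ α _ y lt
  run-at₂ (c₂ ∷ α) x y lt = trans (run-at₂ α x _ (≤-trans lt (≤-trans (n≤1+n _) (≤-reflexive (sym (length-snoc y _)))))) (at-++ˡ y _ lt)

  -- 1 + the number of ones before the t-th two (counting from 0), for a word read from ν₁ = n;
  -- after the last two it is the final value of ν₁.
  position : List Color → ℕ → ℕ → ℕ
  position []       n t       = n
  position (c₁ ∷ α) n t       = position α (suc n) t
  position (c₂ ∷ α) n zero    = n
  position (c₂ ∷ α) n (suc t) = position α n t

  position-≥ : ∀ α n t → n ≤ position α n t
  position-≥ []       n t       = ≤-refl
  position-≥ (c₁ ∷ α) n t       = ≤-trans (n≤1+n n) (position-≥ α (suc n) t)
  position-≥ (c₂ ∷ α) n zero    = ≤-refl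
  position-≥ (c₂ ∷ α) n (suc t) = position-≥ α n t

  position-mono : ∀ α n {s t} → s ≤ t → position α n s ≤ position α n t
  position-mono []       n s≤t = ≤-refl
  position-mono (c₁ ∷ α) n s≤t = position-mono α (suc n) s≤t
  position-mono (c₂ ∷ α) n {zero}  {zero}  _         = ≤-refl
  position-mono (c₂ ∷ α) n {zero}  {suc t} _         = position-≥ α n t
  position-mono (c₂ ∷ α) n {suc s} {suc t} (s≤s s≤t) = position-mono α n s≤t

  position-end : ∀ α n t → count c₂ α ≤ t → position α n t ≡ n + count c₁ α
  position-end []       n t       _       = sym (+-identityʳ n)
  position-end (c₁ ∷ α) n t       h       = trans (position-end α (suc n) t h) (sym (+-suc n (count c₁ α)))
  position-end (c₂ ∷ α) n (suc t) (s≤s h) = position-end α n t h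

  position-≤ : ∀ α n t → position α n t ≤ n + count c₁ α
  position-≤ α n t with ≤-total (count c₂ α) t
  ... | inj₁ h = ≤-reflexive (position-end α n t h)
  ... | inj₂ h = ≤-trans (position-mono α n h) (≤-reflexive (position-end α n (count c₂ α) ≤-refl))

  κ-cong : ∀ {X Y X′ Y′} a b → (∀ i → i ≤ a → X i ≡ X′ i) → (∀ i → i ≤ b → Y i ≡ Y′ i) → κ X Y a b ≡ κ X′ Y′ a b
  κ-cong a b hX hY = ≤-antisym
    (κ-mono a b (λ i p → ≤-reflexive (hX i p)) (λ i p → ≤-reflexive (hY i p)))
    (κ-mono a b (λ i p → ≤-reflexive (sym (hX i p))) (λ i p → ≤-reflexive (sym (hY i p))))

  module _ where
    private
      -- The final component size is appended to the colour-2 list as the value for a fictitious two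
      -- at the end of the word.
      X Y : List Color → List ℕ → List ℕ → ℕ → ℕ
      X α x y = at (proj₁ (run α x y))
      Y α x y = at (proj₂ (run α x y) ++ [ kd (proj₁ (run α x y)) (proj₂ (run α x y)) ])

    final-Y : ∀ α {x y n t} → State n t x y → ∀ {i} → i ≤ t → Y α x y i ≡ at y i
    final-Y α {x} {y} {n} {t} S {i} i≤ = trans
      (at-++ˡ (proj₂ (run α x y)) _ (≤-trans (s≤s (≤-trans i≤ (m≤m+n t (count c₂ α)))) (≤-reflexive (sym (length₂ (run-state α S))))))
      (run-at₂ α x y (≤-trans (s≤s i≤) (≤-reflexive (sym (length₂ S)))))

    final-X : ∀ α {x y n t} → State n t x y → ∀ {i} → i ≤ n → X α x y i ≡ at x i
    final-X α {x} {y} S i≤ = run-at₁ α x y (≤-trans (s≤s i≤) (≤-reflexive (sym (length₁ S))))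

    kd≡final-κ : ∀ α {x y n t} → State n t x y → kd x y ≡ κ (X α x y) (Y α x y) n t
    kd≡final-κ α {x} {y} S = trans (kd≡κ x y (length₁ S) (length₂ S))
      (κ-cong _ _ (λ i i≤ → sym (final-X α S i≤)) (λ i i≤ → sym (final-Y α S i≤)))

    final-Y-mono : ∀ α {x y n t} → State n t x y → ∀ d → d ≤ count c₂ α → ms (Y α x y) t ≤ ms (Y α x y) (d + t)
    final-Y-mono α S zero _ = ≤-refl
    final-Y-mono α {x} {y} {n} {t} S (suc d) d< = ≤-trans (final-Y-mono α S d (<⇒≤ d<))
      (ms-suc (d + t) (λ i i≤ → sorted (sorted-snoc (sorted₂ F)) i (≤-trans (s≤s (s≤s i≤))
        (≤-trans (s≤s (≤-trans (+-monoˡ-≤ t d<) (≤-reflexive (+-comm (count c₂ α) t))))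
          (≤-trans (n≤1+n _) (≤-reflexive (sym (trans (length-snoc (proj₂ (run α x y)) _) (cong suc (length₂ F))))))))))
      where F = run-state α S

    -- When the entry `suc a` is created, at most `d + t` twos have been read, and raising the
    -- colour-2 index to `d + t` only increases `κ`. Hence an inequality, whereas `run-Y-step` knows
    -- the exact moment and gives an equality.
    run-X-step : ∀ α {x y n t} → State n t x y → ∀ a d → n ≤ a → d ≤ count c₂ α → suc a < position α (suc n) d →
      X α x y (suc a) ≤ κ (X α x y) (Y α x y) a (d + t)
    run-X-step [] S a d n≤a _ lt = ⊥-elim (<⇒≱ lt (s≤s n≤a))
    run-X-step (c₁ ∷ α) {x} {y} {n} {t} S a d n≤a d≤ lt with m≤n⇒m<n∨m≡n n≤a
    ... | inj₁ n<a  = run-X-step α (next₁ S) a d n<a d≤ lt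
    ... | inj₂ refl = begin
      X α _ y (suc n)  ≡⟨ final-X α (next₁ S) ≤-refl ⟩
      at (x ++ [ kd x y ]) (suc n)  ≡⟨ cong (at (x ++ [ kd x y ])) (sym (length₁ S)) ⟩
      at (x ++ [ kd x y ]) (length x)  ≡⟨ at-last x (kd x y) ⟩
      kd x y  ≡⟨ kd≡final-κ (c₁ ∷ α) S ⟩
      κ (X (c₁ ∷ α) x y) (Y (c₁ ∷ α) x y) n t  ≤⟨ +-monoʳ-≤ _ (final-Y-mono (c₁ ∷ α) S d d≤) ⟩
      κ (X (c₁ ∷ α) x y) (Y (c₁ ∷ α) x y) n (d + t)  ∎
      where open ≤-Reasoning
    run-X-step (c₂ ∷ α) S a zero n≤a _ lt = ⊥-elim (<⇒≱ lt (s≤s n≤a))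
    run-X-step (c₂ ∷ α) {x} {y} {n} {t} S a (suc d) n≤a (s≤s d≤) lt = subst
      (λ k → X (c₂ ∷ α) x y (suc a) ≤ κ (X (c₂ ∷ α) x y) (Y (c₂ ∷ α) x y) a k) (+-suc d t)
      (run-X-step α (next₂ S) a d n≤a d≤ lt)

    run-Y-step : ∀ α {x y n t} → State n t x y → ∀ d → d ≤ count c₂ α →
      Y α x y (suc (d + t)) ≡ κ (X α x y) (Y α x y) (pred (position α (suc n) d)) (d + t)
    run-Y-step [] {x} {y} S zero _ = trans (cong (at (y ++ [ kd x y ])) (sym (length₂ S)))
      (trans (at-last y (kd x y)) (kd≡final-κ [] S))
    run-Y-step (c₁ ∷ α) S d d≤ = run-Y-step α (next₁ S) d d≤
    run-Y-step (c₂ ∷ α) {x} {y} {n} {t} S zero _ = begin-equality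
      Y α x _ (suc t)  ≡⟨ final-Y α (next₂ S) ≤-refl ⟩
      at (y ++ [ kd x y ]) (suc t)  ≡⟨ cong (at (y ++ [ kd x y ])) (sym (length₂ S)) ⟩
      at (y ++ [ kd x y ]) (length y)  ≡⟨ at-last y (kd x y) ⟩
      kd x y  ≡⟨ kd≡final-κ (c₂ ∷ α) S ⟩
      κ (X (c₂ ∷ α) x y) (Y (c₂ ∷ α) x y) n t  ∎
      where open ≤-Reasoning
    run-Y-step (c₂ ∷ α) {x} {y} {n} {t} S (suc d) (s≤s d≤) = subst
      (λ k → Y (c₂ ∷ α) x y (suc k) ≡ κ (X (c₂ ∷ α) x y) (Y (c₂ ∷ α) x y) (pred (position α (suc n) d)) k) (+-suc d t)
      (run-Y-step α (next₂ S) d d≤)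

  module _ (α : List Color) where
    wordX wordY wordP : ℕ → ℕ
    wordX = at (xs₁ α)
    wordY = at (xs₂ α ++ [ size α ])
    wordP zero    = 0
    wordP (suc t) = position α 1 t

    wordP-end : wordP (suc (count c₂ α)) ≡ suc (count c₁ α)
    wordP-end = position-end α 1 (count c₂ α) ≤-refl

    wordY-end : wordY (suc (count c₂ α)) ≡ size α
    wordY-end = trans (cong wordY (sym (length₂ (word-state α)))) (at-last (xs₂ α) (size α))

    word-profile : Profile (count c₂ α) wordX wordY wordP
    word-profile = record
      { X-zero = head₁ (word-state α)
      ; Y-zero = trans (final-Y α initial z≤n) refl
      ; P-mono = P-mono
      ; P-pos  = λ t → position-≥ α 1 t
      ; X-step = λ a b b≤ lt → subst (λ k → wordX (suc a) ≤ κ wordX wordY a k) (+-identityʳ b)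
          (run-X-step α initial a b z≤n b≤ lt)
      ; Y-step = λ b b≤ → ≤-reflexive (Y-eq b b≤)
      }
      where
      P-mono : Monotone wordP
      P-mono {zero}  _         = z≤n
      P-mono {suc s} (s≤s s≤t) = position-mono α 1 s≤t
      Y-eq : ∀ b → b ≤ count c₂ α → wordY (suc b) ≡ κ wordX wordY (pred (wordP (suc b))) b
      Y-eq b b≤ = subst (λ k → wordY (suc k) ≡ κ wordX wordY (pred (wordP (suc b))) k) (+-identityʳ b)
        (run-Y-step α initial b b≤)

    -- Each `x₁` entry is at least its index, so the cheapest split of a length costs at least that
    -- length. This starts the compression with `L = 1`.
    wordP≤wordY : ∀ s → s ≤ count c₂ α → wordP (suc s) ≤ wordY (suc s)
    wordP≤wordY s s≤ = begin
      position α 1 s  ≡⟨ sym (suc-pred (position α 1 s) {{>-nonZero (position-≥ α 1 s)}}) ⟩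
      suc (pred (position α 1 s))  ≤⟨ s≤s (ms-≥-index _ (λ i i≤ → index≤₁ (word-state α) i
          (≤-trans i≤ (pred-mono-≤ (position-≤ α 1 s))))) ⟩
      1 + ms wordX (pred (position α 1 s))  ≤⟨ m≤m+n _ (ms wordY (s + 0)) ⟩
      κ wordX wordY (pred (position α 1 s)) (s + 0)  ≡⟨ sym (run-Y-step α initial s s≤) ⟩
      wordY (suc (s + 0))  ≡⟨ cong (λ k → wordY (suc k)) (+-identityʳ s) ⟩
      wordY (suc s)  ∎
      where open ≤-Reasoning

    -- The colour-2 cost only grows along the word, so its final value, contained in `βα α`, bounds
    -- the cost at the moment the entry was created.
    xs₁-subadditive : ∀ a b → suc (a + b) < suc (count c₁ α) →
      at (xs₁ α) (suc (a + b)) ≤ βα α + at (xs₁ α) a + at (xs₁ α) b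
    xs₁-subadditive a b lt = begin
      wordX (suc (a + b))  ≤⟨ Profile.X-step word-profile (a + b) (count c₂ α) ≤-refl
          (≤-trans lt (≤-reflexive (sym wordP-end))) ⟩
      1 + ms wordX (a + b) + ms wordY (count c₂ α)  ≤⟨ +-mono-≤ (s≤s (ms-≤ wordX a b)) (≤-reflexive ms≡) ⟩
      1 + (wordX a + wordX b) + minSum (xs₂ α)  ≡⟨ ring (wordX a) (wordX b) (minSum (xs₂ α)) ⟩
      βα α + wordX a + wordX b  ∎
      where
      open ≤-Reasoning
      ring : ∀ a b s → 1 + (a + b) + s ≡ (1 + s) + a + b
      ring = solve-∀
      at≡ : ∀ i → i ≤ count c₂ α → wordY i ≡ at (xs₂ α) i
      at≡ i i≤ = at-++ˡ (xs₂ α) _ (≤-trans (s≤s i≤) (≤-reflexive (sym (length₂ (word-state α)))))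
      ms≡ : ms wordY (count c₂ α) ≡ minSum (xs₂ α)
      ms≡ = trans (≤-antisym (ms-mono _ (λ i i≤ → ≤-reflexive (at≡ i i≤))) (ms-mono _ (λ i i≤ → ≤-reflexive (sym (at≡ i i≤)))))
        (sym (minSum≡ms (xs₂ α) _ (length₂ (word-state α))))

    size-subadditive : ∀ a b → a + b ≡ count c₁ α → size α ≤ βα α + at (xs₁ α) a + at (xs₁ α) b
    size-subadditive a b e = begin
      1 + minSum (xs₁ α) + minSum (xs₂ α)  ≡⟨ ring (minSum (xs₁ α)) (minSum (xs₂ α)) ⟩
      βα α + minSum (xs₁ α)  ≤⟨ +-monoʳ-≤ (βα α) (minSum-≤ (xs₁ α) a b (trans (cong suc e) (sym (length₁ (word-state α))))) ⟩
      βα α + (at (xs₁ α) a + at (xs₁ α) b)  ≡⟨ sym (+-assoc (βα α) (at (xs₁ α) a) _) ⟩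
      βα α + at (xs₁ α) a + at (xs₁ α) b  ∎
      where
      open ≤-Reasoning
      ring : ∀ a b → 1 + a + b ≡ (1 + b) + a
      ring = solve-∀

  ones : ℕ → List Color
  ones k = replicate k c₁

  -- The condition that every ratio in the minimum δ of the word is at least `p / q`, without
  -- fractions.
  SlopeAtLeast : ℕ → ℕ → List ℕ → ℕ → Set
  SlopeAtLeast p q x B = ∀ j → j < length x → p * suc j ≤ q * (at x j + B)

  -- With `i + j = n` the optimal split, `kd x y + B` is `(at x i + B) + (at x j + B)`, while
  -- `suc i + suc j` is `suc (length x)`: adding the two slope conditions gives the next one. So
  -- appending ones preserves the slope.
  slope-kd : ∀ {p q n t x y} → State n t x y → SlopeAtLeast p q x (1 + minSum y) →
    p * suc (length x) ≤ q * (kd x y + (1 + minSum y))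
  slope-kd {p} {q} {n} {x = x} {y} S h with minSum-attained x n (length₁ S)
  ... | i , j , refl , e = begin
    p * suc (length x)  ≡⟨ cong (λ l → p * suc l) (length₁ S) ⟩
    p * suc (suc (i + j))  ≡⟨ ring₁ p i j ⟩
    p * suc i + p * suc j  ≤⟨ +-mono-≤ (h i (below (m≤m+n i j))) (h j (below (m≤n+m j i))) ⟩
    q * (at x i + B) + q * (at x j + B)  ≡⟨ ring₂ q (at x i) (at x j) (minSum y) ⟩
    q * (1 + (at x i + at x j) + minSum y + B) ≡⟨ cong (λ z → q * (1 + z + minSum y + B)) (sym e) ⟩
    q * (kd x y + B)  ∎
    where
    open ≤-Reasoning
    B = 1 + minSum y
    below : ∀ {k} → k ≤ i + j → k < length x
    below k≤ = ≤-trans (s≤s k≤) (≤-reflexive (sym (length₁ S)))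
    ring₁ : ∀ p i j → p * (2 + (i + j)) ≡ p * (1 + i) + p * (1 + j)
    ring₁ = solve-∀
    ring₂ : ∀ q a b y → q * (a + (1 + y)) + q * (b + (1 + y)) ≡ q * (1 + (a + b) + y + (1 + y))
    ring₂ = solve-∀

  slope-snoc : ∀ {p q n t x y} → State n t x y → SlopeAtLeast p q x (1 + minSum y) →
    SlopeAtLeast p q (x ++ [ kd x y ]) (1 + minSum y)
  slope-snoc {p} {q} {x = x} {y} S h j j< with m≤n⇒m<n∨m≡n (s≤s⁻¹ (≤-trans j< (≤-reflexive (length-snoc x (kd x y)))))
  ... | inj₁ lt   = subst (λ z → p * suc j ≤ q * (z + (1 + minSum y))) (sym (at-++ˡ x _ lt)) (h j lt)
  ... | inj₂ refl = subst (λ z → p * suc j ≤ q * (z + (1 + minSum y))) (sym (at-last x (kd x y))) (slope-kd {p} {q} S h)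

  slope-ones : ∀ {p q} k {n t x y} → State n t x y → SlopeAtLeast p q x (1 + minSum y) →
    p * suc (suc n + k) ≤ q * (kd (proj₁ (run (ones k) x y)) (proj₂ (run (ones k) x y)) + (1 + minSum y))
  slope-ones {p} {q} zero {n} {x = x} {y} S h = subst (λ l → p * suc l ≤ q * (kd x y + (1 + minSum y)))
    (trans (length₁ S) (sym (+-identityʳ (suc n)))) (slope-kd {p} {q} S h)
  slope-ones {p} {q} (suc k) {n} {x = x} {y} S h = subst (λ l → p * suc l ≤ q * (kd (proj₁ (run (ones (suc k)) x y)) (proj₂ (run (ones (suc k)) x y)) + (1 + minSum y))) (sym (+-suc (suc n) k))
    (slope-ones {p} {q} k (next₁ S) (slope-snoc {p} {q} S h))

  slope-size : ∀ {p q} α k → SlopeAtLeast p q (xs₁ α) (βα α) →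
    p * suc (suc (count c₁ α) + k) ≤ q * (size (α ++ ones k) + βα α)
  slope-size {p} {q} α k h = subst (λ r → p * suc (suc (count c₁ α) + k) ≤ q * (kd (proj₁ r) (proj₂ r) + βα α)) (sym (run-++ α (ones k) _ _))
    (slope-ones {p} {q} k (word-state α) h)

  count-++ : ∀ s α γ → count s (α ++ γ) ≡ count s α + count s γ
  count-++ c₁ []       γ = refl
  count-++ c₁ (c₁ ∷ α) γ = cong suc (count-++ c₁ α γ)
  count-++ c₁ (c₂ ∷ α) γ = count-++ c₁ α γ
  count-++ c₂ []       γ = refl
  count-++ c₂ (c₁ ∷ α) γ = count-++ c₂ α γ
  count-++ c₂ (c₂ ∷ α) γ = cong suc (count-++ c₂ α γ)

  count₁-ones : ∀ k → count c₁ (ones k) ≡ k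
  count₁-ones zero    = refl
  count₁-ones (suc k) = cong suc (count₁-ones k)

  count₂-ones : ∀ k → count c₂ (ones k) ≡ 0
  count₂-ones zero    = refl
  count₂-ones (suc k) = count₂-ones k

-- Components, paths and the effect of a new vertex.

module Boards where
  open import Data.Nat using (ℕ; zero; suc; _≤_; z≤n; s≤s)
  open import Data.Nat.Properties using (≤-trans; ≤-reflexive; +-mono-≤)
  open import Data.Nat.ListAction using (sum)
  open import Data.Bool using (Bool; true)
  open import Data.Fin using (Fin; zero; suc; _≟_)
  open import Data.Fin.Properties using (suc-injective)
  open import Data.List.Properties using (length-map; length-++)


  module _ {n : ℕ} {b : Board n} where
    reach-trans : ∀ {u v w} → Reach b u v → Reach b v w → Reach b u w
    reach-trans r here       = r
    reach-trans r (step s e) = step (reach-trans r s) e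

  Symmetric : ∀ {n} → Board n → Set
  Symmetric b = ∀ i j → adj b i j ≡ adj b j i

  module _ {n : ℕ} {b : Board n} where
    reach-sym : Symmetric b → ∀ {u v} → Reach b u v → Reach b v u
    reach-sym sm here       = here
    reach-sym sm (step r e) = reach-trans (step here (trans (sm _ _) e)) (reach-sym sm r)

    reach-linked : ∀ {v vs w} → Linked (Adj b) (v ∷ vs) → w ∈ v ∷ vs → Reach b v w
    reach-linked _       (here refl)       = here
    reach-linked (e ∷ l) (there w∈@(here refl)) = step here e
    reach-linked (e ∷ l) (there w∈@(there _))   = reach-trans (step here e) (reach-linked l w∈)

    symmetric-extend : Symmetric b → ∀ S s → Symmetric (extend b S s)
    symmetric-extend sm S s zero    zero    = refl
    symmetric-extend sm S s zero    (suc j) = refl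
    symmetric-extend sm S s (suc i) zero    = refl
    symmetric-extend sm S s (suc i) (suc j) = sm i j

    reach-extend : ∀ {S s u v} → Reach b u v → Reach (extend b S s) (suc u) (suc v)
    reach-extend here       = here
    reach-extend (step r e) = step (reach-extend r) e

  allPairs-++ : ∀ {A : Set} {R : A → A → Set} (xs : List A) {ys} → AllPairs R (xs ++ ys) →
    AllPairs R xs × AllPairs R ys × (∀ {x y} → x ∈ xs → y ∈ ys → R x y)
  allPairs-++ []       u       = [] , u , λ ()
  allPairs-++ (x ∷ xs) {ys} (p ∷ u) =
    let u₁ , u₂ , d = allPairs-++ xs u
    in (Allₚ.++⁻ˡ xs p ∷ u₁) , u₂ ,
       λ { (here refl) y∈ → All.lookup (Allₚ.++⁻ʳ xs p) y∈ ; (there x∈) y∈ → d x∈ y∈ }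

  Component≥ : ∀ {n} → Board n → Fin n → ℕ → Set
  Component≥ b v m = Σ (List _) λ ws → Unique ws × All (Reach b v) ws × m ≤ length ws

  component≥-move : ∀ {n} {b : Board n} {u v m} → Reach b v u → Component≥ b u m → Component≥ b v m
  component≥-move r (ws , u , rs , le) = ws , u , All.map (reach-trans r) rs , le

  module _ {n : ℕ} {b : Board n} {S : Fin n → Bool} {s : Color} (sm : Symmetric b) where
    private
      b′ = extend b S s

    data EndsAt (u : Fin n) : List (Fin n) → Set where
      end  : EndsAt u [ u ]
      cons : ∀ {x xs} → EndsAt u xs → EndsAt u (x ∷ xs)

    -- A simple path from w to u, written together with the edge from u to the new vertex.
    ReturnPath : Fin n → Fin n → Set
    ReturnPath u w = Σ (List (Fin n)) λ vs →
      EndsAt u (w ∷ vs) × Unique (w ∷ vs) × Linked (Adj b′) (map suc (w ∷ vs) ++ [ zero ])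

    suffix : ∀ {u w} xs → w ∈ xs → EndsAt u xs → Unique xs → Linked (Adj b′) (map suc xs ++ [ zero ]) → ReturnPath u w
    suffix (x ∷ xs) (here refl) e        un       l = xs , e , un , l
    suffix (x ∷ xs) (there w∈) (cons e) (_ ∷ un) l = suffix xs w∈ e un (Linked.tail l)

    -- When the walk meets a vertex of the path built so far, the path is cut back to that vertex,
    -- so it stays simple.
    returnPath : ∀ {u w} → S u ≡ true → Reach b u w → ReturnPath u w
    returnPath {u} Su here = [] , end , [] ∷ [] , Su ∷ [-]
    returnPath {u} {w} Su (step {v} r e) with returnPath Su r
    ... | vs , en , un , l with Data.List.Membership.DecPropositional._∈?_ _≟_ w (v ∷ vs)
      where import Data.List.Membership.DecPropositional
    ... | yes w∈ = suffix (v ∷ vs) w∈ en un l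
    ... | no  w∉ = v ∷ vs , cons en , (All.tabulate (λ x∈ eq → w∉ (subst (_∈ v ∷ vs) (sym eq) x∈)) ∷ un) ,
      trans (sm w v) e ∷ l

    -- Two neighbours of the new vertex in the same component would close a cycle.
    neighbours-separated : Forest b′ → ∀ {u w} → S u ≡ true → S w ≡ true → u ≢ w → ¬ Reach b u w
    neighbours-separated forest {u} {w} Su Sw u≢w r with returnPath Su r
    ... | []     , end     , _  , _ = u≢w refl
    ... | []     , cons () , _  , _
    ... | v ∷ vs , _       , un , l = forest zero (map suc (w ∷ v ∷ vs))
      ( s≤s (s≤s z≤n)
      , (Allₚ.map⁺ (All.tabulate (λ _ ())) ∷ Uniqueₚ.map⁺ suc-injective un)
      , Sw ∷ l )

    -- A vertex counted for two of the listed neighbours would connect them in the old board and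
    -- close a cycle, so the counts add up; the new vertex contributes 1.
    component-join : Forest b′ → (es : List (Fin n × ℕ)) → Unique (map proj₁ es) →
      All (λ e → S (proj₁ e) ≡ true × Component≥ b (proj₁ e) (proj₂ e)) es →
      Component≥ b′ zero (suc (sum (map proj₂ es)))
    component-join forest es un hs with collect es un hs
      where
      collect : (es : List (Fin n × ℕ)) → Unique (map proj₁ es) →
        All (λ e → S (proj₁ e) ≡ true × Component≥ b (proj₁ e) (proj₂ e)) es →
        Σ (List (Fin n)) λ ws → Unique ws ×
          All (λ w → ∃ λ e → e ∈ map proj₁ es × S e ≡ true × Reach b e w) ws × sum (map proj₂ es) ≤ length ws
      collect [] _ _ = [] , [] , [] , z≤n
      collect ((e , k) ∷ es) (e∉ ∷ un) ((Se , vs , vu , vr , vl) ∷ hs) =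
        let ws , wu , wr , wl = collect es un hs in
        vs ++ ws ,
        Uniqueₚ.++⁺ vu wu (λ { (x∈vs , x∈ws) →
          let e′ , e′∈ , Se′ , r′ = All.lookup wr x∈ws in
          neighbours-separated forest Se Se′ (All.lookup e∉ e′∈)
            (reach-trans (All.lookup vr x∈vs) (reach-sym sm r′)) }) ,
        Allₚ.++⁺ (All.map (λ r → e , here refl , Se , r) vr)
          (All.map (λ { (e′ , e′∈ , h) → e′ , there e′∈ , h }) wr) ,
        ≤-trans (+-mono-≤ vl wl) (≤-reflexive (sym (length-++ vs)))
    ... | ws , wu , wr , wl = zero ∷ map suc ws ,
      (Allₚ.map⁺ (All.tabulate (λ _ ())) ∷ Uniqueₚ.map⁺ suc-injective wu) ,
      (here ∷ Allₚ.map⁺ (All.map (λ { (e , _ , Se , r) → reach-trans (step here Se) (reach-extend r) }) wr)) ,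
      s≤s (≤-trans wl (≤-reflexive (sym (length-map suc ws))))

  linked-drop : ∀ {A : Set} {R : A → A → Set} xs {ys : List A} → Linked R (xs ++ ys) → Linked R ys
  linked-drop []       l = l
  linked-drop (x ∷ xs) l = linked-drop xs (Linked.tail l)

  module _ {n : ℕ} {b : Board n} {S : Fin n → Bool} {s : Color} where
    private
      b′ = extend b S s

    last-arm : ∀ v vs {q} → Linked (Adj b′) (map suc (v ∷ vs) ++ zero ∷ q) →
      ∃ λ e → e ∈ v ∷ vs × S e ≡ true × Linked (Adj b) (v ∷ vs)
    last-arm v []        (e ∷ l) = v , here refl , e , [-]
    last-arm v (v′ ∷ vs) (e ∷ l) with last-arm v′ vs l
    ... | u , u∈ , Su , l′ = u , there u∈ , Su , (e ∷ l′)

  data SplitAtNew {n : ℕ} : List (Fin (suc n)) → Set where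
    old   : (us : List (Fin n)) → SplitAtNew (map suc us)
    split : (us : List (Fin n)) (q : List (Fin (suc n))) → SplitAtNew (map suc us ++ zero ∷ q)

  splitAtNew : ∀ {n} (p : List (Fin (suc n))) → SplitAtNew p
  splitAtNew []         = old []
  splitAtNew (zero ∷ p) = split [] p
  splitAtNew (suc u ∷ p) with splitAtNew p
  ... | old us     = old (u ∷ us)
  ... | split us q = split (u ∷ us) q

  avoiding-new : ∀ {n} (q : List (Fin (suc n))) → zero ∉ q → Σ (List (Fin n)) λ us → q ≡ map suc us
  avoiding-new []          _ = [] , refl
  avoiding-new (zero ∷ q)  h = ⊥-elim (h (here refl))
  avoiding-new (suc u ∷ q) h with avoiding-new q (λ z∈ → h (there z∈))
  ... | us , refl = u ∷ us , refl

-- Painter's strategy from thresholds.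

module Painter where
  open Boards
  open MinSums
  open Profiles
  open import Data.Nat using (ℕ; zero; suc; _+_; _≤_; _<_; s≤s)
  open import Data.Nat.Properties
    using (≤-trans; ≤-reflexive; <⇒≱; +-mono-≤; m≤m+n; m≤n+m; +-suc; n≤1+n)
  open import Data.Nat.ListAction using (sum)
  open import Data.Nat.ListAction.Properties using (sum-++)
  open import Data.Bool using (Bool; true)
  open import Data.Fin using (Fin; zero; suc)
  open import Data.List.Properties using (length-map; length-++; map-++)
  open import Data.List.Membership.Propositional.Properties using (∈-map⁺; ∈-map⁻; ∈-++⁺ʳ)

  -- Painter can keep every colour-1 path with m vertices in a component of at least X m
  -- vertices, and likewise for colour 2 and Y: on each new vertex one of the two colours is safe.
  -- Since only the impossibility of a Builder win is claimed, the case distinctions are made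
  -- under a double negation.
  module Thresholds (ℓ c h : ℕ) (X Y : ℕ → ℕ) (1≤ℓ : 1 ≤ ℓ) (1≤c : 1 ≤ c) (X0 : X 0 ≡ 0) (Y0 : Y 0 ≡ 0)
    (safe : ∀ a b → a < ℓ → b < c → X (suc a) ≤ κ X Y a b ⊎ Y (suc b) ≤ κ X Y a b)
    (h≤X : h ≤ X ℓ) (h≤Y : h ≤ Y c) where

    threshold : Color → ℕ → ℕ
    threshold c₁ = X
    threshold c₂ = Y

    target : Color → ℕ
    target c₁ = ℓ
    target c₂ = c

    threshold-zero : ∀ s → threshold s 0 ≡ 0
    threshold-zero c₁ = X0
    threshold-zero c₂ = Y0

    PathsGuarded : ∀ {n} → Board n → Color → Set
    PathsGuarded b s = ∀ v vs → Unique (v ∷ vs) → Linked (Adj b) (v ∷ vs) → All (λ u → col b u ≡ s) (v ∷ vs) →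
      length (v ∷ vs) ≤ target s → ¬ ¬ Component≥ b v (threshold s (length (v ∷ vs)))

    Invariant : ∀ {n} → Board n → Set
    Invariant b = Symmetric b × (∀ s → PathsGuarded b s)

    module _ {n : ℕ} {b : Board n} (inv : Invariant b) (S : Fin n → Bool) where
      private
        sm = proj₁ inv

      Arm : Color → Fin n × ℕ → Set
      Arm s (e , k) = col b e ≡ s × S e ≡ true × ¬ ¬ Component≥ b e k

      Arms : Color → ℕ → List (Fin n × ℕ) → Set
      Arms s m es = Unique (map proj₁ es) × All (Arm s) es × threshold s m ≤ sum (map proj₂ es)

      module _ {s : Color} where
        private
          b′ = extend b S s

        left-arm : ∀ us {q} → Linked (Adj b′) (map suc us ++ zero ∷ q) → Unique us → All (λ u → col b u ≡ s) us →
          length us ≤ target s → Σ (List (Fin n × ℕ)) λ es → Arms s (length us) es × (∀ {e} → e ∈ map proj₁ es → e ∈ us)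
        left-arm [] _ _ _ _ = [] , ([] , [] , ≤-reflexive (threshold-zero s)) , λ ()
        left-arm (v ∷ vs) l un cl le with last-arm {b = b} {s = s} v vs l
        ... | e , e∈ , Se , l′ = [ e , threshold s (length (v ∷ vs)) ] ,
          ( ([] ∷ [])
          , ( (All.lookup cl e∈ , Se , λ k → proj₂ inv s v vs un l′ cl le
                (λ cmp → k (component≥-move (reach-sym sm (reach-linked l′ e∈)) cmp))) ∷ [] )
          , m≤m+n _ 0 ) ,
          λ { (here refl) → e∈ }

        right-arm : ∀ us → Linked (Adj b′) (zero ∷ map suc us) → Unique us → All (λ u → col b u ≡ s) us →
          length us ≤ target s → Σ (List (Fin n × ℕ)) λ es → Arms s (length us) es × (∀ {e} → e ∈ map proj₁ es → e ∈ us)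
        right-arm [] _ _ _ _ = [] , ([] , [] , ≤-reflexive (threshold-zero s)) , λ ()
        right-arm (v ∷ vs) (Sv ∷ l) un cl le = [ v , threshold s (length (v ∷ vs)) ] ,
          ( ([] ∷ [])
          , ( (All.head cl , Sv , proj₂ inv s v vs un (Linkedₚ.map⁻ l) cl le) ∷ [] )
          , m≤m+n _ 0 ) ,
          λ { (here refl) → here refl }

        path-arms : ∀ us q → Unique (map suc us ++ zero ∷ q) → Linked (Adj b′) (map suc us ++ zero ∷ q) →
          All (λ u → col b′ u ≡ s) (map suc us ++ zero ∷ q) → length (map suc us ++ zero ∷ q) ≤ target s →
          ∃ λ a → length (map suc us ++ zero ∷ q) ≡ suc a ×
          Σ (List (Fin n × ℕ)) λ es → Unique (map proj₁ es) × All (Arm s) es × ms (threshold s) a ≤ sum (map proj₂ es)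
        path-arms us q un l cl le with allPairs-++ (map suc us) un
        ... | u₁ , (z∉ ∷ u₂) , dis with avoiding-new q (λ z∈ → All.lookup z∉ z∈ refl)
        ... | ws , refl with left-arm us l (Uniqueₚ.map⁻ u₁) (Allₚ.map⁻ (Allₚ.++⁻ˡ (map suc us) cl)) le₁
                           | right-arm ws (linked-drop (map suc us) l) (Uniqueₚ.map⁻ u₂)
                               (Allₚ.map⁻ (All.tail (Allₚ.++⁻ʳ (map suc us) cl))) le₂
          where
          eq : length us + suc (length ws) ≡ length (map suc us ++ zero ∷ map suc ws)
          eq = sym (trans (length-++ (map suc us)) (trans (cong (_+ suc (length (map suc ws))) (length-map suc us))
            (cong (λ z → length us + suc z) (length-map suc ws))))
          le₁ = ≤-trans (≤-trans (m≤m+n (length us) _) (≤-reflexive eq)) le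
          le₂ = ≤-trans (≤-trans (≤-trans (n≤1+n _) (m≤n+m (suc (length ws)) (length us))) (≤-reflexive eq)) le
        ... | es₁ , (un₁ , a₁ , t₁) , in₁ | es₂ , (un₂ , a₂ , t₂) , in₂ =
          length us + length ws ,
          trans (length-++ (map suc us)) (trans (cong (_+ suc (length (map suc ws))) (length-map suc us))
            (trans (cong (λ z → length us + suc z) (length-map suc ws)) (+-suc (length us) (length ws)))) ,
          es₁ ++ es₂ ,
          subst Unique (sym (map-++ proj₁ es₁ es₂))
            (Uniqueₚ.++⁺ un₁ un₂ (λ { (x∈₁ , x∈₂) →
              dis (∈-map⁺ suc (in₁ x∈₁)) (there (∈-map⁺ suc (in₂ x∈₂))) refl })) ,
          Allₚ.++⁺ a₁ a₂ ,
          ≤-trans (ms-≤ (threshold s) (length us) (length ws)) (≤-trans (+-mono-≤ t₁ t₂)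
            (≤-reflexive (sym (trans (cong sum (map-++ proj₂ es₁ es₂)) (sum-++ (map proj₂ es₁) (map proj₂ es₂))))))

      all-¬¬ : ∀ {A : Set} {P : A → Set} {xs} → All (λ x → ¬ ¬ P x) xs → ¬ ¬ All P xs
      all-¬¬ []       k = k []
      all-¬¬ (p ∷ ps) k = p (λ x → all-¬¬ ps (λ xs → k (x ∷ xs)))

      -- The edges at the new vertex do not depend on its colour, so the arms of both hypothetical
      -- paths, one per colour, hang from it at once. Arms of different colour classes start at
      -- different neighbours.
      joined : ∀ s → Forest (extend b S s) → ∀ {es₁ es₂} → Unique (map proj₁ es₁) → Unique (map proj₁ es₂) →
        All (Arm c₁) es₁ → All (Arm c₂) es₂ →
        ¬ ¬ Component≥ (extend b S s) zero (suc (sum (map proj₂ es₁) + sum (map proj₂ es₂)))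
      joined s forest {es₁} {es₂} u₁ u₂ a₁ a₂ k =
        all-¬¬ (Allₚ.++⁺ (All.map arm a₁) (All.map arm a₂)) λ hs → k
          (subst (λ z → Component≥ (extend b S s) zero (suc z))
            (trans (cong sum (map-++ proj₂ es₁ es₂)) (sum-++ (map proj₂ es₁) (map proj₂ es₂)))
            (component-join sm forest (es₁ ++ es₂)
              (subst Unique (sym (map-++ proj₁ es₁ es₂)) (Uniqueₚ.++⁺ u₁ u₂ disjoint)) hs))
        where
        arm : ∀ {s e} → Arm s e → ¬ ¬ (S (proj₁ e) ≡ true × Component≥ b (proj₁ e) (proj₂ e))
        arm (_ , Se , c) k = c (λ cmp → k (Se , cmp))
        colours : ∀ {s es x} → All (Arm s) es → x ∈ map proj₁ es → col b x ≡ s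
        colours {x = x} as x∈ with ∈-map⁻ proj₁ x∈
        ... | e , e∈ , refl = proj₁ (All.lookup as e∈)
        disjoint : ∀ {x} → x ∈ map proj₁ es₁ × x ∈ map proj₁ es₂ → ⊥
        disjoint (x∈₁ , x∈₂) with trans (sym (colours a₁ x∈₁)) (colours a₂ x∈₂)
        ... | ()

      data ThroughNew (s : Color) : Fin (suc n) → List (Fin (suc n)) → Set where
        old     : ∀ {v vs} → ¬ ¬ Component≥ (extend b S s) v (threshold s (length (v ∷ vs))) → ThroughNew s v vs
        through : ∀ {v vs} → zero ∈ v ∷ vs → ∀ a → length (v ∷ vs) ≡ suc a → suc a ≤ target s →
          (es : List (Fin n × ℕ)) → Unique (map proj₁ es) → All (Arm s) es → ms (threshold s) a ≤ sum (map proj₂ es) →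
          ThroughNew s v vs

      component≥-extend : ∀ {s v m} → Component≥ b v m → Component≥ (extend b S s) (suc v) m
      component≥-extend (ws , u , r , le) = map suc ws , Uniqueₚ.map⁺ (λ { refl → refl }) u ,
        Allₚ.map⁺ (All.map reach-extend r) , ≤-trans le (≤-reflexive (sym (length-map suc ws)))

      old-path : ∀ {s s′} us → Unique (map Fin.suc us) → Linked (Adj (extend b S s)) (map Fin.suc us) →
        All (λ u → col (extend b S s) u ≡ s′) (map Fin.suc us) → length (map Fin.suc us) ≤ target s′ →
        ∀ {v vs} → map Fin.suc us ≡ v ∷ vs → ¬ ¬ Component≥ (extend b S s) v (threshold s′ (length (v ∷ vs)))
      old-path {s} {s′} (u ∷ us) un l cl le refl k = proj₂ inv s′ u us (Uniqueₚ.map⁻ un) (Linkedₚ.map⁻ l) (Allₚ.map⁻ cl)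
        (≤-trans (≤-reflexive (sym (length-map suc (u ∷ us)))) le)
        (λ cmp → k (subst (λ z → Component≥ (extend b S s) (suc u) (threshold s′ (suc z))) (sym (length-map suc us)) (component≥-extend cmp)))

      analyse : ∀ s v vs → Unique (v ∷ vs) → Linked (Adj (extend b S s)) (v ∷ vs) →
        All (λ u → col (extend b S s) u ≡ s) (v ∷ vs) → length (v ∷ vs) ≤ target s → ThroughNew s v vs
      analyse s v vs un l cl le = go (v ∷ vs) (splitAtNew (v ∷ vs)) refl un l cl le
        where
        go : ∀ p → SplitAtNew p → p ≡ v ∷ vs → Unique p → Linked (Adj (extend b S s)) p →
          All (λ u → col (extend b S s) u ≡ s) p → length p ≤ target s → ThroughNew s v vs
        go _ (old us) eq un l cl le = old (old-path us un l cl le eq)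
        go _ (split us q) eq un l cl le with path-arms us q un l cl le
        ... | a , ea , es , u , as , m = through (subst (zero ∈_) eq (∈-++⁺ʳ (map suc us) (here refl))) a
          (trans (cong length (sym eq)) ea) (≤-trans (≤-reflexive (sym ea)) le) es u as m

      other-colour : ∀ {s s′} → s ≢ s′ → PathsGuarded (extend b S s) s′
      other-colour {s} {s′} s≢ v vs un l cl le = go (v ∷ vs) (splitAtNew (v ∷ vs)) refl un l cl le
        where
        go : ∀ p → SplitAtNew p → p ≡ v ∷ vs → Unique p → Linked (Adj (extend b S s)) p →
          All (λ u → col (extend b S s) u ≡ s′) p → length p ≤ target s′ →
          ¬ ¬ Component≥ (extend b S s) v (threshold s′ (length (v ∷ vs)))
        go _ (old us) eq un l cl le = old-path us un l cl le eq
        go _ (split us q) eq un l cl le = ⊥-elim (s≢ (All.head (Allₚ.++⁻ʳ (map suc us) cl)))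

      enlarge : ∀ {n} {b : Board n} {v m m′} → m ≤ m′ → Component≥ b v m′ → Component≥ b v m
      enlarge m≤ (ws , u , r , le) = ws , u , r , ≤-trans m≤ le

      -- If both colours failed, each would have a failing path through the new vertex. `safe`,
      -- applied to the total arm lengths of the two, says that for one of them the joint component
      -- is large enough.
      safe-colour : (∀ s → Forest (extend b S s)) → ¬ PathsGuarded (extend b S c₁) c₁ → ¬ PathsGuarded (extend b S c₂) c₂ → ⊥
      safe-colour forest ¬g₁ ¬g₂ = ¬g₁ λ v₁ vs₁ un₁ l₁ cl₁ le₁ k₁ →
        ¬g₂ λ v₂ vs₂ un₂ l₂ cl₂ le₂ k₂ → clash k₁ k₂ l₁ l₂ (analyse c₁ v₁ vs₁ un₁ l₁ cl₁ le₁) (analyse c₂ v₂ vs₂ un₂ l₂ cl₂ le₂)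
        where
        clash : ∀ {v₁ vs₁ v₂ vs₂} → ¬ Component≥ (extend b S c₁) v₁ (X (length (v₁ ∷ vs₁))) →
          ¬ Component≥ (extend b S c₂) v₂ (Y (length (v₂ ∷ vs₂))) →
          Linked (Adj (extend b S c₁)) (v₁ ∷ vs₁) → Linked (Adj (extend b S c₂)) (v₂ ∷ vs₂) →
          ThroughNew c₁ v₁ vs₁ → ThroughNew c₂ v₂ vs₂ → ⊥
        clash k₁ k₂ l₁ l₂ (old h) _ = h k₁
        clash k₁ k₂ l₁ l₂ (through _ _ _ _ _ _ _ _) (old h) = h k₂
        clash k₁ k₂ l₁ l₂ (through z₁ a ea a≤ es₁ u₁ as₁ m₁) (through z₂ a′ eb b≤ es₂ u₂ as₂ m₂)
          with safe a a′ a≤ b≤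
        ... | inj₁ X≤ = joined c₁ (forest c₁) u₁ u₂ as₁ as₂ λ cmp → k₁ (component≥-move (reach-linked l₁ z₁)
          (enlarge (≤-trans (≤-reflexive (cong X ea)) (≤-trans X≤ (s≤s (+-mono-≤ m₁ m₂)))) cmp))
        ... | inj₂ Y≤ = joined c₂ (forest c₂) u₁ u₂ as₁ as₂ λ cmp → k₂ (component≥-move (reach-linked l₂ z₂)
          (enlarge (≤-trans (≤-reflexive (cong Y eb)) (≤-trans Y≤ (s≤s (+-mono-≤ m₁ m₂)))) cmp))

    not-lost : ∀ {n} {b : Board n} {j} s → Invariant b → ComponentsAtMost j b → j < h → 1 ≤ target s → h ≤ threshold s (target s) →
      ¬ MonoPath b s (target s)
    not-lost s inv small j<h 1≤ h≤ ([] , e , _) with subst (1 ≤_) (sym e) 1≤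
    ... | ()
    not-lost s inv small j<h 1≤ h≤ (v ∷ vs , e , un , l , cl) = proj₂ inv s v vs un l cl (≤-reflexive e)
      λ { (ws , u , r , le) → <⇒≱ j<h (≤-trans h≤ (≤-trans (≤-reflexive (cong (threshold s) (sym e))) (≤-trans le (small v ws u r)))) }

    painter-survives : ∀ {j n} {b : Board n} → j < h → Invariant b → ¬ BuilderWins j ℓ c b
    painter-replies : ∀ {j n} {b : Board n} → j < h → Invariant b → ¬ (Legal j b × (Lost ℓ c b ⊎ BuilderWins j ℓ c b))

    painter-survives {b = b} j<h inv (move S f) = safe-colour inv S (λ s → proj₁ (proj₁ (f s)))
      (λ g → painter-replies j<h (symmetric-extend {b = b} (proj₁ inv) S c₁ , λ { c₁ → g ; c₂ → other-colour inv S {c₁} {c₂} λ () }) (f c₁))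
      (λ g → painter-replies j<h (symmetric-extend {b = b} (proj₁ inv) S c₂ , λ { c₂ → g ; c₁ → other-colour inv S {c₂} {c₁} λ () }) (f c₂))

    painter-replies j<h inv ((_ , small) , inj₁ (inj₁ p)) = not-lost c₁ inv small j<h 1≤ℓ h≤X p
    painter-replies j<h inv ((_ , small) , inj₁ (inj₂ p)) = not-lost c₂ inv small j<h 1≤c h≤Y p
    painter-replies j<h inv (_ , inj₂ w) = painter-survives j<h inv w

    no-win : ∀ {j} → j < h → ¬ BuilderWins j ℓ c emptyBoard
    no-win j<h = painter-survives j<h ((λ ()) , λ s ())

-- Builder's building blocks and the move that joins them.

module Gadgets where
  open Boards
  open import Data.Nat using (ℕ; zero; suc; _+_; _≤_; z≤n; s≤s)
  open import Data.Nat.Properties using (≤-trans; ≤-reflexive; +-mono-≤; +-suc)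
  open import Data.Nat.ListAction using (sum)
  open import Data.Bool using (Bool; true)
  open import Data.Fin using (Fin; zero; suc; _≟_)
  open import Data.List.Properties using (length-map; length-ʳ++; map-++; ++-assoc)
  import Data.List.Relation.Unary.AllPairs.Properties as AllPairsₚ
  open import Data.List.Membership.Propositional.Properties using (∈-map⁺; ∈-map⁻; ∈-++⁺ˡ; ∈-++⁺ʳ)
  import Data.List.Membership.DecPropositional as DecMembership

  -- `head` is an end of the path, so that a new neighbour of it can prolong the path. `bound`
  -- limits the whole component, which may contain vertices off the path.
  record Gadget (n : ℕ) : Set where
    constructor gadget
    field
      colour : Color
      bound  : ℕ
      head   : Fin n
      rest   : List (Fin n)
    path : List (Fin n)
    path = head ∷ rest
  open Gadget public

  Component≤ : ∀ {n} → Board n → Fin n → ℕ → Set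
  Component≤ b v m = ∀ ws → Unique ws → All (Reach b v) ws → length ws ≤ m

  record Valid {n} (b : Board n) (t : Gadget n) : Set where
    constructor valid
    field
      unique : Unique (path t)
      linked : Linked (Adj b) (path t)
      mono   : All (λ v → col b v ≡ colour t) (path t)
      small  : Component≤ b (head t) (bound t)
  open Valid public

  Apart : ∀ {n} → Board n → Gadget n → Gadget n → Set
  Apart b t t′ = ¬ Reach b (head t) (head t′)

  Pool : ∀ {n} → Board n → List (Gadget n) → Set
  Pool b ts = All (Valid b) ts × AllPairs (Apart b) ts

  Playable : ∀ {n} → ℕ → Board n → Set
  Playable k b = Symmetric b × Legal k b

  lift : ∀ {n} → Gadget n → Gadget (suc n)
  lift (gadget s k h r) = gadget s k (suc h) (map suc r)

  bounds : ∀ {n} → List (Gadget n) → ℕ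
  bounds ts = sum (map bound ts)

  partition : ∀ {A : Set} {P Q : A → Set} ws → Unique ws → All (λ w → P w ⊎ Q w) ws →
    Σ (List A) λ xs → Σ (List A) λ ys → Unique xs × Unique ys × All P xs × All Q ys ×
      (∀ {w} → w ∈ xs → w ∈ ws) × (∀ {w} → w ∈ ys → w ∈ ws) × length ws ≡ length xs + length ys
  partition [] _ _ = [] , [] , [] , [] , [] , [] , (λ ()) , (λ ()) , refl
  partition (w ∷ ws) (w∉ ∷ un) (h ∷ hs) with partition ws un hs | h
  ... | xs , ys , ux , uy , px , qy , ix , iy , e | inj₁ p =
    w ∷ xs , ys , (All.tabulate (λ x∈ → All.lookup w∉ (ix x∈)) ∷ ux) , uy , (p ∷ px) , qy ,
    (λ { (here refl) → here refl ; (there x∈) → there (ix x∈) }) , (λ y∈ → there (iy y∈)) , cong suc e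
  ... | xs , ys , ux , uy , px , qy , ix , iy , e | inj₂ q =
    xs , w ∷ ys , ux , (All.tabulate (λ y∈ → All.lookup w∉ (iy y∈)) ∷ uy) , px , (q ∷ qy) ,
    (λ x∈ → there (ix x∈)) , (λ { (here refl) → here refl ; (there y∈) → there (iy y∈) }) ,
    trans (cong suc e) (sym (+-suc (length xs) (length ys)))

  all-or : ∀ {A B : Set} {P : A → Set} {ws} → All (λ w → P w ⊎ B) ws → B ⊎ All P ws
  all-or []            = inj₂ []
  all-or (inj₂ q ∷ _)  = inj₁ q
  all-or (inj₁ p ∷ hs) with all-or hs
  ... | inj₁ q  = inj₁ q
  ... | inj₂ ps = inj₂ (p ∷ ps)

  all-suc : ∀ {n} {P : Fin n → Set} (ws : List (Fin (suc n))) → All (λ w → ∃ λ w′ → w ≡ suc w′ × P w′) ws →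
    Σ (List (Fin n)) λ vs → ws ≡ map suc vs × All P vs
  all-suc [] _ = [] , refl , []
  all-suc (_ ∷ ws) ((v , refl , p) ∷ hs) with all-suc ws hs
  ... | vs , refl , ps = v ∷ vs , refl , (p ∷ ps)

  component-cover : ∀ {n} {b : Board n} ts → All (Valid b) ts → ∀ ws → Unique ws →
    All (λ w → Any (λ t → Reach b (head t) w) ts) ws → length ws ≤ bounds ts
  component-cover [] _ [] _ _ = z≤n
  component-cover [] _ (w ∷ ws) _ (() ∷ _)
  component-cover (t ∷ ts) (v ∷ vs) ws un hs with partition ws un (All.map split-any hs)
    where
    split-any : ∀ {w} → Any _ (t ∷ ts) → Reach _ (head t) w ⊎ Any (λ t → Reach _ (head t) w) ts
    split-any (here r)  = inj₁ r
    split-any (there r) = inj₂ r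
  ... | xs , ys , ux , uy , px , qy , _ , _ , e = ≤-trans (≤-reflexive e)
    (+-mono-≤ (small v xs ux px) (component-cover ts vs ys uy qy))

  module _ {n : ℕ} {b : Board n} {S : Fin n → Bool} {s : Color} where
    private
      b′ = extend b S s

    reach-from-new : ∀ {w} → Reach b′ zero w → w ≡ zero ⊎ ∃ λ w′ → w ≡ suc w′ × ∃ λ e → S e ≡ true × Reach b e w′
    reach-from-new here = inj₁ refl
    reach-from-new (step {w = zero}  r e) = inj₁ refl
    reach-from-new (step {w = suc w} r e) with reach-from-new r
    ... | inj₁ refl                    = inj₂ (w , refl , w , e , here)
    ... | inj₂ (v , refl , u , Su , r′) = inj₂ (w , refl , u , Su , step r′ e)

    reach-from-old : ∀ {v w} → Reach b′ (suc v) w →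
      (∃ λ w′ → w ≡ suc w′ × Reach b v w′) ⊎ (∃ λ e → S e ≡ true × Reach b v e)
    reach-from-old here = inj₁ (_ , refl , here)
    reach-from-old (step {w = w} r e) with reach-from-old r
    ... | inj₂ touch = inj₂ touch
    reach-from-old (step {w = zero}  r e) | inj₁ (v′ , refl , r′) = inj₂ (v′ , e , r′)
    reach-from-old (step {w = suc w} r e) | inj₁ (v′ , refl , r′) = inj₁ (w , refl , step r′ e)

  linked-ʳ++ : ∀ {A : Set} {R : A → A → Set} → (∀ {x y} → R x y → R y x) → ∀ xs {x ys} →
    Linked R (x ∷ xs) → Linked R (x ∷ ys) → Linked R (xs ʳ++ (x ∷ ys))
  linked-ʳ++ sm []        l         l′ = l′
  linked-ʳ++ sm (x′ ∷ xs) (e ∷ l) l′ = linked-ʳ++ sm xs l (sm e ∷ l′)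

  unique-ʳ++ : ∀ {A : Set} xs {ys : List A} → Unique xs → Unique ys → (∀ {x} → x ∈ xs → x ∉ ys) → Unique (xs ʳ++ ys)
  unique-ʳ++ []       ux       uy d = uy
  unique-ʳ++ (x ∷ xs) (p ∷ ux) uy d = unique-ʳ++ xs ux
    (All.tabulate (λ y∈ eq → d (here refl) (subst (_∈ _) (sym eq) y∈)) ∷ uy)
    λ { z∈ (here refl) → All.lookup p z∈ refl ; z∈ (there z∈′) → d (there z∈) z∈′ }

  all-ʳ++ : ∀ {A : Set} {P : A → Set} xs {ys} → All P xs → All P ys → All P (xs ʳ++ ys)
  all-ʳ++ []       _        q = q
  all-ʳ++ (x ∷ xs) (p ∷ ps) q = all-ʳ++ xs ps (p ∷ q)

  ∈-ʳ++ : ∀ {A : Set} {z : A} xs {ys} → z ∈ ys → z ∈ xs ʳ++ ys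
  ∈-ʳ++ []       z∈ = z∈
  ∈-ʳ++ (x ∷ xs) z∈ = ∈-ʳ++ xs (there z∈)

  -- For j = 0 no gadget is needed: the new vertex then ends the path on that side.
  data Half {n} (s : Color) : ℕ → List (Gadget n) → Set where
    none : Half s 0 []
    one  : ∀ t → colour t ≡ s → Half s (suc (length (rest t))) [ t ]

  halfPath : ∀ {n s j} {ts : List (Gadget n)} → Half s j ts → List (Fin n)
  halfPath none      = []
  halfPath (one t _) = path t

  halfPath-length : ∀ {n s j} {ts : List (Gadget n)} (u : Half s j ts) → length (halfPath u) ≡ j
  halfPath-length none      = refl
  halfPath-length (one t _) = refl

  module Attach {n : ℕ} {k : ℕ} {b : Board n} (ok : Playable k b) (used others : List (Gadget n))
    (pool : Pool b (used ++ others)) (fits : suc (bounds used) ≤ k) where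

    private
      sm = proj₁ ok
      forest = proj₁ (proj₂ ok)
      comps = proj₂ (proj₂ ok)

      parts = allPairs-++ used (proj₂ pool)

    used-valid : All (Valid b) used
    used-valid = Allₚ.++⁻ˡ used (proj₁ pool)

    others-valid : All (Valid b) others
    others-valid = Allₚ.++⁻ʳ used (proj₁ pool)

    heads : List (Fin n)
    heads = map head used

    open DecMembership (_≟_ {n}) using (_∈?_)

    attachTo : Fin n → Bool
    attachTo v = does (v ∈? heads)

    attachTo⁻ : ∀ {v} → attachTo v ≡ true → v ∈ heads
    attachTo⁻ {v} e with v ∈? heads
    ... | yes p = p
    attachTo⁻ {v} () | no _

    attachTo⁺ : ∀ {v} → v ∈ heads → attachTo v ≡ true
    attachTo⁺ {v} p with v ∈? heads
    ... | yes _ = refl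
    ... | no ¬p = ⊥-elim (¬p p)

    separated : ∀ {u v} → attachTo u ≡ true → attachTo v ≡ true → u ≢ v → ¬ Reach b u v
    separated Su Sv = go (AllPairsₚ.map⁺ (proj₁ parts)) (attachTo⁻ Su) (attachTo⁻ Sv)
      where
      go : ∀ {hs} → AllPairs (λ u v → ¬ Reach b u v) hs → ∀ {u v} → u ∈ hs → v ∈ hs → u ≢ v → ¬ Reach b u v
      go (p ∷ ps) (here refl) (here refl) u≢v r = u≢v refl
      go (p ∷ ps) (here refl) (there v∈)  u≢v r = All.lookup p v∈ r
      go (p ∷ ps) (there u∈)  (here refl) u≢v r = All.lookup p u∈ (reach-sym sm r)
      go (p ∷ ps) (there u∈)  (there v∈)  u≢v r = go ps u∈ v∈ u≢v r

    apart-others : ∀ {e t} → attachTo e ≡ true → t ∈ others → ¬ Reach b e (head t)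
    apart-others Se t∈ r with ∈-map⁻ head (attachTo⁻ Se)
    ... | u , u∈ , refl = proj₂ (proj₂ parts) u∈ t∈ r

    module _ (s : Color) where
      private
        b′ = extend b attachTo s

      last-neighbour : ∀ v vs {q} → Linked (Adj b′) (map suc (v ∷ vs) ++ zero ∷ q) →
        ∃ λ e → e ∈ v ∷ vs × attachTo e ≡ true × Linked (Adj b) (v ∷ vs)
      last-neighbour = last-arm {b = b} {S = attachTo} {s = s}

      -- The two cycle neighbours of the new vertex are distinct and joined in the old board by the
      -- rest of the cycle, against `separated`. The start of a cycle is arbitrary, so the new
      -- vertex may be first, last or in the middle of the list.
      no-cycle-through-new : ∀ us q → Unique (map suc us ++ zero ∷ q) → ∀ {u r} → map suc us ++ zero ∷ q ≡ u ∷ r →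
        2 ≤ length r → Linked (Adj b′) (u ∷ r ++ [ u ]) → ⊥
      no-cycle-through-new [] q (z∉ ∷ un) refl two l with avoiding-new q (λ z∈ → All.lookup z∉ z∈ refl)
      no-cycle-through-new [] .(map suc (v ∷ [])) _ refl (s≤s ()) l | v ∷ [] , refl
      no-cycle-through-new [] .(map suc (v ∷ w ∷ ws)) (_ ∷ un) refl two (Sv ∷ e ∷ l) | v ∷ w ∷ ws , refl
        with last-neighbour w ws l
      ... | x , x∈ , Sx , l′ = separated Sv Sx (λ { refl → All.lookup (AllPairs.head (Uniqueₚ.map⁻ un)) x∈ refl })
        (reach-linked (e ∷ l′) (there x∈))
      no-cycle-through-new (u ∷ us) q un refl two l with allPairs-++ (map suc (u ∷ us)) un
      ... | u₁ , (z∉ ∷ u₂) , dis with avoiding-new q (λ z∈ → All.lookup z∉ z∈ refl)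
      ... | ws , refl = go ws dis two (subst (λ z → Linked (Adj b′) (suc u ∷ z)) (++-assoc (map suc us) (zero ∷ map suc ws) [ suc u ]) l)
        where
        go : ∀ ws → (∀ {x y} → x ∈ map suc (u ∷ us) → y ∈ zero ∷ map suc ws → x ≢ y) →
          2 ≤ length (map suc us ++ zero ∷ map suc ws) → Linked (Adj b′) (map suc (u ∷ us) ++ zero ∷ map suc ws ++ [ suc u ]) → ⊥
        go [] dis two l = short us (Uniqueₚ.map⁻ u₁) two l
          where
          short : ∀ us → Unique (u ∷ us) → 2 ≤ length (map suc us ++ [ zero ]) → Linked (Adj b′) (map suc (u ∷ us) ++ zero ∷ [ suc u ]) → ⊥
          short [] _ (s≤s ()) _
          short (v ∷ vs) (u∉ ∷ _) _ (e ∷ l) with last-neighbour v vs l | linked-drop (map suc (v ∷ vs)) l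
          ... | x , x∈ , Sx , l′ | Su ∷ _ = separated Su Sx (λ { refl → All.lookup u∉ x∈ refl }) (reach-linked (e ∷ l′) (there x∈))
        go (w ∷ ws) dis two l with last-neighbour u us l | linked-drop (map suc (u ∷ us)) l
        ... | x , x∈ , Sx , l′ | Sw ∷ lw = separated Sw Sx
          (λ { refl → dis (∈-map⁺ suc x∈) (there (here refl)) refl })
          (reach-trans (reach-linked lw′ (∈-++⁺ʳ (w ∷ ws) (here refl))) (reach-linked l′ x∈))
          where
          lw′ : Linked (Adj b) ((w ∷ ws) ++ [ u ])
          lw′ = Linkedₚ.map⁻ (subst (Linked (Adj b′)) (sym (map-++ suc (w ∷ ws) [ u ])) lw)

      forest′ : Forest b′
      forest′ u r (two , un , l) = go (u ∷ r) (splitAtNew (u ∷ r)) refl un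
        where
        go : ∀ p → SplitAtNew p → p ≡ u ∷ r → Unique p → ⊥
        go _ (old (v ∷ vs)) refl un = forest v vs
          ( ≤-trans two (≤-reflexive (length-map suc vs)) , Uniqueₚ.map⁻ un
          , Linkedₚ.map⁻ (subst (λ z → Linked (Adj b′) (suc v ∷ z)) (sym (map-++ suc vs [ v ])) l) )
        go _ (split us q) eq un = no-cycle-through-new us q un eq two l

      new-component : Component≤ b′ zero (suc (bounds used))
      new-component ws un rs with partition ws un (All.map reach-from-new rs)
      ... | xs , ys , ux , uy , px , qy , _ , _ , e with all-suc ys qy
      ... | vs , refl , rvs = ≤-trans (≤-reflexive e) (+-mono-≤ (zeros xs ux px)
        (≤-trans (≤-reflexive (length-map suc vs)) (component-cover used used-valid vs (Uniqueₚ.map⁻ uy) (All.map touch rvs))))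
        where
        zeros : ∀ (xs : List (Fin (suc n))) → Unique xs → All (_≡ zero) xs → length xs ≤ 1
        zeros []           _              _                  = z≤n
        zeros (_ ∷ [])     _              _                  = s≤s z≤n
        zeros (_ ∷ _ ∷ _) ((x≢ ∷ _) ∷ _) (refl ∷ refl ∷ _) = ⊥-elim (x≢ refl)
        touch : ∀ {w} → (∃ λ e → attachTo e ≡ true × Reach b e w) → Any (λ t → Reach b (head t) w) used
        touch (e , Se , r) with ∈-map⁻ head (attachTo⁻ Se)
        ... | t , t∈ , refl = lose t∈ r

      sm′ : Symmetric b′
      sm′ = symmetric-extend {b = b} sm attachTo s

      new-component-at : ∀ {v} → Reach b′ zero v → Component≤ b′ v (suc (bounds used))
      new-component-at r ws un rs = new-component ws un (All.map (reach-trans r) rs)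

      old-component : ∀ {v m} ws → Unique ws → All (Reach b′ (suc v)) ws → Component≤ b v m →
        length ws ≤ m ⊎ ∃ λ e → attachTo e ≡ true × Reach b v e
      old-component {v} ws un rs h with all-or (All.map reach-from-old rs)
      ... | inj₁ touch = inj₂ touch
      ... | inj₂ olds with all-suc ws olds
      ... | vs , refl , rvs = inj₁ (≤-trans (≤-reflexive (length-map suc vs)) (h vs (Uniqueₚ.map⁻ un) rvs))

      components′ : ComponentsAtMost k b′
      components′ zero ws un rs = ≤-trans (new-component ws un rs) fits
      components′ (suc v) ws un rs with old-component ws un rs (comps v)
      ... | inj₁ le = le
      ... | inj₂ (e , Se , r) = ≤-trans
        (new-component-at (reach-trans (step here Se) (reach-extend (reach-sym sm r))) ws un rs) fits

      playable′ : Playable k b′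
      playable′ = sm′ , forest′ , components′

      others-valid′ : All (Valid b′) (map lift others)
      others-valid′ = Allₚ.map⁺ (All.tabulate λ {t} t∈ →
        let v = All.lookup others-valid t∈ in
        valid (Uniqueₚ.map⁺ (λ { refl → refl }) (unique v)) (Linkedₚ.map⁺ (linked v)) (Allₚ.map⁺ (mono v))
          λ ws un rs → untouched t∈ (old-component ws un rs (small v)))
        where
        untouched : ∀ {t l m} → t ∈ others → l ≤ m ⊎ (∃ λ e → attachTo e ≡ true × Reach b (head t) e) → l ≤ m
        untouched t∈ (inj₁ le)            = le
        untouched t∈ (inj₂ (e , Se , r)) = ⊥-elim (apart-others Se t∈ (reach-sym sm r))

      others-apart′ : AllPairs (Apart b′) (map lift others)
      others-apart′ = AllPairsₚ.map⁺ (go others (λ t∈ → t∈) (proj₁ (proj₂ parts)))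
        where
        go : ∀ ts → (∀ {t} → t ∈ ts → t ∈ others) → AllPairs (Apart b) ts →
          AllPairs (λ t t′ → ¬ Reach b′ (suc (head t)) (suc (head t′))) ts
        go []       _ []       = []
        go (t ∷ ts) i (p ∷ ps) = All.tabulate apart ∷ go ts (λ t∈ → i (there t∈)) ps
          where
          apart : ∀ {t′} → t′ ∈ ts → ¬ Reach b′ (suc (head t)) (suc (head t′))
          apart t′∈ r with reach-from-old r
          ... | inj₁ (_ , refl , r′) = All.lookup p t′∈ r′
          ... | inj₂ (e , Se , r′)   = apart-others Se (i (here refl)) (reach-sym sm r′)

      NewGadget : ℕ → Set
      NewGadget j = Σ (Gadget (suc n)) λ t → colour t ≡ s × suc (length (rest t)) ≡ j × bound t ≡ suc (bounds used) ×
        Pool b′ (t ∷ map lift others)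

      module _ {j j′ : ℕ} {w w′ : List (Gadget n)} (u : Half s j w) (u′ : Half s j′ w′)
        (⊆used : ∀ {t} → t ∈ w ++ w′ → t ∈ used) (apart : AllPairs (Apart b) (w ++ w′)) where

        private
          p p′ : List (Fin n)
          p  = halfPath u
          p′ = halfPath u′

        half-valid : ∀ {j w} (u : Half s j w) → (∀ {t} → t ∈ w → t ∈ used) →
          Unique (halfPath u) × Linked (Adj b′) (zero ∷ map suc (halfPath u)) × All (λ v → col b v ≡ s) (halfPath u)
        half-valid none i = [] , [-] , []
        half-valid (one t refl) i = let v = All.lookup used-valid (i (here refl)) in
          unique v , (attachTo⁺ (∈-map⁺ head (i (here refl))) ∷ Linkedₚ.map⁺ (linked v)) , mono v

        halves-disjoint : ∀ {j j′ w w′} (u : Half s j w) (u′ : Half s j′ w′) → (∀ {t} → t ∈ w ++ w′ → t ∈ used) →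
          AllPairs (Apart b) (w ++ w′) → ∀ {x} → x ∈ halfPath u → x ∉ halfPath u′
        halves-disjoint (one t _) (one t′ _) i ((a ∷ []) ∷ _) x∈ x∈′ = a (reach-trans
          (reach-linked (linked (All.lookup used-valid (i (here refl)))) x∈)
          (reach-sym sm (reach-linked (linked (All.lookup used-valid (i (there (here refl))))) x∈′)))

        newPath : List (Fin (suc n))
        -- Reversing the first half puts its head next to the new vertex.
        newPath = map suc p ʳ++ (zero ∷ map suc p′)

        valid₁ = half-valid u  (λ t∈ → ⊆used (∈-++⁺ˡ t∈))
        valid₂ = half-valid u′ (λ t∈ → ⊆used (∈-++⁺ʳ w t∈))

        newPath-unique : Unique newPath
        newPath-unique = unique-ʳ++ (map suc p) (Uniqueₚ.map⁺ (λ { refl → refl }) (proj₁ valid₁))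
          (All.tabulate (λ x∈ eq → zero∉ (subst (_∈ map suc p′) (sym eq) x∈)) ∷ Uniqueₚ.map⁺ (λ { refl → refl }) (proj₁ valid₂))
          λ { x∈ (here refl) → zero∉ x∈ ; x∈ (there x∈′) → clash x∈ x∈′ }
          where
          zero∉ : ∀ {q : List (Fin n)} → Fin.zero ∉ map Fin.suc q
          zero∉ z∈ with ∈-map⁻ suc z∈
          ... | _ , _ , ()
          clash : ∀ {x : Fin (suc n)} → x ∈ map suc p → x ∉ map suc p′
          clash x∈ x∈′ with ∈-map⁻ suc x∈ | ∈-map⁻ suc x∈′
          ... | v , v∈ , refl | .v , v∈′ , refl = halves-disjoint u u′ ⊆used apart v∈ v∈′

        newPath-linked : Linked (Adj b′) newPath
        newPath-linked = linked-ʳ++ (λ {x} {y} e → trans (sm′ y x) e) (map suc p) (proj₁ (proj₂ valid₁)) (proj₁ (proj₂ valid₂))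

        newPath-mono : All (λ v → col b′ v ≡ s) newPath
        newPath-mono = all-ʳ++ (map suc p) (Allₚ.map⁺ (proj₂ (proj₂ valid₁))) (refl ∷ Allₚ.map⁺ (proj₂ (proj₂ valid₂)))

        newPath-length : length newPath ≡ suc (j + j′)
        newPath-length = trans (length-ʳ++ (map suc p)) (trans
          (cong₂ (λ a b → a + suc b) (trans (length-map suc p) (halfPath-length u)) (trans (length-map suc p′) (halfPath-length u′)))
          (+-suc j j′))

        -- The bound counts all of `used`, including the gadgets held ready for the other colour:
        -- they hang from the new vertex whatever its colour.
        new-gadget : NewGadget (suc (j + j′))
        new-gadget = go newPath refl
          where
          go : ∀ q → q ≡ newPath → NewGadget (suc (j + j′))
          go [] eq with subst (zero ∈_) (sym eq) (∈-ʳ++ (map suc p) (here refl))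
          ... | ()
          go (h ∷ r) eq = gadget s (suc (bounds used)) h r , refl , trans (cong length eq) newPath-length , refl ,
            ( valid (subst Unique (sym eq) newPath-unique) lk (subst (All _) (sym eq) newPath-mono) (new-component-at zr) ∷ others-valid′
            , Allₚ.map⁺ (All.tabulate far) ∷ others-apart′ )
            where
            lk : Linked (Adj b′) (h ∷ r)
            lk = subst (Linked (Adj b′)) (sym eq) newPath-linked
            zr : Reach b′ zero h
            zr = reach-sym sm′ (reach-linked lk (subst (zero ∈_) (sym eq) (∈-ʳ++ (map suc p) (here refl))))
            far : ∀ {t} → t ∈ others → ¬ Reach b′ h (suc (head t))
            far t∈ r with reach-from-new (reach-trans zr r)
            ... | inj₂ (_ , refl , e , Se , r′) = apart-others Se t∈ r′

-- Builder's strategy with a stock of gadgets.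

module Builder where
  open Boards
  open Gadgets
  open MinSumLists
  open Words
  open import Data.Nat
  open import Data.Nat.Properties hiding (_≟_)
  import Data.Nat.Properties as ℕₚ
  open import Data.Nat.Tactic.RingSolver using (solve-∀)
  open import Data.Nat.ListAction using (sum)
  open import Data.Nat.ListAction.Properties using (sum-++)
  open import Data.List.Properties using (map-++; ++-assoc)
  open import Data.List.Membership.Propositional.Properties using (∈-++⁺ˡ; ∈-++⁺ʳ)
  open import Data.List.Relation.Binary.Permutation.Propositional using (_↭_; refl; prep; swap; ↭-trans)
  open import Data.List.Relation.Binary.Permutation.Propositional.Properties using (All-resp-↭; ++⁺ˡ)
  open import Data.Product.Properties using (≡-dec)
  open import Relation.Binary.Definitions using (DecidableEquality)

  _≟ᶜ_ : DecidableEquality Color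
  c₁ ≟ᶜ c₁ = yes refl
  c₁ ≟ᶜ c₂ = no λ ()
  c₂ ≟ᶜ c₁ = no λ ()
  c₂ ≟ᶜ c₂ = yes refl

  Kind : Set
  Kind = Color × ℕ × ℕ

  _≟ᵏ_ : DecidableEquality Kind
  _≟ᵏ_ = ≡-dec _≟ᶜ_ (≡-dec ℕₚ._≟_ ℕₚ._≟_)

  kind : ∀ {n} → Gadget n → Kind
  kind t = colour t , suc (length (rest t)) , bound t

  indicator : ∀ {A : Set} → Dec A → ℕ
  indicator (yes _) = 1
  indicator (no  _) = 0

  stock : ∀ {n} → Kind → List (Gadget n) → ℕ
  stock σ []       = 0
  stock σ (t ∷ ts) = indicator (kind t ≟ᵏ σ) + stock σ ts

  indicator-≤1 : ∀ {A : Set} (d : Dec A) → indicator d ≤ 1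
  indicator-≤1 (yes _) = ≤-refl
  indicator-≤1 (no _)  = z≤n

  indicator-yes : ∀ {A : Set} (d : Dec A) → A → indicator d ≡ 1
  indicator-yes (yes _) _ = refl
  indicator-yes (no ¬a) a = ⊥-elim (¬a a)

  indicator-no : ∀ {A : Set} (d : Dec A) → ¬ A → indicator d ≡ 0
  indicator-no (yes a) ¬a = ⊥-elim (¬a a)
  indicator-no (no _)  _  = refl

  stock-++ : ∀ {n} σ (ts : List (Gadget n)) {us} → stock σ (ts ++ us) ≡ stock σ ts + stock σ us
  stock-++ σ []       = refl
  stock-++ σ (t ∷ ts) {us} = trans (cong (indicator (kind t ≟ᵏ σ) +_) (stock-++ σ ts))
    (sym (+-assoc (indicator (kind t ≟ᵏ σ)) (stock σ ts) (stock σ us)))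

  stock-↭ : ∀ {n} σ {ts us : List (Gadget n)} → ts ↭ us → stock σ ts ≡ stock σ us
  stock-↭ σ refl        = refl
  stock-↭ σ (prep x r)  = cong (indicator (kind x ≟ᵏ σ) +_) (stock-↭ σ r)
  stock-↭ σ (swap {ys = ys} x y r) = trans
    (cong (λ z → indicator (kind x ≟ᵏ σ) + (indicator (kind y ≟ᵏ σ) + z)) (stock-↭ σ r))
    (exchange (indicator (kind x ≟ᵏ σ)) (indicator (kind y ≟ᵏ σ)) (stock σ ys))
    where
    exchange : ∀ a b c → a + (b + c) ≡ b + (a + c)
    exchange = solve-∀
  stock-↭ σ (_↭_.trans r s) = trans (stock-↭ σ r) (stock-↭ σ s)

  kind-lift : ∀ {n} (t : Gadget n) → kind (lift t) ≡ kind t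
  kind-lift t = cong (λ l → colour t , suc l , bound t) (Data.List.Properties.length-map Data.Fin.suc (rest t))
    where
    import Data.Fin
    import Data.List.Properties

  stock-lift : ∀ {n} σ (ts : List (Gadget n)) → stock σ (map lift ts) ≡ stock σ ts
  stock-lift σ []       = refl
  stock-lift σ (t ∷ ts) = cong₂ _+_ (cong (λ κ → indicator (κ ≟ᵏ σ)) (kind-lift t)) (stock-lift σ ts)

  allPairs-↭ : ∀ {A : Set} {R : A → A → Set} → (∀ {x y} → R x y → R y x) → ∀ {xs ys} → xs ↭ ys → AllPairs R xs → AllPairs R ys
  allPairs-↭ sm refl        ps                   = ps
  allPairs-↭ sm (prep x r)  (p ∷ ps)             = All-resp-↭ r p ∷ allPairs-↭ sm r ps
  allPairs-↭ sm (swap x y r) ((q ∷ p) ∷ p′ ∷ ps) = (sm q ∷ All-resp-↭ r p′) ∷ All-resp-↭ r p ∷ allPairs-↭ sm r ps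
  allPairs-↭ sm (_↭_.trans r s) ps                   = allPairs-↭ sm s (allPairs-↭ sm r ps)

  pool-↭ : ∀ {n} {b : Board n} → Symmetric b → ∀ {ts us} → ts ↭ us → Pool b ts → Pool b us
  pool-↭ sm r (v , a) = All-resp-↭ r v , allPairs-↭ (λ ¬r r → ¬r (reach-sym sm r)) r a

  extract : ∀ {n} σ (ts : List (Gadget n)) → 1 ≤ stock σ ts →
    ∃₂ λ t us → kind t ≡ σ × ts ↭ t ∷ us
  extract σ (t ∷ ts) h = go (kind t ≟ᵏ σ) h
    where
    go : (d : Dec (kind t ≡ σ)) → 1 ≤ indicator d + stock σ ts → ∃₂ λ t′ us → kind t′ ≡ σ × t ∷ ts ↭ t′ ∷ us
    go (yes e) _ = t , ts , e , refl
    go (no _)  h with extract σ ts h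
    ... | t′ , us , e , r = t′ , t ∷ us , e , ↭-trans (prep t r) (swap t t′ refl)

  -- The last two fields control how the stock shrinks: at most one gadget of any kind leaves it,
  -- and none that is of the other colour or longer than `j`.
  record TakenHalf {n} (s : Color) (j z : ℕ) (ts : List (Gadget n)) : Set where
    field
      {taken others} : List (Gadget n)
      half   : Half s j taken
      cost   : bounds taken ≡ z
      rearr  : ts ↭ taken ++ others
      used≤1 : ∀ σ → stock σ taken ≤ 1
      unused : ∀ s′ j′ z′ → s′ ≢ s ⊎ j < j′ → stock (s′ , j′ , z′) taken ≡ 0

  takeHalf : ∀ {n} s j z (ts : List (Gadget n)) → (j ≡ 0 → z ≡ 0) → (1 ≤ j → 1 ≤ stock (s , j , z) ts) → TakenHalf s j z ts
  takeHalf s zero z ts z0 _ = record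
    { half = none ; cost = sym (z0 refl) ; rearr = refl ; used≤1 = λ _ → z≤n ; unused = λ _ _ _ _ → refl }
  takeHalf s (suc j) z ts _ h with extract (s , suc j , z) ts (h (s≤s z≤n))
  ... | t , us , refl , r = record
    { half = one t refl ; cost = +-identityʳ z ; rearr = r
    ; used≤1 = λ σ → ≤-trans (≤-reflexive (+-identityʳ _)) (indicator-≤1 (kind t ≟ᵏ σ))
    ; unused = λ s′ j′ z′ h → trans (+-identityʳ _) (indicator-no (kind t ≟ᵏ (s′ , j′ , z′)) (differ h)) }
    where
    differ : ∀ {s′ j′ z′} → s′ ≢ s ⊎ suc j < j′ → (s , suc j , z) ≢ (s′ , j′ , z′)
    differ (inj₁ s≢) refl = s≢ refl
    differ (inj₂ lt) refl = <-irrefl refl lt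

  record TakenPair {n} (s : Color) (x : List ℕ) (i : ℕ) (ts : List (Gadget n)) : Set where
    field
      {j j′}      : ℕ
      {w w′ others} : List (Gadget n)
      total  : j + j′ ≡ i
      half   : Half s j w
      half′  : Half s j′ w′
      cost   : bounds (w ++ w′) ≡ minSum x
      rearr  : ts ↭ (w ++ w′) ++ others
      used≤2 : ∀ σ → stock σ (w ++ w′) ≤ 2
      unused : ∀ s′ j′ z′ → s′ ≢ s ⊎ i < j′ → stock (s′ , j′ , z′) (w ++ w′) ≡ 0

  record Stocked {n} (N : ℕ) (s : Color) (x : List ℕ) (ts : List (Gadget n)) : Set where
    constructor stocked
    field
      level : ∀ j → 1 ≤ j → j < length x → N ≤ stock (s , j , at x j) ts
  open Stocked

  bounds-++ : ∀ {n} (ts us : List (Gadget n)) → bounds (ts ++ us) ≡ bounds ts + bounds us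
  bounds-++ ts us = trans (cong sum (map-++ bound ts us)) (sum-++ (map bound ts) (map bound us))

  -- Two copies per length are enough and may be necessary, since both halves of an optimal split
  -- can have the same length.
  takePair : ∀ {n} s x i (ts : List (Gadget n)) → length x ≡ suc i → at x 0 ≡ 0 → Stocked 2 s x ts → TakenPair s x i ts
  takePair s x i ts ex x0 h with minSum-attained x i ex
  ... | j , j′ , refl , e = record
    { total = refl ; half = H₁.half ; half′ = H₂.half
    ; cost = trans (bounds-++ H₁.taken H₂.taken) (trans (cong₂ _+_ H₁.cost H₂.cost) (sym e))
    ; rearr = subst (ts ↭_) (sym (++-assoc H₁.taken H₂.taken H₂.others)) (↭-trans H₁.rearr (++⁺ˡ H₁.taken H₂.rearr))
    ; used≤2 = λ σ → ≤-trans (≤-reflexive (stock-++ σ H₁.taken)) (+-mono-≤ (H₁.used≤1 σ) (H₂.used≤1 σ))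
    ; unused = λ s′ l z′ d → trans (stock-++ (s′ , l , z′) H₁.taken)
        (cong₂ _+_ (H₁.unused s′ l z′ (weaken (m≤m+n j j′) d)) (H₂.unused s′ l z′ (weaken (m≤n+m j′ j) d)))
    }
    where
    weaken : ∀ {s′ l m} → m ≤ j + j′ → s′ ≢ s ⊎ j + j′ < l → s′ ≢ s ⊎ m < l
    weaken m≤ (inj₁ p) = inj₁ p
    weaken m≤ (inj₂ q) = inj₂ (≤-<-trans m≤ q)
    atx : ∀ {j} → j ≡ 0 → at x j ≡ 0
    atx refl = x0
    below : ∀ {m} → m ≤ j + j′ → m < length x
    below m≤ = ≤-trans (s≤s m≤) (≤-reflexive (sym ex))
    first : TakenHalf s j (at x j) ts
    first = takeHalf s j (at x j) ts atx (λ 1≤j → ≤-trans (n≤1+n 1) (level h j 1≤j (below (m≤m+n j j′))))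
    module H₁ = TakenHalf first
    second : TakenHalf s j′ (at x j′) H₁.others
    second = takeHalf s j′ (at x j′) H₁.others atx λ 1≤j′ → +-cancelˡ-≤ 1 _ _ (begin
      2  ≤⟨ level h j′ 1≤j′ (below (m≤n+m j′ j)) ⟩
      stock (s , j′ , at x j′) ts  ≡⟨ stock-↭ _ H₁.rearr ⟩
      stock (s , j′ , at x j′) (H₁.taken ++ H₁.others)  ≡⟨ stock-++ _ H₁.taken ⟩
      stock (s , j′ , at x j′) H₁.taken + stock (s , j′ , at x j′) H₁.others ≤⟨ +-monoˡ-≤ _ (H₁.used≤1 _) ⟩
      1 + stock (s , j′ , at x j′) H₁.others  ∎)
      where open ≤-Reasoning
    module H₂ = TakenHalf second

  module Game (k ℓ c : ℕ) (1≤ℓ : 1 ≤ ℓ) (1≤c : 1 ≤ c) where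

    Won : ∀ {n} → Board n → Set
    Won b = Lost ℓ c b ⊎ BuilderWins k ℓ c b

    WinsFrom : ℕ → List ℕ → List ℕ → Set
    WinsFrom N x y = ∀ {m} (b : Board m) ts → Playable k b → Pool b ts → Stocked N c₁ x ts → Stocked N c₂ y ts → Won b

    gadget-path : ∀ {m} {b : Board m} {ts s j z} → Pool b ts → 1 ≤ stock (s , j , z) ts → MonoPath b s j
    gadget-path {ts = ts} (v , _) h with extract _ ts h
    ... | t , us , refl , r with All-resp-↭ r v
    ... | vt ∷ _ = path t , refl , unique vt , linked vt , mono vt

    -- Pigeonhole: after N₁ + N₂ further gadgets of the two new kinds, one kind is well stocked.
    module Loop {n t x y} (S : State n t x y) (fits : kd x y ≤ k) {N₁ N₂}
      (win₁ : WinsFrom N₁ (x ++ [ kd x y ]) y) (win₂ : WinsFrom N₂ x (y ++ [ kd x y ])) where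

      new₁ new₂ : Kind
      new₁ = c₁ , suc n , kd x y
      new₂ = c₂ , suc t , kd x y

      stocked-snoc : ∀ {m s z n N K} {ts : List (Gadget m)} → length z ≡ suc n → Stocked N s z ts → N ≤ stock (s , suc n , K) ts →
        Stocked N s (z ++ [ K ]) ts
      stocked-snoc {s = s} {z} {n} {N} {K} {ts} e h new = stocked go
        where
        go : ∀ j → 1 ≤ j → j < length (z ++ [ K ]) → N ≤ stock (s , j , at (z ++ [ K ]) j) ts
        go j 1≤j j< with m≤n⇒m<n∨m≡n (s≤s⁻¹ (≤-trans j< (≤-reflexive (length-snoc z K))))
        ... | inj₁ lt   = subst (λ a → N ≤ stock (s , j , a) ts) (sym (at-++ˡ z [ K ] lt)) (level h j 1≤j lt)
        ... | inj₂ refl = subst (λ a → N ≤ stock (s , length z , a) ts) (sym (at-last z K))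
          (subst (λ l → N ≤ stock (s , l , K) ts) (sym e) new)

      stocked-≤ : ∀ {m s z N N′} {ts : List (Gadget m)} → N ≤ N′ → Stocked N′ s z ts → Stocked N s z ts
      stocked-≤ N≤ h = stocked λ j p q → ≤-trans N≤ (level h j p q)

      -- One move takes at most four gadgets of any kind, and `N₁ + N₂` must be left after `d`
      -- moves.
      need : ℕ → ℕ
      need d = (N₁ + N₂) + 4 * d

      loop : ∀ d {m} (b : Board m) ts → Playable k b → Pool b ts → Stocked (need d) c₁ x ts → Stocked (need d) c₂ y ts →
        N₁ + N₂ ≤ stock new₁ ts + stock new₂ ts + d → Won b
      loop zero b ts ok pool h₁ h₂ enough with N₁ ≤? stock new₁ ts
      ... | yes p = win₁ b ts ok pool
        (stocked-snoc (length₁ S) (stocked-≤ (≤-trans (m≤m+n N₁ N₂) (m≤m+n _ 0)) h₁) p)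
        (stocked-≤ (≤-trans (m≤m+n N₁ N₂) (m≤m+n _ 0)) h₂)
      ... | no ¬p = win₂ b ts ok pool
        (stocked-≤ (≤-trans (m≤n+m N₂ N₁) (m≤m+n _ 0)) h₁)
        (stocked-snoc (length₂ S) (stocked-≤ (≤-trans (m≤n+m N₂ N₁) (m≤m+n _ 0)) h₂)
          (+-cancelˡ-≤ N₁ _ _ (≤-trans enough (≤-trans (≤-reflexive (+-identityʳ _)) (+-monoˡ-≤ _ (<⇒≤ (≰⇒> ¬p)))))))
      loop (suc d) b ts ok pool h₁ h₂ enough = inj₂ (move A.attachTo reply)
        where
        4≤need : 4 ≤ need (suc d)
        4≤need = ≤-trans (m≤m*n 4 (suc d)) (m≤n+m (4 * suc d) (N₁ + N₂))
        pair₁ : TakenPair c₁ x n ts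
        pair₁ = takePair c₁ x n ts (length₁ S) (head₁ S) (stocked-≤ (≤-trans (s≤s (s≤s z≤n)) 4≤need) h₁)
        module P₁ = TakenPair pair₁
        pair₂ : TakenPair c₂ y t P₁.others
        pair₂ = takePair c₂ y t P₁.others (length₂ S) (head₂ S) (stocked λ j p q → +-cancelˡ-≤ 2 _ _ (begin
          4  ≤⟨ 4≤need ⟩
          need (suc d)  ≤⟨ level h₂ j p q ⟩
          stock (c₂ , j , at y j) ts  ≡⟨ stock-↭ _ P₁.rearr ⟩
          stock (c₂ , j , at y j) ((P₁.w ++ P₁.w′) ++ P₁.others) ≡⟨ stock-++ _ (P₁.w ++ P₁.w′) ⟩
          stock (c₂ , j , at y j) (P₁.w ++ P₁.w′) + stock (c₂ , j , at y j) P₁.others ≤⟨ +-monoˡ-≤ _ (P₁.used≤2 _) ⟩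
          2 + stock (c₂ , j , at y j) P₁.others  ∎))
          where open ≤-Reasoning
        module P₂ = TakenPair pair₂
        used rest′ : List (Gadget _)
        used  = (P₁.w ++ P₁.w′) ++ (P₂.w ++ P₂.w′)
        rest′ = P₂.others
        rearr : ts ↭ used ++ rest′
        rearr = subst (ts ↭_) (sym (++-assoc (P₁.w ++ P₁.w′) (P₂.w ++ P₂.w′) P₂.others))
          (↭-trans P₁.rearr (++⁺ˡ (P₁.w ++ P₁.w′) P₂.rearr))
        cost : suc (bounds used) ≡ kd x y
        cost = cong suc (trans (bounds-++ (P₁.w ++ P₁.w′) (P₂.w ++ P₂.w′)) (cong₂ _+_ P₁.cost P₂.cost))
        pool′ : Pool b (used ++ rest′)
        pool′ = pool-↭ (proj₁ ok) rearr pool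
        module A = Attach ok used rest′ pool′ (≤-trans (≤-reflexive cost) fits)
        apart = allPairs-++ (P₁.w ++ P₁.w′) (proj₁ (allPairs-++ used (proj₂ pool′)))
        stock-split : ∀ σ → stock σ ts ≡ stock σ (P₁.w ++ P₁.w′) + stock σ (P₂.w ++ P₂.w′) + stock σ rest′
        stock-split σ = trans (stock-↭ σ rearr) (trans (stock-++ σ used) (cong (_+ stock σ rest′) (stock-++ σ (P₁.w ++ P₁.w′))))
        drop≤4 : ∀ σ → stock σ ts ≤ 4 + stock σ rest′
        drop≤4 σ = ≤-trans (≤-reflexive (stock-split σ)) (+-monoˡ-≤ (stock σ rest′) (+-mono-≤ (P₁.used≤2 σ) (P₂.used≤2 σ)))
        -- A move takes only shorter gadgets of this colour, so gadgets of the new kinds accumulate.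
        keep₁ : stock new₁ ts ≡ stock new₁ rest′
        keep₁ = trans (stock-split new₁) (cong (_+ stock new₁ rest′)
          (cong₂ _+_ (P₁.unused c₁ (suc n) _ (inj₂ ≤-refl)) (P₂.unused c₁ (suc n) _ (inj₁ λ ()))))
        keep₂ : stock new₂ ts ≡ stock new₂ rest′
        keep₂ = trans (stock-split new₂) (cong (_+ stock new₂ rest′)
          (cong₂ _+_ (P₁.unused c₂ (suc t) _ (inj₁ λ ())) (P₂.unused c₂ (suc t) _ (inj₂ ≤-refl))))
        continue : ∀ s i → (∀ g → kind g ≡ (s , suc i , kd x y) → 1 + (stock new₁ rest′ + stock new₂ rest′) ≤
            stock new₁ (g ∷ map lift rest′) + stock new₂ (g ∷ map lift rest′)) →
          A.NewGadget s (suc i) → Won (extend b A.attachTo s)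
        continue s i more (g , es , ej , ez , gpool) = loop d (extend b A.attachTo s) (g ∷ map lift rest′) (A.playable′ s) gpool
          (after h₁) (after h₂)
          (≤-trans enough (≤-trans (≤-reflexive (trans (cong₂ (λ a a′ → a + a′ + suc d) keep₁ keep₂) (+-suc _ d)))
            (+-monoˡ-≤ d (more g (cong₂ _,_ es (cong₂ _,_ ej (trans ez cost)))))))
          where
          after : ∀ {s z} → Stocked (need (suc d)) s z ts → Stocked (need d) s z (g ∷ map lift rest′)
          after {s} {z} h = stocked λ j p q → ≤-trans (+-cancelˡ-≤ 4 _ _ (begin
            4 + need d  ≡⟨ ring (N₁ + N₂) d ⟩
            need (suc d)  ≤⟨ level h j p q ⟩
            stock (s , j , at z j) ts  ≤⟨ drop≤4 _ ⟩
            4 + stock (s , j , at z j) rest′ ∎)) (≤-trans (≤-reflexive (sym (stock-lift _ rest′))) (m≤n+m _ _))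
            where
            open ≤-Reasoning
            ring : ∀ a d → 4 + (a + 4 * d) ≡ a + 4 * (1 + d)
            ring = solve-∀
        more₁ : ∀ g → kind g ≡ new₁ → 1 + (stock new₁ rest′ + stock new₂ rest′) ≤
          stock new₁ (g ∷ map lift rest′) + stock new₂ (g ∷ map lift rest′)
        more₁ g e = +-mono-≤ (≤-reflexive (cong₂ _+_ (sym (indicator-yes (kind g ≟ᵏ new₁) e)) (sym (stock-lift new₁ rest′))))
          (≤-trans (≤-reflexive (sym (stock-lift new₂ rest′))) (m≤n+m _ _))
        more₂ : ∀ g → kind g ≡ new₂ → 1 + (stock new₁ rest′ + stock new₂ rest′) ≤
          stock new₁ (g ∷ map lift rest′) + stock new₂ (g ∷ map lift rest′)
        more₂ g e = ≤-trans (≤-reflexive (sym (+-suc (stock new₁ rest′) (stock new₂ rest′))))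
          (+-mono-≤ (≤-trans (≤-reflexive (sym (stock-lift new₁ rest′))) (m≤n+m _ (indicator (kind g ≟ᵏ new₁))))
            (≤-reflexive (cong₂ _+_ (sym (indicator-yes (kind g ≟ᵏ new₂) e)) (sym (stock-lift new₂ rest′)))))
        reply : ∀ s → Legal k (extend b A.attachTo s) × Won (extend b A.attachTo s)
        reply c₁ = proj₂ (A.playable′ c₁) , continue c₁ n more₁ (subst (λ i → A.NewGadget c₁ (suc i)) P₁.total
          (A.new-gadget c₁ P₁.half P₁.half′ ∈-++⁺ˡ (proj₁ apart)))
        reply c₂ = proj₂ (A.playable′ c₂) , continue c₂ t more₂ (subst (λ i → A.NewGadget c₂ (suc i)) P₂.total
          (A.new-gadget c₂ P₂.half P₂.half′ (∈-++⁺ʳ (P₁.w ++ P₁.w′)) (proj₁ (proj₂ apart))))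

    Affordable : ℕ → ℕ → List ℕ → List ℕ → Set
    Affordable p q x y = ∀ α → suc (count c₁ α) ≤ p → suc (count c₂ α) ≤ q →
      kd (proj₁ (run α x y)) (proj₂ (run α x y)) ≤ k

    target-stocked : ∀ {m s z n N} {b : Board m} {ts} → length z ≡ suc n → 1 ≤ n → 1 ≤ N → Pool b ts → Stocked N s z ts →
      MonoPath b s n
    target-stocked e 1≤n 1≤N pool h = gadget-path pool (≤-trans 1≤N (level h _ 1≤n (≤-reflexive (sym e))))

    -- The required number of copies is found backwards from the end of the game, because building
    -- longer paths consumes the stock of shorter ones. Painter's choices spell the word, and
    -- `Affordable` covers every word that can still arise.
    win : ∀ p q {n t x y} → State n t x y → n + p ≡ ℓ → t + q ≡ c → Affordable p q x y → ∃ λ N → WinsFrom N x y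
    win zero q {n} S refl ec A = 1 , λ b ts ok pool h₁ h₂ → inj₁ (inj₁
      (subst (MonoPath b c₁) (sym (+-identityʳ n)) (target-stocked (length₁ S) (≤-trans 1≤ℓ (≤-reflexive (+-identityʳ n))) ≤-refl pool h₁)))
    win (suc p) zero {n} {t} S eℓ refl A = 1 , λ b ts ok pool h₁ h₂ → inj₁ (inj₂
      (subst (MonoPath b c₂) (sym (+-identityʳ t)) (target-stocked (length₂ S) (≤-trans 1≤c (≤-reflexive (+-identityʳ t))) ≤-refl pool h₂)))
    win (suc p) (suc q) {n} {t} S eℓ ec A
      with win p (suc q) (next₁ S) (trans (sym (+-suc n p)) eℓ) ec (λ α h₁ h₂ → A (c₁ ∷ α) (s≤s h₁) h₂)
         | win (suc p) q (next₂ S) eℓ (trans (sym (+-suc t q)) ec) (λ α h₁ h₂ → A (c₂ ∷ α) h₁ (s≤s h₂))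
    ... | N₁ , win₁ | N₂ , win₂ = need (N₁ + N₂) , λ b ts ok pool h₁ h₂ →
      loop (N₁ + N₂) b ts ok pool h₁ h₂ (m≤n+m (N₁ + N₂) (stock new₁ ts + stock new₂ ts))
      where open Loop S (A [] (s≤s z≤n) (s≤s z≤n)) win₁ win₂

    builder-wins : (∀ α → suc (count c₁ α) ≤ ℓ → suc (count c₂ α) ≤ c → size α ≤ k) → BuilderWins k ℓ c emptyBoard
    builder-wins A with win ℓ c initial refl refl A
    ... | N , w with w emptyBoard [] ((λ ()) , ((λ ()) , λ ())) ([] , []) (stocked λ { (suc j) _ (s≤s ()) }) (stocked λ { (suc j) _ (s≤s ()) })
    ... | inj₂ bw = bw
    ... | inj₁ (inj₁ ([] , e , _)) = ⊥-elim (<-irrefl e 1≤ℓ)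
    ... | inj₁ (inj₂ ([] , e , _)) = ⊥-elim (<-irrefl e 1≤c)
    ... | inj₁ (inj₁ (() ∷ _ , _))
    ... | inj₁ (inj₂ (() ∷ _ , _))

-- The game value, its slope and the lower bound in integers.

module GameValue where
  open MinSums
  open Profiles
  open MinSumLists
  open Words
  open Painter
  open Builder
  open Downscaling
  open import Data.Nat
  open import Data.Nat.Properties
  open import Data.Nat.DivMod using (m≡m%n+[m/n]*n; m%n<n; m≥n⇒m/n>0)
  open import Data.Nat.Tactic.RingSolver using (solve-∀)

  abstract
    -- Raises the threshold at the target length to `h`: only shorter paths follow the profile.
    override : (ℕ → ℕ) → ℕ → ℕ → ℕ → ℕ
    override f h r a with a <? r
    ... | yes _ = f a
    ... | no  _ = h

    override-< : ∀ f h {r a} → a < r → override f h r a ≡ f a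
    override-< f h {r} {a} lt with a <? r
    ... | yes _ = refl
    ... | no ¬p = ⊥-elim (¬p lt)

    override-≥ : ∀ f h {r a} → r ≤ a → override f h r a ≡ h
    override-≥ f h {r} {a} ge with a <? r
    ... | yes p = ⊥-elim (<⇒≱ p ge)
    ... | no  _ = refl

  -- Against arms of total lengths `a` and `b`, colour 1 is used when `suc a < P (suc b)` and colour
  -- 2 otherwise. By this rule only one colour can ever complete its target: colour 1 if
  -- `r < P (suc c′)`, colour 2 if not. This explains the two conditional hypotheses.
  profile-no-win : ∀ {c′ X Y P} → Profile c′ X Y P → Monotone X → Monotone Y → ∀ r h → 1 ≤ r →
    (r < P (suc c′) → h ≤ X r) → (P (suc c′) ≤ r → h ≤ Y (suc c′)) →
    ∀ {j} → j < h → ¬ BuilderWins j r (suc c′) emptyBoard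
  profile-no-win {c′} {X} {Y} {P} R X-mono Y-mono r h 1≤r hX hY =
    Thresholds.no-win r (suc c′) h X̂ Ŷ 1≤r (s≤s z≤n)
      (trans (override-< X h 1≤r) X-zero) (trans (override-< Y h (s≤s z≤n)) Y-zero) safe
      (≤-reflexive (sym (override-≥ X h ≤-refl))) (≤-reflexive (sym (override-≥ Y h ≤-refl)))
    where
    open Profile R
    X̂ Ŷ : ℕ → ℕ
    X̂ = override X h r
    Ŷ = override Y h (suc c′)
    safe : ∀ a b → a < r → b < suc c′ → X̂ (suc a) ≤ κ X̂ Ŷ a b ⊎ Ŷ (suc b) ≤ κ X̂ Ŷ a b
    safe a b a<r b<c = go (suc a <? P (suc b))
      where
      κ≤ : κ X Y a b ≤ κ X̂ Ŷ a b
      κ≤ = κ-mono a b (λ i i≤ → ≤-reflexive (sym (override-< X h (≤-<-trans i≤ a<r))))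
        (λ i i≤ → ≤-reflexive (sym (override-< Y h (≤-<-trans i≤ b<c))))
      go : Dec (suc a < P (suc b)) → X̂ (suc a) ≤ κ X̂ Ŷ a b ⊎ Ŷ (suc b) ≤ κ X̂ Ŷ a b
      go (yes lt) = inj₁ (≤-trans (low (m≤n⇒m<n∨m≡n a<r)) (≤-trans (X-step a b (s≤s⁻¹ b<c) lt) κ≤))
        where
        low : suc a < r ⊎ suc a ≡ r → X̂ (suc a) ≤ X (suc a)
        low (inj₁ sa<r) = ≤-reflexive (override-< X h sa<r)
        low (inj₂ refl) = ≤-trans (≤-reflexive (override-≥ X h ≤-refl)) (hX (<-≤-trans lt (P-mono b<c)))
      go (no ge) = inj₂ (≤-trans (low (m≤n⇒m<n∨m≡n b<c)) (≤-trans (Y-step b (s≤s⁻¹ b<c))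
        (≤-trans (κ-monoʳ X-mono Y-mono {b = b} (pred-mono-≤ (≮⇒≥ ge)) ≤-refl) κ≤)))
        where
        low : suc b < suc c′ ⊎ suc b ≡ suc c′ → Ŷ (suc b) ≤ Y (suc b)
        low (inj₁ sb<c) = ≤-reflexive (override-< Y h sb<c)
        low (inj₂ refl) = ≤-trans (≤-reflexive (override-≥ Y h ≤-refl)) (hY (≤-trans (≮⇒≥ ge) a<r))

  record Best (p q : ℕ) (f : List Color → ℕ) : Set where
    field
      word    : List Color
      ones≡   : count c₁ word ≡ p
      twos≡   : count c₂ word ≡ q
      maximal : ∀ α → count c₁ α ≡ p → count c₂ α ≡ q → f α ≤ f word
  open Best public

  best-of-two : ∀ {p q f} → Best p (suc q) (λ α → f (c₁ ∷ α)) → Best (suc p) q (λ α → f (c₂ ∷ α)) → Best (suc p) (suc q) f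
  best-of-two {p} {q} {f} B₁ B₂ = choose (≤-total (f (c₂ ∷ word B₂)) (f (c₁ ∷ word B₁)))
    where
    choose : f (c₂ ∷ word B₂) ≤ f (c₁ ∷ word B₁) ⊎ f (c₁ ∷ word B₁) ≤ f (c₂ ∷ word B₂) → Best (suc p) (suc q) f
    choose (inj₁ le) = record { word = c₁ ∷ word B₁ ; ones≡ = cong suc (ones≡ B₁) ; twos≡ = twos≡ B₁
      ; maximal = λ { [] () _ ; (c₁ ∷ α) e₁ e₂ → maximal B₁ α (suc-injective e₁) e₂
                    ; (c₂ ∷ α) e₁ e₂ → ≤-trans (maximal B₂ α e₁ (suc-injective e₂)) le } }
    choose (inj₂ le) = record { word = c₂ ∷ word B₂ ; ones≡ = ones≡ B₂ ; twos≡ = cong suc (twos≡ B₂)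
      ; maximal = λ { [] () _ ; (c₁ ∷ α) e₁ e₂ → ≤-trans (maximal B₁ α (suc-injective e₁) e₂) le
                    ; (c₂ ∷ α) e₁ e₂ → maximal B₂ α e₁ (suc-injective e₂) } }

  best : ∀ p q f → Best p q f
  best zero zero f = record { word = [] ; ones≡ = refl ; twos≡ = refl
    ; maximal = λ { [] _ _ → ≤-refl ; (c₁ ∷ α) () _ ; (c₂ ∷ α) _ () } }
  best (suc p) zero f = record { word = c₁ ∷ word B ; ones≡ = cong suc (ones≡ B) ; twos≡ = twos≡ B
    ; maximal = λ { [] () _ ; (c₁ ∷ α) e₁ e₂ → maximal B α (suc-injective e₁) e₂ ; (c₂ ∷ α) _ () } }
    where B = best p zero (λ α → f (c₁ ∷ α))
  best zero (suc q) f = record { word = c₂ ∷ word B ; ones≡ = ones≡ B ; twos≡ = cong suc (twos≡ B)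
    ; maximal = λ { [] _ () ; (c₁ ∷ α) () _ ; (c₂ ∷ α) e₁ e₂ → maximal B α e₁ (suc-injective e₂) } }
    where B = best zero q (λ α → f (c₂ ∷ α))
  best (suc p) (suc q) f = best-of-two (best p (suc q) (λ α → f (c₁ ∷ α))) (best (suc p) q (λ α → f (c₂ ∷ α)))

  abstract
    bestWord : (p q : ℕ) → Best p q size
    bestWord p q = best p q size

  -- k*(P_ℓ, P_c) for ℓ = 1 + p and c = 1 + q.
  K : ℕ → ℕ → ℕ
  K p q = size (word (bestWord p q))

  twos : ℕ → List Color
  twos k = replicate k c₂

  count₁-twos : ∀ k → count c₁ (twos k) ≡ 0
  count₁-twos zero    = refl
  count₁-twos (suc k) = count₁-twos k

  count₂-twos : ∀ k → count c₂ (twos k) ≡ k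
  count₂-twos zero    = refl
  count₂-twos (suc k) = cong suc (count₂-twos k)

  size≤K : ∀ {p q} α → count c₁ α ≤ p → count c₂ α ≤ q → size α ≤ K p q
  size≤K {p} {q} α h₁ h₂ = ≤-trans (size-++ α pad) (maximal (bestWord p q) (α ++ pad)
    (trans (count-++ c₁ α pad) (trans (cong (count c₁ α +_) pad₁) (m+[n∸m]≡n h₁)))
    (trans (count-++ c₂ α pad) (trans (cong (count c₂ α +_) pad₂) (m+[n∸m]≡n h₂))))
    where
    m₁ = p ∸ count c₁ α
    m₂ = q ∸ count c₂ α
    pad = ones m₁ ++ twos m₂
    pad₁ : count c₁ pad ≡ m₁
    pad₁ = trans (count-++ c₁ (ones m₁) (twos m₂)) (trans (cong₂ _+_ (count₁-ones m₁) (count₁-twos m₂)) (+-identityʳ m₁))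
    pad₂ : count c₂ pad ≡ m₂
    pad₂ = trans (count-++ c₂ (ones m₁) (twos m₂)) (cong₂ _+_ (count₂-ones m₁) (count₂-twos m₂))

  K-wins : ∀ p q → BuilderWins (K p q) (suc p) (suc q) emptyBoard
  K-wins p q = Game.builder-wins (K p q) (suc p) (suc q) (s≤s z≤n) (s≤s z≤n) (λ α h₁ h₂ → size≤K α (s≤s⁻¹ h₁) (s≤s⁻¹ h₂))

  profile≤K : ∀ {q X Y P} → Profile q X Y P → Monotone X → Monotone Y → ∀ p h →
    (suc p < P (suc q) → h ≤ X (suc p)) → (P (suc q) ≤ suc p → h ≤ Y (suc q)) → h ≤ K p q
  profile≤K {q} R mX mY p h hX hY = ≮⇒≥ λ K<h → profile-no-win R mX mY (suc p) h (s≤s z≤n) hX hY K<h (K-wins p q)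

  size-no-win : ∀ α {j} → j < size α → ¬ BuilderWins j (suc (count c₁ α)) (suc (count c₂ α)) emptyBoard
  size-no-win α = profile-no-win (runningMax-profile (word-profile α)) (runningMax-mono _) (runningMax-mono _) (suc (count c₁ α)) (size α)
    (s≤s z≤n) (λ lt → ⊥-elim (<⇒≱ lt (≤-reflexive (wordP-end α))))
    (λ _ → ≤-trans (≤-reflexive (sym (wordY-end α))) (≤-runningMax (wordY α) (suc (count c₂ α))))

  K-isKStar : ∀ p q → IsKStar (suc p) (suc q) (K p q)
  K-isKStar p q = s≤s z≤n , K-wins p q , λ j _ j< → subst₂ (λ a b → ¬ BuilderWins j (suc a) (suc b) emptyBoard)
    (ones≡ B) (twos≡ B) (size-no-win (word B) j<)
    where B = bestWord p q

  size≤kStar : ∀ {p q k} → IsKStar (suc p) (suc q) k → ∀ α → count c₁ α ≡ p → count c₂ α ≡ q → size α ≤ k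
  size≤kStar (_ , wins , _) α refl refl = ≮⇒≥ λ k< → size-no-win α k< wins

  kStar≤K : ∀ {p q k} → IsKStar (suc p) (suc q) k → k ≤ K p q
  kStar≤K {p} {q} (_ , _ , least) = ≮⇒≥ λ K<k → least (K p q) (s≤s z≤n) K<k (K-wins p q)

  -- Obtained by way of the game: the profile of `α` also guards Painter for the shorter target
  -- `suc s`, where colour 1 is the colour that completes it, whereas Builder wins there with `K`.
  xs₁≤K : ∀ α s → suc s < suc (count c₁ α) → at (xs₁ α) (suc s) ≤ K s (count c₂ α)
  xs₁≤K α s lt = ≤-trans (≤-runningMax (wordX α) (suc s)) (profile≤K (runningMax-profile (word-profile α)) (runningMax-mono _) (runningMax-mono _)
    s (runningMax (wordX α) (suc s)) (λ _ → ≤-refl) (λ ge → ⊥-elim (<⇒≱ lt (≤-trans (≤-reflexive (sym (wordP-end α))) ge))))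

  xs₁-blocks : ∀ α i j m → i + m * suc j < suc (count c₁ α) →
    at (xs₁ α) (i + m * suc j) ≤ at (xs₁ α) i + m * (at (xs₁ α) j + βα α)
  xs₁-blocks α i j zero _ = ≤-reflexive (trans (cong (at (xs₁ α)) (+-identityʳ i)) (sym (+-identityʳ _)))
  xs₁-blocks α i j (suc m) lt = begin
    x (i + suc m * suc j)  ≡⟨ cong x (index i m j) ⟩
    x (suc ((i + m * suc j) + j))  ≤⟨ xs₁-subadditive α (i + m * suc j) j lt′ ⟩
    βα α + x (i + m * suc j) + x j  ≤⟨ +-monoˡ-≤ (x j) (+-monoʳ-≤ (βα α) (xs₁-blocks α i j m
        (<-trans (s≤s (m≤m+n _ j)) lt′))) ⟩
    βα α + (x i + m * (x j + βα α)) + x j  ≡⟨ ring (βα α) (x i) (x j) (m * (x j + βα α)) ⟩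
    x i + suc m * (x j + βα α)  ∎
    where
    open ≤-Reasoning
    x = at (xs₁ α)
    index : ∀ i m j → i + (1 + m) * (1 + j) ≡ 1 + ((i + m * (1 + j)) + j)
    index = solve-∀
    lt′ : suc ((i + m * suc j) + j) < suc (count c₁ α)
    lt′ = subst (_< suc (count c₁ α)) (index i m j) lt
    ring : ∀ b i j s → b + (i + s) + j ≡ i + ((j + b) + s)
    ring = solve-∀

  size-blocks : ∀ α i j m → i + suc m * suc j ≡ suc (count c₁ α) → size α ≤ at (xs₁ α) i + suc m * (at (xs₁ α) j + βα α)
  size-blocks α i j m e = begin
    size α  ≤⟨ size-subadditive α (i + m * suc j) j total ⟩
    βα α + x (i + m * suc j) + x j  ≤⟨ +-monoˡ-≤ (x j) (+-monoʳ-≤ (βα α) (xs₁-blocks α i j m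
        (s≤s (≤-trans (m≤m+n _ j) (≤-reflexive total))))) ⟩
    βα α + (x i + m * (x j + βα α)) + x j  ≡⟨ ring (βα α) (x i) (x j) (m * (x j + βα α)) ⟩
    x i + suc m * (x j + βα α)  ∎
    where
    open ≤-Reasoning
    x = at (xs₁ α)
    index : ∀ i m j → i + (1 + m) * (1 + j) ≡ 1 + ((i + m * (1 + j)) + j)
    index = solve-∀
    total : (i + m * suc j) + j ≡ count c₁ α
    total = suc-injective (trans (sym (index i m j)) e)
    ring : ∀ b i j s → b + (i + s) + j ≡ i + ((j + b) + s)
    ring = solve-∀

  best-ratio : ∀ (f : ℕ → ℕ) p → ∃ λ r → r ≤ p × (∀ i → i ≤ p → f i * suc r ≤ f r * suc i)
  best-ratio f zero = 0 , z≤n , λ { zero z≤n → ≤-refl }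
  best-ratio f (suc p) with best-ratio f p
  ... | r , r≤ , h with ≤-total (f (suc p) * suc r) (f r * suc (suc p))
  ... | inj₁ le = r , m≤n⇒m≤1+n r≤ , λ i i≤ → case i i≤ (m≤n⇒m<n∨m≡n i≤)
    where
    case : ∀ i → i ≤ suc p → i < suc p ⊎ i ≡ suc p → f i * suc r ≤ f r * suc i
    case i _ (inj₁ lt)   = h i (s≤s⁻¹ lt)
    case i _ (inj₂ refl) = le
  ... | inj₂ ge = suc p , ≤-refl , λ i i≤ → case i (m≤n⇒m<n∨m≡n i≤)
    where
    open ≤-Reasoning
    swapʳ : ∀ a b c → a * b * c ≡ a * c * b
    swapʳ = solve-∀
    case : ∀ i → i < suc p ⊎ i ≡ suc p → f i * suc (suc p) ≤ f (suc p) * suc i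
    case i (inj₂ refl) = ≤-refl
    case i (inj₁ lt) = *-cancelʳ-≤ _ _ (suc r) (begin
      f i * suc (suc p) * suc r  ≡⟨ swapʳ (f i) (suc (suc p)) (suc r) ⟩
      f i * suc r * suc (suc p)  ≤⟨ *-monoˡ-≤ (suc (suc p)) (h i (s≤s⁻¹ lt)) ⟩
      f r * suc i * suc (suc p)  ≡⟨ swapʳ (f r) (suc i) (suc (suc p)) ⟩
      f r * suc (suc p) * suc i  ≤⟨ *-monoˡ-≤ (suc i) ge ⟩
      f (suc p) * suc r * suc i  ≡⟨ swapʳ (f (suc p)) (suc r) (suc i) ⟩
      f (suc p) * suc i * suc r  ∎)

  -- Take ℓ′ ≤ ℓ with k*(P_ℓ′, P_c) / ℓ′ maximal and an optimal word for ℓ′; cutting ℓ′ into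
  -- blocks of length j + 1 and bounding the remainder by maximality, every ratio defining δ of
  -- this word is at least k*(P_ℓ, P_c) / ℓ.
  optimal-slope : ∀ p q → ∃ λ r → r ≤ p ×
    SlopeAtLeast (K p q) (suc p) (xs₁ (word (bestWord r q))) (βα (word (bestWord r q)))
  optimal-slope p q with best-ratio (λ i → K i q) p
  ... | r , r≤p , h = r , r≤p , λ j j< → *-cancelʳ-≤ _ _ (suc r) (begin
      K p q * suc j * suc r  ≡⟨ swapʳ (K p q) (suc j) (suc r) ⟩
      K p q * suc r * suc j  ≤⟨ *-monoˡ-≤ (suc j) (h p ≤-refl) ⟩
      K r q * suc p * suc j  ≡⟨ swapʳ (K r q) (suc p) (suc j) ⟩
      K r q * suc j * suc p  ≤⟨ *-monoˡ-≤ (suc p) (slope j (s≤s⁻¹ (≤-trans j< (≤-reflexive (trans (length₁ (word-state α)) (cong suc (ones≡ B))))))) ⟩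
      suc r * (x j + βα α) * suc p  ≡⟨ rotate (suc r) (x j + βα α) (suc p) ⟩
      suc p * (x j + βα α) * suc r  ∎)
    where
    open ≤-Reasoning
    B = bestWord r q
    α = word B
    x = at (xs₁ α)
    swapʳ : ∀ a b c → a * b * c ≡ a * c * b
    swapʳ = solve-∀
    rotate : ∀ a b c → a * b * c ≡ c * b * a
    rotate = solve-∀
    remainder : ∀ i → i ≤ r → x i * suc r ≤ K r q * i
    remainder zero _ = ≤-trans (≤-reflexive (cong (_* suc r) (head₁ (word-state α)))) z≤n
    remainder (suc i) i<r = ≤-trans (*-monoˡ-≤ (suc r) (≤-trans (xs₁≤K α i (s≤s (≤-trans i<r (≤-reflexive (sym (ones≡ B))))))
      (≤-reflexive (cong (K i) (twos≡ B))))) (h i (≤-trans (<⇒≤ i<r) r≤p))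
    slope : ∀ j → j ≤ r → K r q * suc j ≤ suc r * (x j + βα α)
    slope j j≤r = cut (suc r / suc j) (suc r % suc j) (trans (m≡m%n+[m/n]*n (suc r) (suc j)) refl)
      (m%n<n (suc r) (suc j)) (m≥n⇒m/n>0 (s≤s j≤r))
      where
      cut : ∀ m i → suc r ≡ i + m * suc j → i < suc j → 0 < m → K r q * suc j ≤ suc r * (x j + βα α)
      cut (suc m) i e i< _ = *-cancelˡ-≤ (suc m) (+-cancelˡ-≤ (K r q * i) _ _ (begin
        K r q * i + suc m * (K r q * suc j)  ≡⟨ ring₁ (K r q) i (suc m) (suc j) ⟩
        K r q * (i + suc m * suc j)  ≡⟨ cong (K r q *_) (sym e) ⟩
        K r q * suc r  ≤⟨ *-monoˡ-≤ (suc r) (size-blocks α i j m (trans (sym e) (cong suc (sym (ones≡ B))))) ⟩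
        (x i + suc m * (x j + βα α)) * suc r  ≡⟨ ring₂ (x i) (suc m) (x j + βα α) (suc r) ⟩
        x i * suc r + suc m * (suc r * (x j + βα α))  ≤⟨ +-monoˡ-≤ _ (remainder i (≤-trans (s≤s⁻¹ i<) j≤r)) ⟩
        K r q * i + suc m * (suc r * (x j + βα α))  ∎))
        where
        ring₁ : ∀ k i m j → k * i + m * (k * j) ≡ k * (i + m * j)
        ring₁ = solve-∀
        ring₂ : ∀ x m z r → (x + m * z) * r ≡ x * r + m * (r * z)
        ring₂ = solve-∀

  run-ones₂ : ∀ k x y → proj₂ (run (ones k) x y) ≡ y
  run-ones₂ zero    x y = refl
  run-ones₂ (suc k) x y = run-ones₂ k _ y

  -- Trailing ones change neither the colour-2 list nor the earlier entries, so removing them only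
  -- drops conditions. This produces words ending in a two, as δ(c) demands.
  slope-prefix : ∀ {p q} α k → SlopeAtLeast p q (xs₁ (α ++ ones k)) (βα (α ++ ones k)) → SlopeAtLeast p q (xs₁ α) (βα α)
  slope-prefix {p} {q} α k h j j< = subst₂ (λ a B → p * suc j ≤ q * (a + B)) at≡ β≡ (h j (≤-trans j< longer))
    where
    r≡ : run (α ++ ones k) (0 ∷ []) (0 ∷ []) ≡ run (ones k) (xs₁ α) (xs₂ α)
    r≡ = run-++ α (ones k) _ _
    at≡ : at (xs₁ (α ++ ones k)) j ≡ at (xs₁ α) j
    at≡ = trans (cong (λ r → at (proj₁ r) j) r≡) (run-at₁ (ones k) (xs₁ α) (xs₂ α) j<)
    β≡ : βα (α ++ ones k) ≡ βα α
    β≡ = cong (λ y → 1 + minSum y) (trans (cong proj₂ r≡) (run-ones₂ k (xs₁ α) (xs₂ α)))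
    longer : length (xs₁ α) ≤ length (xs₁ (α ++ ones k))
    longer = ≤-trans (≤-reflexive (length₁ (word-state α))) (≤-trans (s≤s (≤-trans (m≤m+n _ (count c₁ (ones k)))
      (≤-reflexive (sym (count-++ c₁ α (ones k)))))) (≤-reflexive (sym (length₁ (word-state (α ++ ones k))))))

  no-twos : ∀ α → count c₂ α ≡ 0 → α ≡ ones (count c₁ α)
  no-twos []       _ = refl
  no-twos (c₁ ∷ α) e = cong (c₁ ∷_) (no-twos α e)

  last-two : ∀ α → 1 ≤ count c₂ α → ∃₂ λ α′ k → α ≡ (α′ ++ [ c₂ ]) ++ ones k
  last-two (c₁ ∷ α) h with last-two α h
  ... | α′ , k , e = c₁ ∷ α′ , k , cong (c₁ ∷_) e
  last-two (c₂ ∷ α) h = go (count c₂ α) refl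
    where
    go : ∀ m → count c₂ α ≡ m → ∃₂ λ α′ k → c₂ ∷ α ≡ (α′ ++ [ c₂ ]) ++ ones k
    go zero    e = [] , count c₁ α , cong (c₂ ∷_) (no-twos α e)
    go (suc m) e with last-two α (≤-trans (s≤s z≤n) (≤-reflexive (sym e)))
    ... | α′ , k , e′ = c₂ ∷ α′ , k , cong (c₂ ∷_) e′

  word-stage : ∀ α → Stage (count c₂ α) 0 1 0 0 (runningMax (wordX α)) (runningMax (wordY α)) (wordP α)
  word-stage α = record
    { profile = runningMax-profile (word-profile α) ; X-mono = runningMax-mono _ ; Y-mono = runningMax-mono _
    ; P-bound = z≤n ; Y-bound = ≤-reflexive (Profile.Y-zero (word-profile α))
    ; P≤L*Y = λ s s≤ → ≤-trans (wordP≤wordY α s s≤) (≤-trans (≤-runningMax (wordY α) (suc s)) (≤-reflexive (sym (*-identityˡ _)))) }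

  -- k*(P_ℓ, P_c) / ℓ is nearly attained already for some ℓ₁ bounded in terms of N and c alone.
  compress : ∀ N q → 1 ≤ N → ∀ α → count c₂ α ≡ q →
    ∃₂ λ p₁ z → suc p₁ ≤ pBound N q (suc q) × z ≤ yBound N q (suc q) × z ≤ K p₁ q ×
      N ^ suc q * size α * suc p₁ ≤ suc N ^ suc q * z * suc (count c₁ α)
  compress N q 1≤N α refl with downscale {N} 1≤N (word-stage α) (suc q) ≤-refl
  ... | X′ , Y′ , P′ , S , quality = go (P′ (suc q)) refl (Profile.P-pos (Stage.profile S) q)
    where
    go : ∀ ℓ₁ → P′ (suc q) ≡ ℓ₁ → 1 ≤ ℓ₁ → ∃₂ λ p₁ z → suc p₁ ≤ pBound N q (suc q) × z ≤ yBound N q (suc q) × z ≤ K p₁ q ×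
      N ^ suc q * size α * suc p₁ ≤ suc N ^ suc q * z * suc (count c₁ α)
    go (suc p₁) e _ = p₁ , Y′ (suc q) , ≤-trans (≤-reflexive (sym e)) (Stage.P-bound S) , Stage.Y-bound S ,
      profile≤K (Stage.profile S) (Stage.X-mono S) (Stage.Y-mono S) p₁ (Y′ (suc q))
        (λ lt → ⊥-elim (<⇒≱ lt (≤-reflexive e))) (λ _ → ≤-refl) ,
      ≤-trans (*-mono-≤ (*-monoʳ-≤ (N ^ suc q) (≤-trans (≤-reflexive (sym (wordY-end α))) (≤-runningMax (wordY α) (suc q)))) (≤-reflexive (sym e)))
        (≤-trans quality (≤-reflexive (cong (suc N ^ suc q * Y′ (suc q) *_) (wordP-end α))))

  -- Compression at the crudest accuracy `N = 1` already gives a linear bound. The `suc` makes it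
  -- positive, which `accuracy` relies on.
  linearBound : ℕ → ℕ
  linearBound q = suc (2 ^ suc q * yBound 1 q (suc q))

  K-linear : ∀ p q → K p q ≤ linearBound q * suc p
  K-linear p q with compress 1 q ≤-refl (word (bestWord p q)) (twos≡ (bestWord p q))
  ... | p₁ , z , _ , z≤ , _ , h = begin
    K p q  ≤⟨ m≤m*n (K p q) (suc p₁) ⟩
    K p q * suc p₁  ≡⟨ cong (_* suc p₁) (sym (trans (cong (_* K p q) (^-zeroˡ (suc q))) (*-identityˡ (K p q)))) ⟩
    1 ^ suc q * K p q * suc p₁  ≤⟨ h ⟩
    2 ^ suc q * z * suc (count c₁ (word (bestWord p q))) ≡⟨ cong (λ n → 2 ^ suc q * z * suc n) (ones≡ (bestWord p q)) ⟩
    2 ^ suc q * z * suc p  ≤⟨ *-monoˡ-≤ (suc p) (≤-trans (*-monoʳ-≤ (2 ^ suc q) z≤) (n≤1+n _)) ⟩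
    linearBound q * suc p  ∎
    where open ≤-Reasoning

  -- This is `(1 + 1/N)^c ≤ 1 + 3^c / N`. In the step, each of the terms `N`, `t * N` and `t` with
  -- `t = 3 ^ c` is at most `t * N`.
  power-ratio : ∀ N → 1 ≤ N → ∀ c → N * suc N ^ c ≤ (N + 3 ^ c) * N ^ c
  power-ratio N 1≤N zero = ≤-trans (≤-reflexive (*-identityʳ N)) (≤-trans (m≤m+n N 1) (≤-reflexive (sym (*-identityʳ (N + 1)))))
  power-ratio N 1≤N (suc c) = begin
    N * (suc N * suc N ^ c)  ≡⟨ ring₁ N (suc N) (suc N ^ c) ⟩
    suc N * (N * suc N ^ c)  ≤⟨ *-monoʳ-≤ (suc N) (power-ratio N 1≤N c) ⟩
    suc N * ((N + 3 ^ c) * N ^ c)  ≡⟨ ring₂ N (3 ^ c) (N ^ c) ⟩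
    (N * N + N * 1 + 3 ^ c * N + 1 * 3 ^ c) * N ^ c ≤⟨ *-monoˡ-≤ (N ^ c) (+-mono-≤ (+-monoˡ-≤ (3 ^ c * N) (+-monoʳ-≤ (N * N)
        (*-monoʳ-≤ N (m^n>0 3 c)))) (*-monoˡ-≤ (3 ^ c) 1≤N)) ⟩
    (N * N + N * 3 ^ c + 3 ^ c * N + N * 3 ^ c) * N ^ c ≡⟨ ring₃ N (3 ^ c) (N ^ c) ⟩
    (N + 3 * 3 ^ c) * (N * N ^ c)  ∎
    where
    open ≤-Reasoning
    ring₁ : ∀ a b c → a * (b * c) ≡ b * (a * c)
    ring₁ = solve-∀
    ring₂ : ∀ n t m → (1 + n) * ((n + t) * m) ≡ (n * n + n * 1 + t * n + 1 * t) * m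
    ring₂ = solve-∀
    ring₃ : ∀ n t m → (n * n + n * t + t * n + n * t) * m ≡ (n + 3 * t) * (n * m)
    ring₃ = solve-∀

  archimedes : ∀ {a b d n} → a * n ≤ b * n + d → d < n → a ≤ b
  archimedes {a} {b} {d} {n} h d<n = ≮⇒≥ λ b<a → <⇒≱ d<n (+-cancelˡ-≤ (b * n) _ _ (begin
    b * n + n  ≡⟨ +-comm (b * n) n ⟩
    suc b * n  ≤⟨ *-monoˡ-≤ n b<a ⟩
    a * n  ≤⟨ h ⟩
    b * n + d  ∎))
    where open ≤-Reasoning

  β≤size : ∀ α → βα α ≤ size α
  β≤size α = s≤s (m≤n+m (minSum (xs₂ α)) (minSum (xs₁ α)))

  -- Bounds `βα` of optimal words up to the compressed length, through `β≤size` and `K-linear`.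
  overhead : ℕ → ℕ → ℕ
  overhead N q = linearBound q * pBound N q (suc q)

  -- `long` relates the slope of `α` to the size at a huge length `ℓ∞`. `short` compresses that size
  -- to a bounded length and extends an optimal word found there to the given `ℓ`. Only the bounded
  -- word contributes to the overhead, which hence does not depend on `α`.
  slope-bound : ∀ {a d} N q → 1 ≤ N → ∀ α → count c₂ α ≡ q → SlopeAtLeast a (suc d) (xs₁ α) (βα α) →
    ∀ p → pBound N q (suc q) ≤ suc p → ∀ {k} → IsKStar (suc p) (suc q) k →
    N * (suc p * a) ≤ suc d * ((N + 3 ^ suc q) * (k + overhead N q))
  slope-bound {a} {d} N q 1≤N α twos≡q slope p p≥ {k} kstar = *-cancelʳ-≤ _ _ (N ^ c) {{m^n≢0 N c {{>-nonZero 1≤N}}}} (begin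
    N * (ℓ * a) * N ^ c  ≡⟨ ring₁ N (ℓ * a) (N ^ c) ⟩
    N * (N ^ c * (ℓ * a))  ≤⟨ *-monoʳ-≤ N main ⟩
    N * (suc d * (suc N ^ c * (k + R)))  ≡⟨ ring₂ N (suc d) (suc N ^ c) (k + R) ⟩
    suc d * (k + R) * (N * suc N ^ c)  ≤⟨ *-monoʳ-≤ (suc d * (k + R)) (power-ratio N 1≤N c) ⟩
    suc d * (k + R) * ((N + 3 ^ c) * N ^ c)  ≡⟨ ring₃ (suc d) (k + R) (N + 3 ^ c) (N ^ c) ⟩
    suc d * ((N + 3 ^ c) * (k + R)) * N ^ c  ∎)
    where
    open ≤-Reasoning
    c = suc q
    ℓ = suc p
    R = overhead N q
    ring₁ : ∀ n l m → n * l * m ≡ n * (m * l)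
    ring₁ = solve-∀
    ring₂ : ∀ n d s z → n * (d * (s * z)) ≡ d * z * (n * s)
    ring₂ = solve-∀
    ring₃ : ∀ d z t m → d * z * (t * m) ≡ d * (t * z) * m
    ring₃ = solve-∀
    -- Exactly the additive error caused by `βα α` in `main`. As the length `ℓ∞` exceeds it,
    -- `archimedes` removes the error completely.
    excess = suc d * (N ^ c * ℓ * βα α)
    α∞ = α ++ ones excess
    ℓ∞ = suc (count c₁ α) + excess
    S = size α∞
    ones∞ : suc (count c₁ α∞) ≡ ℓ∞
    ones∞ = cong suc (trans (count-++ c₁ α (ones excess)) (cong (count c₁ α +_) (count₁-ones excess)))
    twos∞ : count c₂ α∞ ≡ q
    twos∞ = trans (count-++ c₂ α (ones excess)) (trans (cong₂ _+_ twos≡q (count₂-ones excess)) (+-identityʳ q))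
    long : a * ℓ∞ ≤ suc d * (S + βα α)
    long = ≤-trans (*-monoʳ-≤ a (n≤1+n ℓ∞)) (slope-size {a} {suc d} α excess slope)
    short : N ^ c * S * ℓ ≤ suc N ^ c * ℓ∞ * (k + R)
    short =
      let p₁ , z , p₁< , _ , z≤ , h = compress N q 1≤N α∞ twos∞
          r , r≤ , slope₁ = optimal-slope p₁ q
      in via p₁ z r p₁< z≤ h r≤ slope₁
      where
      via : ∀ p₁ z r → suc p₁ ≤ pBound N q (suc q) → z ≤ K p₁ q → N ^ c * S * suc p₁ ≤ suc N ^ c * z * suc (count c₁ α∞) →
        r ≤ p₁ → SlopeAtLeast (K p₁ q) (suc p₁) (xs₁ (word (bestWord r q))) (βα (word (bestWord r q))) →
        N ^ c * S * ℓ ≤ suc N ^ c * ℓ∞ * (k + R)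
      via p₁ z r p₁< z≤ h r≤ slope₁ = *-cancelʳ-≤ _ _ (suc p₁) (begin
        N ^ c * S * ℓ * suc p₁  ≡⟨ ring₄ (N ^ c * S) ℓ (suc p₁) ⟩
        N ^ c * S * suc p₁ * ℓ  ≤⟨ *-monoˡ-≤ ℓ h ⟩
        suc N ^ c * z * suc (count c₁ α∞) * ℓ  ≡⟨ cong (λ n → suc N ^ c * z * n * ℓ) ones∞ ⟩
        suc N ^ c * z * ℓ∞ * ℓ  ≡⟨ ring₅ (suc N ^ c) z ℓ∞ ℓ ⟩
        suc N ^ c * ℓ∞ * (z * ℓ)  ≤⟨ *-monoʳ-≤ (suc N ^ c * ℓ∞) last ⟩
        suc N ^ c * ℓ∞ * (suc p₁ * (k + R))  ≡⟨ ring₆ (suc N ^ c * ℓ∞) (suc p₁) (k + R) ⟩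
        suc N ^ c * ℓ∞ * (k + R) * suc p₁  ∎)
        where
        ring₄ : ∀ x y z → x * y * z ≡ x * z * y
        ring₄ = solve-∀
        ring₅ : ∀ x z l m → x * z * l * m ≡ x * l * (z * m)
        ring₅ = solve-∀
        ring₆ : ∀ x y z → x * (y * z) ≡ x * z * y
        ring₆ = solve-∀
        B = bestWord r q
        γ = word B
        r≤p : r ≤ p
        r≤p = ≤-trans r≤ (s≤s⁻¹ (≤-trans p₁< p≥))
        γ∞ = γ ++ ones (p ∸ r)
        sizeγ∞≤k : size γ∞ ≤ k
        sizeγ∞≤k = size≤kStar kstar γ∞
          (trans (count-++ c₁ γ (ones (p ∸ r))) (trans (cong₂ _+_ (ones≡ B) (count₁-ones (p ∸ r))) (m+[n∸m]≡n r≤p)))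
          (trans (count-++ c₂ γ (ones (p ∸ r))) (trans (cong₂ _+_ (twos≡ B) (count₂-ones (p ∸ r))) (+-identityʳ q)))
        βγ≤R : βα γ ≤ R
        βγ≤R = ≤-trans (β≤size γ) (≤-trans (K-linear r q) (*-monoʳ-≤ (linearBound q) (≤-trans (s≤s r≤) p₁<)))
        total : suc (count c₁ γ) + (p ∸ r) ≡ ℓ
        total = cong suc (trans (cong (_+ (p ∸ r)) (ones≡ B)) (m+[n∸m]≡n r≤p))
        last : z * ℓ ≤ suc p₁ * (k + R)
        last = begin
          z * ℓ  ≤⟨ *-mono-≤ z≤ (n≤1+n ℓ) ⟩
          K p₁ q * suc ℓ  ≡⟨ cong (λ n → K p₁ q * suc n) (sym total) ⟩
          K p₁ q * suc (suc (count c₁ γ) + (p ∸ r))  ≤⟨ slope-size {K p₁ q} {suc p₁} γ (p ∸ r) slope₁ ⟩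
          suc p₁ * (size γ∞ + βα γ)  ≤⟨ *-monoʳ-≤ (suc p₁) (+-mono-≤ sizeγ∞≤k βγ≤R) ⟩
          suc p₁ * (k + R)  ∎
    main : N ^ c * (ℓ * a) ≤ suc d * (suc N ^ c * (k + R))
    main = archimedes {d = excess} {n = ℓ∞} (begin
      N ^ c * (ℓ * a) * ℓ∞  ≡⟨ ring₇ (N ^ c) ℓ a ℓ∞ ⟩
      N ^ c * ℓ * (a * ℓ∞)  ≤⟨ *-monoʳ-≤ (N ^ c * ℓ) long ⟩
      N ^ c * ℓ * (suc d * (S + βα α))  ≡⟨ ring₈ (N ^ c) ℓ (suc d) S (βα α) ⟩
      suc d * (N ^ c * S * ℓ) + excess  ≤⟨ +-monoˡ-≤ excess (*-monoʳ-≤ (suc d) short) ⟩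
      suc d * (suc N ^ c * ℓ∞ * (k + R)) + excess  ≡⟨ cong (_+ excess) (ring₉ (suc d) (suc N ^ c) ℓ∞ (k + R)) ⟩
      suc d * (suc N ^ c * (k + R)) * ℓ∞ + excess  ∎) (s≤s (m≤n+m excess (count c₁ α)))
      where
      ring₇ : ∀ n l a m → n * (l * a) * m ≡ n * l * (a * m)
      ring₇ = solve-∀
      ring₈ : ∀ n l d s b → n * l * (d * (s + b)) ≡ d * (n * s * l) + d * (n * l * b)
      ring₈ = solve-∀
      ring₉ : ∀ d s l z → d * (s * l * z) ≡ d * (s * z) * l
      ring₉ = solve-∀

  -- Of the error `N * ℓ` allowed, `accuracy` makes the power loss at most half, using that `k` is
  -- at most `linearBound q * ℓ`, and the second summand of `threshold` makes the overhead at most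
  -- the other half. The first summand lets the compressed length fit below `ℓ`.
  accuracy threshold : ℕ → ℕ → ℕ
  accuracy F q = 2 * (3 ^ suc q * (linearBound q * F))
  threshold F q = pBound (accuracy F q) q (suc q) + 2 * (F * (overhead (accuracy F q) q * (1 + 3 ^ suc q)))

  kStar-lower : ∀ {a d} F q → 1 ≤ F → ∀ α → count c₂ α ≡ q → SlopeAtLeast a (suc d) (xs₁ α) (βα α) →
    ∀ p → threshold F q ≤ suc p → ∀ {k} → IsKStar (suc p) (suc q) k →
    a * suc p * F ≤ suc d * (k * F + suc p)
  kStar-lower {a} {d} F q 1≤F α twos≡q slope p p≥ {k} kstar = *-cancelˡ-≤ N {{>-nonZero 1≤N}} (begin
    N * (a * ℓ * F)  ≡⟨ ring₁ N a ℓ F ⟩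
    N * (ℓ * a) * F  ≤⟨ *-monoˡ-≤ F (slope-bound {a} {d} N q 1≤N α twos≡q slope p (≤-trans (m≤m+n _ _) p≥) kstar) ⟩
    suc d * ((N + T) * (k + R)) * F  ≡⟨ ring₂ (suc d) N T k R F ⟩
    suc d * (N * (k * F) + (T * F * k + F * (R * (N + T)))) ≤⟨ *-monoʳ-≤ (suc d) (+-monoʳ-≤ (N * (k * F)) (*-cancelˡ-≤ 2 error)) ⟩
    suc d * (N * (k * F) + N * ℓ)  ≡⟨ ring₃ (suc d) N (k * F) ℓ ⟩
    N * (suc d * (k * F + ℓ))  ∎)
    where
    open ≤-Reasoning
    N = accuracy F q
    T = 3 ^ suc q
    C = linearBound q
    R = overhead N q
    ℓ = suc p
    1≤N : 1 ≤ N
    1≤N = ≤-trans (*-mono-≤ (m^n>0 3 (suc q)) (*-mono-≤ (s≤s (z≤n {2 ^ suc q * yBound 1 q (suc q)})) 1≤F)) (m≤n*m (T * (C * F)) 2)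
    ring₁ : ∀ n a l f → n * (a * l * f) ≡ n * (l * a) * f
    ring₁ = solve-∀
    ring₂ : ∀ d n t k r f → d * ((n + t) * (k + r)) * f ≡ d * (n * (k * f) + (t * f * k + f * (r * (n + t))))
    ring₂ = solve-∀
    ring₃ : ∀ d n k l → d * (n * k + n * l) ≡ n * (d * (k + l))
    ring₃ = solve-∀
    k≤ : k ≤ C * ℓ
    k≤ = ≤-trans (kStar≤K kstar) (K-linear p q)
    error₁ : 2 * (T * F * k) ≤ N * ℓ
    error₁ = begin
      2 * (T * F * k)  ≤⟨ *-monoʳ-≤ 2 (*-monoʳ-≤ (T * F) k≤) ⟩
      2 * (T * F * (C * ℓ))  ≡⟨ ring T F C ℓ ⟩
      2 * (T * (C * F)) * ℓ  ∎
      where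
      ring : ∀ t f c l → 2 * (t * f * (c * l)) ≡ 2 * (t * (c * f)) * l
      ring = solve-∀
    error₂ : 2 * (F * (R * (N + T))) ≤ N * ℓ
    error₂ = begin
      2 * (F * (R * (N + T)))  ≤⟨ *-monoʳ-≤ 2 (*-monoʳ-≤ F (*-monoʳ-≤ R (+-monoʳ-≤ N (m≤n*m T N {{>-nonZero 1≤N}})))) ⟩
      2 * (F * (R * (N + N * T)))  ≡⟨ ring F R N T ⟩
      N * (2 * (F * (R * (1 + T))))  ≤⟨ *-monoʳ-≤ N (≤-trans (m≤n+m _ (pBound N q (suc q))) p≥) ⟩
      N * ℓ  ∎
      where
      ring : ∀ f r n t → 2 * (f * (r * (n + n * t))) ≡ n * (2 * (f * (r * (1 + t))))
      ring = solve-∀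
    error : 2 * (T * F * k + F * (R * (N + T))) ≤ 2 * (N * ℓ)
    error = begin
      2 * (T * F * k + F * (R * (N + T)))  ≡⟨ *-distribˡ-+ 2 (T * F * k) _ ⟩
      2 * (T * F * k) + 2 * (F * (R * (N + T)))  ≤⟨ +-mono-≤ error₁ error₂ ⟩
      N * ℓ + N * ℓ  ≡⟨ cong (N * ℓ +_) (sym (+-identityʳ (N * ℓ))) ⟩
      2 * (N * ℓ)  ∎

-- Translation between rational and integer inequalities.

module Ratios where
  open MinSumLists
  open Words
  open import Data.Nat as ℕ using (ℕ; zero; suc; z≤n; s≤s)
  import Data.Nat.Properties as ℕₚ
  open import Data.Nat.Coprimality using (Coprime)
  open import Data.Integer as ℤ using (ℤ; +_; +≤+)
  import Data.Integer.Properties as ℤₚ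
  open import Data.Integer.Tactic.RingSolver using (solve-∀)
  open import Data.Rational as ℚ using (ℚ; mkℚ; _/_; toℚᵘ)
  import Data.Rational.Properties as ℚₚ
  open import Data.Rational.Unnormalised as ℚᵘ using (mkℚᵘ)
  import Data.Rational.Unnormalised.Properties as ℚᵘₚ

  toℚᵘ-/ : ∀ i d → toℚᵘ (i / suc d) ℚᵘ.≃ mkℚᵘ i d
  toℚᵘ-/ i d = ℚₚ.toℚᵘ-fromℚᵘ (mkℚᵘ i d)

  toℚᵘ-*-ℕ : ∀ q n → toℚᵘ (q ℚ.* ℕtoℚ n) ℚᵘ.≃ toℚᵘ q ℚᵘ.* mkℚᵘ (+ n) 0
  toℚᵘ-*-ℕ q n = ℚᵘₚ.≃-trans (ℚₚ.toℚᵘ-homo-* q (ℕtoℚ n)) (ℚᵘₚ.*-congˡ {toℚᵘ q} (toℚᵘ-/ (+ n) 0))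

  ratio-> : ∀ q p k m j → q ℚ.* ℕtoℚ (suc p) ℚ.< ℕtoℚ k → k ℕ.* suc j ℕ.≤ suc p ℕ.* m → q ℚ.< (+ m) / suc j
  ratio-> q@(mkℚ a b _) p k m j q< le = ℚₚ.toℚᵘ-cancel-< (ℚᵘₚ.<-respʳ-≃ (ℚᵘₚ.≃-sym (toℚᵘ-/ (+ m) j))
    (ℚᵘ.*<* (ℤₚ.*-cancelˡ-<-nonNeg (+ suc p) (begin-strict
      + suc p ℤ.* (a ℤ.* + suc j)  ≡⟨ ring₁ (+ suc p) a (+ suc j) ⟩
      a ℤ.* + suc p ℤ.* + 1 ℤ.* + suc j  <⟨ ℤₚ.*-monoʳ-<-pos (+ suc j) below ⟩
      + k ℤ.* + suc (b ℕ.* 1) ℤ.* + suc j  ≡⟨ cong (λ z → + k ℤ.* + suc z ℤ.* + suc j) (ℕₚ.*-identityʳ b) ⟩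
      + k ℤ.* + suc b ℤ.* + suc j  ≡⟨ ring₂ (+ k) (+ suc b) (+ suc j) ⟩
      + k ℤ.* + suc j ℤ.* + suc b  ≡⟨ cong (ℤ._* + suc b) (sym (ℤₚ.pos-* k (suc j))) ⟩
      + (k ℕ.* suc j) ℤ.* + suc b  ≤⟨ ℤₚ.*-monoʳ-≤-nonNeg (+ suc b) (+≤+ le) ⟩
      + (suc p ℕ.* m) ℤ.* + suc b  ≡⟨ cong (ℤ._* + suc b) (ℤₚ.pos-* (suc p) m) ⟩
      + suc p ℤ.* + m ℤ.* + suc b  ≡⟨ ℤₚ.*-assoc (+ suc p) (+ m) (+ suc b) ⟩
      + suc p ℤ.* (+ m ℤ.* + suc b)  ∎))))
    where
    open ℤₚ.≤-Reasoning
    ring₁ : ∀ p a j → p ℤ.* (a ℤ.* j) ≡ a ℤ.* p ℤ.* + 1 ℤ.* j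
    ring₁ = solve-∀
    ring₂ : ∀ k b j → k ℤ.* b ℤ.* j ≡ k ℤ.* j ℤ.* b
    ring₂ = solve-∀
    below : a ℤ.* + suc p ℤ.* + 1 ℤ.< + k ℤ.* + suc (b ℕ.* 1)
    below = ℚᵘₚ.drop-*<* (ℚᵘₚ.<-respʳ-≃ (toℚᵘ-/ (+ k) 0) (ℚᵘₚ.<-respˡ-≃ (toℚᵘ-*-ℕ q (suc p)) (ℚₚ.toℚᵘ-mono-< q<)))

  ratio-≥ : ∀ a d .(c : Coprime a (suc d)) m j → mkℚ (+ a) d c ℚ.≤ (+ m) / suc j → a ℕ.* suc j ℕ.≤ suc d ℕ.* m
  ratio-≥ a d c m j le = ℕₚ.≤-trans (ℤₚ.drop‿+≤+ (subst₂ ℤ._≤_ (sym (ℤₚ.pos-* a (suc j))) (sym (ℤₚ.pos-* m (suc d)))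
    (ℚᵘₚ.drop-*≤* (ℚᵘₚ.≤-respʳ-≃ (toℚᵘ-/ (+ m) j) (ℚₚ.toℚᵘ-mono-≤ le))))) (ℕₚ.≤-reflexive (ℕₚ.*-comm m (suc d)))

  -- The rational `ε` is at least `1 / suc f`, so an integer estimate with `F = suc f` is enough.
  -- Allowing `i` below `a` covers negative values of `v` with `a = 0`.
  ratio-bound : ∀ i d .(c : Coprime ℤ.∣ i ∣ (suc d)) a ℓ k e f .(c′ : Coprime (suc e) (suc f)) → i ℤ.≤ + a → a ℕ.* ℓ ℕ.* suc f ℕ.≤ suc d ℕ.* (k ℕ.* suc f ℕ.+ ℓ) →
    mkℚ i d c ℚ.* ℕtoℚ ℓ ℚ.≤ ℕtoℚ k ℚ.+ mkℚ (+ suc e) f c′ ℚ.* ℕtoℚ ℓ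
  ratio-bound i d c a ℓ k e f c′ i≤a le = ℚₚ.toℚᵘ-cancel-≤
    (ℚᵘₚ.≤-respˡ-≃ (ℚᵘₚ.≃-sym (toℚᵘ-*-ℕ v ℓ)) (ℚᵘₚ.≤-respʳ-≃ (ℚᵘₚ.≃-sym rhs) (ℚᵘ.*≤* (begin
      i ℤ.* + ℓ ℤ.* + suc (f ℕ.* 1 ℕ.+ 0)  ≡⟨ cong (λ z → i ℤ.* + ℓ ℤ.* + suc z) (trans (ℕₚ.+-identityʳ _) (ℕₚ.*-identityʳ f)) ⟩
      i ℤ.* + ℓ ℤ.* + suc f  ≤⟨ ℤₚ.*-monoʳ-≤-nonNeg (+ suc f) (ℤₚ.*-monoʳ-≤-nonNeg (+ ℓ) i≤a) ⟩
      + a ℤ.* + ℓ ℤ.* + suc f  ≡⟨ trans (cong (ℤ._* + suc f) (sym (ℤₚ.pos-* a ℓ))) (sym (ℤₚ.pos-* (a ℕ.* ℓ) (suc f))) ⟩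
      + (a ℕ.* ℓ ℕ.* suc f)  ≤⟨ +≤+ (ℕₚ.≤-trans le (ℕₚ.*-monoʳ-≤ (suc d) (ℕₚ.+-monoʳ-≤ (k ℕ.* suc f) (ℕₚ.m≤n*m ℓ (suc e))))) ⟩
      + (suc d ℕ.* (k ℕ.* suc f ℕ.+ suc e ℕ.* ℓ))  ≡⟨ ℤₚ.pos-* (suc d) _ ⟩
      + suc d ℤ.* + (k ℕ.* suc f ℕ.+ suc e ℕ.* ℓ)  ≡⟨ cong (+ suc d ℤ.*_) (trans (ℤₚ.pos-+ (k ℕ.* suc f) _) (cong₂ ℤ._+_ (ℤₚ.pos-* k (suc f)) (ℤₚ.pos-* (suc e) ℓ))) ⟩
      + suc d ℤ.* (+ k ℤ.* + suc f ℤ.+ + suc e ℤ.* + ℓ)  ≡⟨ ring (+ suc d) (+ k) (+ suc f) (+ suc e) (+ ℓ) ⟩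
      (+ k ℤ.* + suc f ℤ.+ + suc e ℤ.* + ℓ ℤ.* + 1) ℤ.* + suc d  ≡⟨ cong₂ (λ z z′ → (+ k ℤ.* + suc z ℤ.+ + suc e ℤ.* + ℓ ℤ.* + 1) ℤ.* + suc z′)
          (sym (ℕₚ.*-identityʳ f)) (sym (ℕₚ.*-identityʳ d)) ⟩
      (+ k ℤ.* + suc (f ℕ.* 1) ℤ.+ + suc e ℤ.* + ℓ ℤ.* + 1) ℤ.* + suc (d ℕ.* 1) ∎))))
    where
    open ℤₚ.≤-Reasoning
    v ε : ℚ
    v = mkℚ i d c
    ε = mkℚ (+ suc e) f c′
    ring : ∀ d k f e l → d ℤ.* (k ℤ.* f ℤ.+ e ℤ.* l) ≡ (k ℤ.* f ℤ.+ e ℤ.* l ℤ.* + 1) ℤ.* d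
    ring = solve-∀
    rhs : toℚᵘ (ℕtoℚ k ℚ.+ ε ℚ.* ℕtoℚ ℓ) ℚᵘ.≃ mkℚᵘ (+ k) 0 ℚᵘ.+ (mkℚᵘ (+ suc e) f ℚᵘ.* mkℚᵘ (+ ℓ) 0)
    rhs = ℚᵘₚ.≃-trans (ℚₚ.toℚᵘ-homo-+ (ℕtoℚ k) (ε ℚ.* ℕtoℚ ℓ)) (ℚᵘₚ.+-cong (toℚᵘ-/ (+ k) 0) (toℚᵘ-*-ℕ ε ℓ))

  foldr-⊓-≤ʰ : ∀ q qs → foldr ℚ._⊓_ q qs ℚ.≤ q
  foldr-⊓-≤ʰ q []       = ℚₚ.≤-refl
  foldr-⊓-≤ʰ q (r ∷ qs) = ℚₚ.≤-trans (ℚₚ.p⊓q≤q r _) (foldr-⊓-≤ʰ q qs)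

  foldr-⊓-≤ᵗ : ∀ {x} q qs → x ∈ qs → foldr ℚ._⊓_ q qs ℚ.≤ x
  foldr-⊓-≤ᵗ q (r ∷ qs) (here refl) = ℚₚ.p⊓q≤p r _
  foldr-⊓-≤ᵗ q (r ∷ qs) (there x∈)  = ℚₚ.≤-trans (ℚₚ.p⊓q≤q r _) (foldr-⊓-≤ᵗ q qs x∈)

  minℚ-≤ : ∀ {x} qs → x ∈ qs → minℚ qs ℚ.≤ x
  minℚ-≤ (q ∷ qs) (here refl) = foldr-⊓-≤ʰ q qs
  minℚ-≤ (q ∷ qs) (there x∈)  = foldr-⊓-≤ᵗ q qs x∈

  foldr-⊓-> : ∀ {x} q qs → x ℚ.< q → All (x ℚ.<_) qs → x ℚ.< foldr ℚ._⊓_ q qs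
  foldr-⊓-> q []       h _        = h
  foldr-⊓-> {x} q (r ∷ qs) h (p ∷ ps) with ℚₚ.⊓-sel r (foldr ℚ._⊓_ q qs)
  ... | inj₁ e = subst (x ℚ.<_) (sym e) p
  ... | inj₂ e = subst (x ℚ.<_) (sym e) (foldr-⊓-> q qs h ps)

  minℚ-> : ∀ {x} qs → 1 ℕ.≤ length qs → All (x ℚ.<_) qs → x ℚ.< minℚ qs
  minℚ-> (q ∷ qs) _ (p ∷ ps) = foldr-⊓-> q qs p ps

  ratios-∈ : ∀ β xs i j l → l ≡ i ℕ.+ j → j ℕ.< length xs → (+ (at xs j ℕ.+ β)) / suc l ∈ ratios β xs i
  ratios-∈ β (x ∷ xs) i zero    l e _       = here (cong (λ z → (+ (x ℕ.+ β)) / suc z) (trans e (ℕₚ.+-identityʳ i)))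
  ratios-∈ β (x ∷ xs) i (suc j) l e (s≤s h) = there (ratios-∈ β xs (suc i) j l (trans e (ℕₚ.+-suc i j)) h)

  ratios-all : ∀ {P : ℚ → Set} β xs i → (∀ j l → l ≡ i ℕ.+ j → j ℕ.< length xs → P ((+ (at xs j ℕ.+ β)) / suc l)) →
    All P (ratios β xs i)
  ratios-all β []       i h = []
  ratios-all β (x ∷ xs) i h = h 0 i (sym (ℕₚ.+-identityʳ i)) (s≤s z≤n) ∷
    ratios-all β xs (suc i) (λ j l e j< → h (suc j) l (trans e (sym (ℕₚ.+-suc i j))) (s≤s j<))

  length-ratios : ∀ β xs i → length (ratios β xs i) ≡ length xs
  length-ratios β []       i = refl
  length-ratios β (x ∷ xs) i = cong suc (length-ratios β xs (suc i))

  δα-> : ∀ q p k α → q ℚ.* ℕtoℚ (suc p) ℚ.< ℕtoℚ k → SlopeAtLeast k (suc p) (xs₁ α) (βα α) → q ℚ.< δα α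
  δα-> q p k α q< h = minℚ-> (ratios (βα α) (xs₁ α) 0)
    (subst (1 ℕ.≤_) (sym (trans (length-ratios (βα α) (xs₁ α) 0) (length₁ (word-state α)))) (s≤s z≤n))
    (ratios-all (βα α) (xs₁ α) 0 λ { j .j refl j< → ratio-> q p k (at (xs₁ α) j ℕ.+ βα α) j q< (h j j<) })

  δα-slope : ∀ α a d .(c : Coprime a (suc d)) → δα α ≡ mkℚ (+ a) d c → SlopeAtLeast a (suc d) (xs₁ α) (βα α)
  δα-slope α a d c e j j< = ratio-≥ a d c (at (xs₁ α) j ℕ.+ βα α) j
    (subst (ℚ._≤ (+ (at (xs₁ α) j ℕ.+ βα α)) / suc j) e (minℚ-≤ (ratios (βα α) (xs₁ α) 0) (ratios-∈ (βα α) (xs₁ α) 0 j j refl j<)))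

-- Both bounds in terms of the set defining δ(c).

module Supremum where
  open MinSumLists
  open Words
  open GameValue
  open Ratios
  open import Data.Nat using (ℕ; zero; suc; _+_; _≤_; z≤n; s≤s)
  open import Data.Nat.Properties using (≤-trans; ≤-reflexive; +-identityʳ)
  open import Data.Integer using (+_; -[1+_]; -≤+; +<+)
  import Data.Integer.Properties as ℤₚ
  open import Data.Rational as ℚ using (ℚ; mkℚ; 0ℚ; 1ℚ)

  delta-word : ∀ {q v} → DeltaVal (suc q) v → ∃ λ α → count c₂ α ≡ q × δα α ≡ v
  delta-word (inj₁ (refl , refl))                       = [] , refl , refl
  delta-word (inj₂ (_ , _ , _ , α , (_ , e , _) , refl)) = α , e , refl

  module _ {p q : ℕ} {r : ℚ} {k : ℕ} (r< : r ℚ.* ℕtoℚ (suc p) ℚ.< ℕtoℚ k) (α : List Color) (twos≡q : count c₂ α ≡ q)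
    (slope : SlopeAtLeast k (suc p) (xs₁ α) (βα α)) where

    stripped : ∀ α₀ t → α ≡ α₀ ++ ones t → r ℚ.< δα α₀
    stripped α₀ t e = δα-> r p k α₀ r< (slope-prefix {k} {suc p} α₀ t
      (subst (λ α → SlopeAtLeast k (suc p) (xs₁ α) (βα α)) e slope))

    ending-in-two : ∀ {q′} → suc q′ ≡ q → ∀ α′ t → α ≡ (α′ ++ [ c₂ ]) ++ ones t → Σ ℚ λ v → DeltaVal (suc q) v × r ℚ.< v
    ending-in-two refl α′ t e = δα (α′ ++ [ c₂ ]) ,
      inj₂ (s≤s (s≤s z≤n) , suc (count c₁ (α′ ++ [ c₂ ])) , s≤s z≤n , α′ ++ [ c₂ ] , (refl , twos′ , α′ , refl) , refl) ,
      stripped (α′ ++ [ c₂ ]) t e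
      where
      twos′ : count c₂ (α′ ++ [ c₂ ]) ≡ q
      twos′ = trans (sym (trans (count-++ c₂ (α′ ++ [ c₂ ]) (ones t)) (trans (cong (λ z → count c₂ (α′ ++ [ c₂ ]) + z) (count₂-ones t)) (+-identityʳ _))))
        (trans (cong (count c₂) (sym e)) twos≡q)

    delta-of-slope : ∀ q′ → q′ ≡ q → Σ ℚ λ v → DeltaVal (suc q) v × r ℚ.< v
    -- A word without twos is stripped to the empty word, whose `δα` evaluates to 1, the value fixed
    -- for `c = 1`.
    delta-of-slope zero refl = 1ℚ , inj₁ (refl , refl) , stripped [] (count c₁ α) (no-twos α twos≡q)
    delta-of-slope (suc q′) e =
      let α′ , t , eq = last-two α (≤-trans (s≤s z≤n) (≤-reflexive (trans e (sym twos≡q))))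
      in ending-in-two e α′ t eq

  -- The bound by the supremum without forming it: every rational below the quotient of the game
  -- value by the length is exceeded by some element of the set.
  kStar-≤-delta : ∀ p q r → r ℚ.* ℕtoℚ (suc p) ℚ.< ℕtoℚ (K p q) → Σ ℚ λ v → DeltaVal (suc q) v × r ℚ.< v
  kStar-≤-delta p q r r< =
    let p′ , _ , slope = optimal-slope p q
    in delta-of-slope {p} {q} {r} {K p q} r< (word (bestWord p′ q)) (twos≡ (bestWord p′ q)) slope q refl

  -- `L` is chosen before `v`, so the estimate passes to the supremum; this uniformity is what the
  -- compression provides.
  delta-≤-kStar : ∀ q ε → 0ℚ ℚ.< ε → Σ ℕ λ L → ∀ p → L ≤ suc p → ∀ k → IsKStar (suc p) (suc q) k →
    ∀ v → DeltaVal (suc q) v → v ℚ.* ℕtoℚ (suc p) ℚ.≤ ℕtoℚ k ℚ.+ ε ℚ.* ℕtoℚ (suc p)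
  delta-≤-kStar q (mkℚ (+ zero) f _)  (ℚ.*<* (+<+ ()))
  delta-≤-kStar q (mkℚ -[1+ _ ] f _)  (ℚ.*<* ())
  delta-≤-kStar q (mkℚ (+ suc e) f c′) _ = threshold (suc f) q , below
    where
    below : ∀ p → threshold (suc f) q ≤ suc p → ∀ k → IsKStar (suc p) (suc q) k →
      ∀ v → DeltaVal (suc q) v → v ℚ.* ℕtoℚ (suc p) ℚ.≤ ℕtoℚ k ℚ.+ mkℚ (+ suc e) f c′ ℚ.* ℕtoℚ (suc p)
    below p p≥ k kstar (mkℚ -[1+ a ] d c) _ = ratio-bound -[1+ a ] d c 0 (suc p) k e f c′ -≤+ z≤n
    below p p≥ k kstar (mkℚ (+ a) d c) δ with delta-word δ
    ... | α , twos≡q , eq = ratio-bound (+ a) d c a (suc p) k e f c′ ℤₚ.≤-refl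
      (kStar-lower {a} {d} (suc f) q (s≤s z≤n) α twos≡q (δα-slope α a d c eq) p p≥ kstar)

open import Data.Nat using (ℕ; _≤_)
open import Data.Rational using (ℚ; 0ℚ; _+_; _*_; _<_) renaming (_≤_ to _≤ℚ_)
open Data.Nat using (suc; s≤s)

theorem16 : ((c ℓ : ℕ) → 1 ≤ c → 1 ≤ ℓ →
    Σ ℕ λ k → IsKStar ℓ c k ×
    ((q : ℚ) → q * ℕtoℚ ℓ < ℕtoℚ k → Σ ℚ λ v → DeltaVal c v × q < v))
    ×
    ((c : ℕ) → 1 ≤ c → (ε : ℚ) → 0ℚ < ε →
    Σ ℕ λ L → (ℓ : ℕ) → L ≤ ℓ → 1 ≤ ℓ → (k : ℕ) → IsKStar ℓ c k →
    (v : ℚ) → DeltaVal c v → v * ℕtoℚ ℓ ≤ℚ ℕtoℚ k + ε * ℕtoℚ ℓ)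
theorem16 = upper , lower
  where
  open GameValue using (K; K-isKStar)
  open Supremum using (kStar-≤-delta; delta-≤-kStar)

  upper : (c ℓ : ℕ) → 1 ≤ c → 1 ≤ ℓ →
    Σ ℕ λ k → IsKStar ℓ c k ×
    ((q : ℚ) → q * ℕtoℚ ℓ < ℕtoℚ k → Σ ℚ λ v → DeltaVal c v × q < v)
  upper (suc q) (suc p) _ _ = K p q , K-isKStar p q , kStar-≤-delta p q

  lower : (c : ℕ) → 1 ≤ c → (ε : ℚ) → 0ℚ < ε →
    Σ ℕ λ L → (ℓ : ℕ) → L ≤ ℓ → 1 ≤ ℓ → (k : ℕ) → IsKStar ℓ c k →
    (v : ℚ) → DeltaVal c v → v * ℕtoℚ ℓ ≤ℚ ℕtoℚ k + ε * ℕtoℚ ℓ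
  lower (suc q) _ ε ε>0 with delta-≤-kStar q ε ε>0
  ... | L , h = L , λ { (suc p) L≤ _ → h p L≤ }
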